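{- Let $K$ be a finite simplicial complex and let $\tau$ be a simplex (possibly empty) whose vertex set is disjoint from $V_K$. Then $K$ is a minimal $NH$-sphere if and only if $K^{\tau}$ is a minimal $NH$-sphere.
   Context: All simplicial complexes are finite. $\Delta^d$ denotes a $d$-simplex, $\partial\Delta^d$ its boundary; $\{\emptyset\}$ is the complex with only the empty simplex, regarded as the sphere of dimension $-1$. $V_K$ is the vertex set of $K$; $\Delta(V)$ is the simplex spanned by $V$. A simplex is principal in $K$ if it is not a proper face of another simplex; $\mathsf{m}(K)$ is the number of principal simplices. A subcomplex $L\subset K$ is top generated if every principal simplex of $L$ is principal in $K$. $K+L$ denotes union; $lk(v,K)$ is the link. A combinatorial $d$-ball is a complex having a common subdivision with $\Delta^d$; its boundary $\partial L$ is generated by the $(d-1)$-simplices that are faces of exactly one $d$-simplex. A complex is collapsible if some subdivision collapses simplicially to a vertex. $NH$-manifolds/balls/spheres of dimension $0$ are the $0$-dimensional manifolds/balls/spheres; the $NH$-sphere of dimension $-1$ is $\{\emptyset\}$. For $d\ge1$ inductively: an $NH$-manifold of dimension $d$ is a $d$-dimensional complex $M$ such that each vertex link is an $NH$-ball of dimension in $[0,d-1]$ or an $NH$-sphere of dimension in $[-1,d-1]$; an $NH$-ball of dimension $d$ is a collapsible $NH$-manifold of dimension $d$; an $NH$-sphere of dimension $d$ and homotopy dimension $k$ is an $NH$-manifold $S$ of dimension $d$ for which there exist a top generated $NH$-ball $B$ of dimension $d$ and a top generated combinatorial $k$-ball $L$ with $B+L=S$, $B\cap L=\partial L$; write $\dim_h(S)=k$.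 A minimal $NH$-sphere is an $NH$-sphere $S$ with $\mathsf{m}(S)=\dim_h(S)+2$. Alexander dual: for $V\supseteq V_K$, $K^{*_V}=\{\sigma\in\Delta(V):\Delta(V-V_\sigma)\notin K\}$. For a simplex $\tau$ with vertices disjoint from $V_K$, $K^\tau:=K^{*_V}$ with $V=V_K\cup V_\tau$; in particular $K^{\emptyset}=K^*:=K^{*_{V_K}}$.
   Formalization: The case where K has no vertices and τ is empty is excluded: for K={∅}, τ=∅ the dual K^τ has no simplices, so the equivalence fails there; subdivisions are taken with rational barycentric coordinates, which gives the same notions of combinatorial ball and collapsibility. -}

module Defs where

open import Data.Bool using (Bool; true; false; _∧_; _∨_; not; if_then_else_)
import Data.Bool as Bool
open import Data.Nat using (ℕ; zero; suc; _+_; _≤_; _≡ᵇ_)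
open import Data.Fin using (Fin)
import Data.Fin as Fin
open import Data.Fin.Subset using (Subset; ⁅_⁆; _∈_; _∉_; _⊆_; ∁; _∩_; _∪_; ∣_∣; ⊥)
open import Data.Fin.Subset.Properties using (_⊆?_; _∈?_)
open import Data.Vec using (Vec; []; _∷_; tabulate)
open import Data.Vec.Properties using (≡-dec)
open import Data.List using (List; []; _∷_; _++_; map)
open import Data.Nat.ListAction using (sum)
open import Data.Bool.ListAction using (any)
open import Data.Rational using (ℚ; 0ℚ; 1ℚ) renaming (_+_ to _+ℚ_; _*_ to _*ℚ_; _≤_ to _≤ℚ_)
open import Data.Product using (Σ; ∃; ∃-syntax; _×_; _,_)
open import Data.Sum using (_⊎_)
open import Relation.Binary.PropositionalEquality using (_≡_; _≢_)
open import Relation.Nullary.Decidable using (⌊_⌋)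
open import Relation.Binary.Construct.Closure.ReflexiveTransitive using (Star)
open import Function.Bundles using (_⇔_)

-- Finite simplicial complexes.
-- Vertices are labelled by Fin n (every finite complex embeds in such a
-- universe).  A simplex is a finite set of vertices, i.e. a Subset n
-- (the empty subset is the empty simplex).  A complex is the (decidable)
-- family of its simplices, given by a Boolean predicate; it must be
-- closed under taking faces.  The void complex (no simplices) and
-- {∅} (only the empty simplex) are distinct complexes.

Complex : ℕ → Set
Complex n = Subset n → Bool

IsComplex : ∀ {n} → Complex n → Set
IsComplex {n} K = ∀ (σ τ : Subset n) → K σ ≡ true → τ ⊆ σ → K τ ≡ true

_==ₛ_ : ∀ {n} → Subset n → Subset n → Bool
σ ==ₛ τ = ⌊ ≡-dec Bool._≟_ σ τ ⌋

_⊆ᵇ_ : ∀ {n} → Subset n → Subset n → Bool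
σ ⊆ᵇ τ = ⌊ σ ⊆? τ ⌋

_⊂ᵇ_ : ∀ {n} → Subset n → Subset n → Bool
σ ⊂ᵇ τ = (σ ⊆ᵇ τ) ∧ not (σ ==ₛ τ)

allSubsets : ∀ n → List (Subset n)
allSubsets zero = [] ∷ []
allSubsets (suc n) = map (true ∷_) (allSubsets n) ++ map (false ∷_) (allSubsets n)

countB : ∀ {n} → (Subset n → Bool) → ℕ
countB {n} P = sum (map (λ σ → if P σ then 1 else 0) (allSubsets n))

vertices : ∀ {n} → Complex n → Subset n
vertices K = tabulate (λ v → K ⁅ v ⁆)

Δ : ∀ {n} → Subset n → Complex n
Δ V σ = σ ⊆ᵇ V

principal : ∀ {n} → Complex n → Subset n → Bool
principal {n} K σ = K σ ∧ not (any (λ τ → K τ ∧ (σ ⊂ᵇ τ)) (allSubsets n))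

m : ∀ {n} → Complex n → ℕ
m K = countB (principal K)

-- L ⊂ K top generated (only the principal-simplex condition; being a
-- subcomplex is imposed separately where used)
TopGenerated : ∀ {n} → Complex n → Complex n → Set
TopGenerated {n} L K = ∀ (σ : Subset n) → principal L σ ≡ true → principal K σ ≡ true

HasDim : ∀ {n} → Complex n → ℕ → Set
HasDim {n} K d = (∃[ σ ] (K σ ≡ true × ∣ σ ∣ ≡ suc d))
               × (∀ (σ : Subset n) → K σ ≡ true → ∣ σ ∣ ≤ suc d)

lk : ∀ {n} → Fin n → Complex n → Complex n
lk v K ρ = K (⁅ v ⁆ ∪ ρ) ∧ not ⌊ v ∈? ρ ⌋

_+ₖ_ : ∀ {n} → Complex n → Complex n → Complex n
(K +ₖ L) σ = K σ ∨ L σ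

_∩ₖ_ : ∀ {n} → Complex n → Complex n → Complex n
(K ∩ₖ L) σ = K σ ∧ L σ

_≈ₖ_ : ∀ {n} → Complex n → Complex n → Set
K ≈ₖ L = ∀ σ → K σ ≡ L σ

-- boundary of a combinatorial k-ball L: generated by the (k-1)-simplices
-- (k vertices) that are faces of exactly one k-simplex (k+1 vertices)
∂ : ∀ {n} → ℕ → Complex n → Complex n
∂ {n} k L σ = any (λ ρ → (σ ⊆ᵇ ρ) ∧ L ρ ∧ (∣ ρ ∣ ≡ᵇ k)
                         ∧ (countB (λ ρ' → L ρ' ∧ (∣ ρ' ∣ ≡ᵇ suc k) ∧ (ρ ⊆ᵇ ρ')) ≡ᵇ 1))
                  (allSubsets n)

IsEmptySimplexOnly : ∀ {n} → Complex n → Set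
IsEmptySimplexOnly K = ∀ σ → K σ ≡ true ⇔ σ ≡ ⊥

IsPoint : ∀ {n} → Complex n → Set
IsPoint K = ∃[ v ] (∀ σ → K σ ≡ true ⇔ σ ⊆ ⁅ v ⁆)

IsTwoPoints : ∀ {n} → Complex n → Set
IsTwoPoints K = ∃[ u ] ∃[ v ] (u ≢ v × (∀ σ → K σ ≡ true ⇔ (σ ⊆ ⁅ u ⁆ ⊎ σ ⊆ ⁅ v ⁆)))

-- Geometric realisation (with rational coordinates) and subdivisions.
-- A point of |Δ(Fin n)| is given by barycentric coordinates Fin n → ℚ.

Point : ℕ → Set
Point n = Fin n → ℚ

sumFin : ∀ {n} → (Fin n → ℚ) → ℚ
sumFin {zero} f = 0ℚ
sumFin {suc n} f = f Fin.zero +ℚ sumFin (λ i → f (Fin.suc i))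

InSimplex : ∀ {n} → Subset n → Point n → Set
InSimplex σ p = (∀ i → 0ℚ ≤ℚ p i) × (∀ i → i ∉ σ → p i ≡ 0ℚ) × sumFin p ≡ 1ℚ

InRealization : ∀ {n} → Complex n → Point n → Set
InRealization K p = ∃[ σ ] (K σ ≡ true × InSimplex σ p)

InHull : ∀ {m n} → (Fin m → Point n) → Subset m → Point n → Set
InHull f σ' p = ∃[ λ' ] (InSimplex σ' λ' × (∀ i → p i ≡ sumFin (λ v → λ' v *ℚ f v i)))

AffinelyIndependent : ∀ {m n} → (Fin m → Point n) → Subset m → Set
AffinelyIndependent f σ' =
  ∀ μ → (∀ v → v ∉ σ' → μ v ≡ 0ℚ) → sumFin μ ≡ 0ℚ
      → (∀ i → sumFin (λ v → μ v *ℚ f v i) ≡ 0ℚ) → ∀ v → μ v ≡ 0ℚ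

IsSubdivision : ∀ {m n} → Complex m → (Fin m → Point n) → Complex n → Set
IsSubdivision {m} {n} J f K =
    IsComplex J
  × (∀ σ' → J σ' ≡ true → AffinelyIndependent f σ')
  × (∀ σ' → J σ' ≡ true → ∃[ σ ] (K σ ≡ true × (∀ v → v ∈ σ' → InSimplex σ (f v))))
  × (∀ σ' ρ' p → J σ' ≡ true → J ρ' ≡ true → InHull f σ' p → InHull f ρ' p
       → InHull f (σ' ∩ ρ') p)
  × (∀ p → InRealization K p → ∃[ σ' ] (J σ' ≡ true × InHull f σ' p))

HaveCommonSubdivision : ∀ {n n'} → Complex n → Complex n' → Set
HaveCommonSubdivision K L =
  ∃[ m ] Σ (Complex m) λ J → ∃[ f ] ∃[ g ] (IsSubdivision J f K × IsSubdivision J g L)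

Simplex : (d : ℕ) → Complex (suc d)
Simplex d σ = true

IsCombBall : ∀ {n} → ℕ → Complex n → Set
IsCombBall d L = IsComplex L × HaveCommonSubdivision L (Simplex d)

ElemCollapse : ∀ {n} → Complex n → Complex n → Set
ElemCollapse K K' =
  ∃[ σ ] ∃[ τ ] (K σ ≡ true × K τ ≡ true × (σ ⊂ᵇ τ) ≡ true
    × (∀ ρ → K ρ ≡ true → σ ⊆ ρ → ρ ≡ σ ⊎ ρ ≡ τ)
    × (∀ ρ → K' ρ ≡ (K ρ ∧ not (ρ ==ₛ σ) ∧ not (ρ ==ₛ τ))))

CollapsesToVertex : ∀ {n} → Complex n → Set
CollapsesToVertex K = ∃[ K' ] (Star ElemCollapse K K' × IsPoint K')

Collapsible : ∀ {n} → Complex n → Set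
Collapsible K =
  ∃[ m ] Σ (Complex m) λ J → ∃[ f ] (IsSubdivision J f K × CollapsesToVertex J)

-- NH-manifolds, NH-balls, NH-spheres (dimension d ≥ 0; the (-1)-sphere
-- {∅} is handled by IsEmptySimplexOnly).
-- NHSphere d k S : S is an NH-sphere of dimension d and homotopy dimension k.

mutual
  NHManifold : ℕ → ∀ {n} → Complex n → Set
  NHManifold zero K = IsComplex K × HasDim K 0
  NHManifold (suc d) K =
    IsComplex K × HasDim K (suc d) × (∀ v → K ⁅ v ⁆ ≡ true → LinkOK d (lk v K))

  LinkOK : ℕ → ∀ {n} → Complex n → Set
  LinkOK d L = BallUpTo d L ⊎ SphereUpTo d L ⊎ IsEmptySimplexOnly L

  BallUpTo : ℕ → ∀ {n} → Complex n → Set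
  BallUpTo zero L = NHBall zero L
  BallUpTo (suc d) L = BallUpTo d L ⊎ NHBall (suc d) L

  SphereUpTo : ℕ → ∀ {n} → Complex n → Set
  SphereUpTo zero L = ∃[ k ] NHSphere zero k L
  SphereUpTo (suc d) L = SphereUpTo d L ⊎ ∃[ k ] NHSphere (suc d) k L

  NHBall : ℕ → ∀ {n} → Complex n → Set
  NHBall zero K = IsComplex K × IsPoint K
  NHBall (suc d) K = NHManifold (suc d) K × Collapsible K

  NHSphere : ℕ → ℕ → ∀ {n} → Complex n → Set
  NHSphere zero k S = k ≡ 0 × IsComplex S × IsTwoPoints S
  NHSphere (suc d) k S =
    NHManifold (suc d) S
    × Σ (Complex _) λ B → Σ (Complex _) λ L →
        NHBall (suc d) B × TopGenerated B S
      × IsCombBall k L × TopGenerated L S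
      × ((B +ₖ L) ≈ₖ S) × ((B ∩ₖ L) ≈ₖ ∂ k L)

-- minimal NH-sphere: m(S) = dim_h(S) + 2 ; for {∅}, dim_h = -1 and m = 1
IsMinimalNHSphere : ∀ {n} → Complex n → Set
IsMinimalNHSphere S =
  IsEmptySimplexOnly S ⊎ ∃[ d ] ∃[ k ] (NHSphere d k S × m S ≡ k + 2)

dualW : ∀ {n} → Complex n → Subset n → Complex n
dualW K V σ = (σ ⊆ᵇ V) ∧ not (K (V ∩ ∁ σ))

dualτ : ∀ {n} → Complex n → Subset n → Complex n
dualτ K τ = dualW K (vertices K ∪ τ)

{-# OPTIONS --safe #-}
module Submission where

-- On a nonempty vertex set V ⊇ V_K, the minimal NH-spheres are the complexes encoded by a word:
-- a linear order x₁ … x_N on V with each letter marked or not, the last one marked, the facets being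
-- F_x = V − x − {unmarked letters before x} for the marked x.  Alexander duality in V flips every
-- mark but the last, so this class is closed under duality, and K is its own double dual.
--
-- From words to spheres: deleting a letter x (and unmarking all later letters if x is unmarked) gives
-- the link of x; unmarking the last letter gives the ball B, whose complement is the simplex L spanned
-- by the other marked letters; B collapses because Δ(W) + x * K collapses to Δ(W) when K collapses.
--
-- From spheres to words: ∅ ∈ B ∩ L = ∂L yields a principal k-simplex μ ∈ L, and every ridge μ − v lies
-- in another facet F_v, so m(S) = k + 2 leaves no other facets.  The F_v have a common vertex: if L has
-- a second facet, by looking at its ridges (dimension invariance bounds its size); otherwise B = ⋃ F_v
-- is collapsible and the mod 2 Euler characteristic forbids an empty total intersection.  The link of
-- F ∩ G, for facets F ≠ G, is a disjoint union of two simplices, so one of them is a vertex; hence the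
-- complements of the facets, without their private vertices, form a chain, which is the word.

open import Defs
open import Data.Bool using (Bool; true; false; _xor_; not; _∧_; _∨_; T; T?; if_then_else_)
import Data.Bool.Properties as Boolₚ
open Boolₚ using (xor-comm; ∧-identityʳ)
open import Data.Bool.ListAction using (any)
open import Data.Empty using (⊥-elim) renaming (⊥ to Void)
open import Data.Fin using (Fin)
import Data.Fin as Fin
import Data.Fin.Properties as Finₚ
open import Data.Fin.Subset using (Subset; ⁅_⁆; _∈_; _∉_; _⊆_; ∁; _∩_; _∪_; ∣_∣; ⊥; ⊤)
open import Data.Fin.Subset.Properties
open import Data.List using (List; []; _∷_; _++_; _∷ʳ_; map; concatMap; filterᵇ; allFin; length)
import Data.List.Properties as Listₚ
open import Data.List.Membership.Propositional using () renaming (_∈_ to _∈ˡ_)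
open import Data.List.Membership.Propositional.Properties using (∈-map⁺; ∈-map⁻; ∈-++⁺ˡ; ∈-++⁺ʳ; ∈-++⁻; ∈-∃++; ∈-filter⁺; ∈-filter⁻; ∈-concat⁺′; ∈-concat⁻′; ∈-allFin)
open import Data.List.Relation.Unary.All as All using (All; []; _∷_)
import Data.List.Relation.Unary.All.Properties as Allₚ
open import Data.List.Relation.Unary.AllPairs using (AllPairs; []; _∷_)
import Data.List.Relation.Unary.Any as Any
open import Data.List.Relation.Unary.Any using (here; there)
open import Data.List.Relation.Unary.Unique.Propositional using (Unique)
import Data.List.Relation.Unary.Unique.Propositional.Properties as Uniqueₚ
open import Data.Nat using (ℕ; zero; suc; s≤s; z≤n; _≤_; _<_; _+_; _∸_; _≡ᵇ_)
open import Data.Nat.ListAction using (sum)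
import Data.Nat.Properties as ℕₚ
open import Data.Product using (Σ; ∃-syntax; _×_; _,_; proj₁; proj₂)
open import Data.Rational using (ℚ; 0ℚ; 1ℚ; ½; 1/_; ≢-nonZero; positive; nonNegative) renaming (_+_ to _+ℚ_; _*_ to _*ℚ_; _≤_ to _≤ℚ_; _<_ to _<ℚ_; -_ to -ℚ_)
import Data.Rational.Properties as ℚₚ
open import Data.Rational.Solver using (module +-*-Solver)
open import Data.Sum using (_⊎_; inj₁; inj₂; [_,_]′)
import Data.Sum as Sum
open import Data.Unit using (tt) renaming (⊤ to Unit)
open import Data.Vec using ([]; _∷_; tabulate)
import Data.Vec.Base as Vec
import Data.Vec.Properties as Vecₚ
open import Function using (_∘_; _⇔_; mk⇔; Equivalence)
open import Relation.Binary.Construct.Closure.ReflexiveTransitive using (Star; ε; _◅_; _◅◅_)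
open import Relation.Binary.Definitions using (tri<; tri≈; tri>)
open import Relation.Binary.PropositionalEquality using (_≡_; _≢_; refl; sym; trans; cong; cong₂; subst; module ≡-Reasoning)
open import Relation.Nullary using (¬_; Dec; yes; no; contradiction)
open import Relation.Nullary.Decidable using (⌊_⌋; decidable-stable; _×-dec_; _⊎-dec_; _→-dec_; ¬?)

open +-*-Solver using (solve; _:+_; _:*_; :-_; _:=_; con)

-- Collapsibility and combinatorial balls are defined through arbitrary rational subdivisions, not
-- through elementary moves. The step from spheres to words therefore rests on two facts proved
-- geometrically: a subdivided simplex has an even number of cells, the empty one included, and a
-- simplex is not covered by cells of smaller dimension. The first is proved for rays instead of
-- points: cells become open cones, and a hyperplane section is formed by positive combinations
-- alone, without normalisation. The count m(S) = k + 2 only makes every facet the sole one to omit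
-- some vertex. That the remaining omitted vertices can be ordered linearly is where the vertex
-- links enter. V has to be nonempty: over V = ∅ the complex {∅} has the void complex as its dual.
-- Over nonempty V its words mark the last letter only and those of its dual mark every letter,
-- which gives ∂Δ(V). The last mark is exempt from the flip because a word without marks encodes the
-- void complex.

private
  variable
    n n′ : ℕ
    A B : Set

-- Rational arithmetic and finite sums

*-pos : ∀ {p q} → 0ℚ <ℚ p → 0ℚ <ℚ q → 0ℚ <ℚ p *ℚ q
*-pos {p} {q} 0<p 0<q = ℚₚ.positive⁻¹ (p *ℚ q) {{ℚₚ.pos*pos⇒pos p {{positive 0<p}} q {{positive 0<q}}}}

*-nonneg : ∀ {p q} → 0ℚ ≤ℚ p → 0ℚ ≤ℚ q → 0ℚ ≤ℚ p *ℚ q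
*-nonneg {p} {q} 0≤p 0≤q = ℚₚ.nonNegative⁻¹ (p *ℚ q) {{ℚₚ.nonNeg*nonNeg⇒nonNeg p {{nonNegative 0≤p}} q {{nonNegative 0≤q}}}}

+-nonneg : ∀ {p q} → 0ℚ ≤ℚ p → 0ℚ ≤ℚ q → 0ℚ ≤ℚ p +ℚ q
+-nonneg 0≤p 0≤q = ℚₚ.+-mono-≤ 0≤p 0≤q

+-pos-nonneg : ∀ {p q} → 0ℚ <ℚ p → 0ℚ ≤ℚ q → 0ℚ <ℚ p +ℚ q
+-pos-nonneg 0<p 0≤q = ℚₚ.+-mono-<-≤ 0<p 0≤q

neg-pos : ∀ {p} → p <ℚ 0ℚ → 0ℚ <ℚ -ℚ p
neg-pos p<0 = ℚₚ.neg-antimono-< p<0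

*-zero⁻ : ∀ p q → p *ℚ q ≡ 0ℚ → p ≢ 0ℚ → q ≡ 0ℚ
*-zero⁻ p q pq≡0 p≢0 = begin
  q                    ≡⟨ sym (ℚₚ.*-identityˡ q) ⟩
  1ℚ *ℚ q              ≡⟨ cong (_*ℚ q) (sym (ℚₚ.*-inverseˡ p)) ⟩
  (1/ p) *ℚ p *ℚ q     ≡⟨ ℚₚ.*-assoc (1/ p) p q ⟩
  (1/ p) *ℚ (p *ℚ q)   ≡⟨ cong ((1/ p) *ℚ_) pq≡0 ⟩
  (1/ p) *ℚ 0ℚ         ≡⟨ ℚₚ.*-zeroʳ (1/ p) ⟩
  0ℚ                   ∎
  where
  open ≡-Reasoning
  instance _ = ≢-nonZero p≢0

-- Total, with value 0 at 0, so that a scaling factor can be written down before its positivity is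
-- established.
inv : ℚ → ℚ
inv q with q ℚₚ.≟ 0ℚ
... | yes _   = 0ℚ
... | no  q≢0 = (1/ q) {{≢-nonZero q≢0}}

*-inv : ∀ {q} → q ≢ 0ℚ → q *ℚ inv q ≡ 1ℚ
*-inv {q} q≢0 with q ℚₚ.≟ 0ℚ
... | yes q≡0 = contradiction q≡0 q≢0
... | no  q≢0 = ℚₚ.*-inverseʳ q {{≢-nonZero q≢0}}

inv-pos : ∀ {q} → 0ℚ <ℚ q → 0ℚ <ℚ inv q
inv-pos {q} 0<q with q ℚₚ.≟ 0ℚ
... | yes q≡0 = contradiction (sym q≡0) (ℚₚ.<⇒≢ 0<q)
... | no  q≢0 = ℚₚ.positive⁻¹ _ {{ℚₚ.1/pos⇒pos q {{positive 0<q}}}}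

pos⇒≢0 : ∀ {q} → 0ℚ <ℚ q → q ≢ 0ℚ
pos⇒≢0 0<q q≡0 = ℚₚ.<⇒≢ 0<q (sym q≡0)

*-inv-pos : ∀ {q} → 0ℚ <ℚ q → q *ℚ inv q ≡ 1ℚ
*-inv-pos 0<q = *-inv (pos⇒≢0 0<q)

nonneg-+≡0 : ∀ {p q} → 0ℚ ≤ℚ p → 0ℚ ≤ℚ q → p +ℚ q ≡ 0ℚ → p ≡ 0ℚ × q ≡ 0ℚ
nonneg-+≡0 {p} {q} 0≤p 0≤q eq =
    ℚₚ.≤-antisym (subst (p ≤ℚ_) eq (subst (_≤ℚ p +ℚ q) (ℚₚ.+-identityʳ p) (ℚₚ.+-monoʳ-≤ p 0≤q))) 0≤p
  , ℚₚ.≤-antisym (subst (q ≤ℚ_) eq (subst (_≤ℚ p +ℚ q) (ℚₚ.+-identityˡ q) (ℚₚ.+-monoˡ-≤ q 0≤p))) 0≤q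

nonneg∧≢0⇒pos : ∀ {p} → 0ℚ ≤ℚ p → p ≢ 0ℚ → 0ℚ <ℚ p
nonneg∧≢0⇒pos {p} 0≤p p≢0 with ℚₚ.<-cmp 0ℚ p
... | tri< 0<p _ _ = 0<p
... | tri≈ _ 0≡p _ = contradiction (sym 0≡p) p≢0
... | tri> _ _ p<0 = contradiction (ℚₚ.≤-antisym (ℚₚ.<⇒≤ p<0) 0≤p) p≢0

sumFin-cong : {f g : Fin n → ℚ} → (∀ i → f i ≡ g i) → sumFin f ≡ sumFin g
sumFin-cong {zero}  f≗g = refl
sumFin-cong {suc n} f≗g = cong₂ _+ℚ_ (f≗g Fin.zero) (sumFin-cong (f≗g ∘ Fin.suc))

sumFin-0 : {f : Fin n → ℚ} → (∀ i → f i ≡ 0ℚ) → sumFin f ≡ 0ℚ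
sumFin-0 {zero}  f≗0 = refl
sumFin-0 {suc n} f≗0 = cong₂ _+ℚ_ (f≗0 Fin.zero) (sumFin-0 (f≗0 ∘ Fin.suc))

sumFin-+ : (f g : Fin n → ℚ) → sumFin (λ i → f i +ℚ g i) ≡ sumFin f +ℚ sumFin g
sumFin-+ {zero}  f g = refl
sumFin-+ {suc n} f g = trans (cong ((f Fin.zero +ℚ g Fin.zero) +ℚ_) (sumFin-+ (f ∘ Fin.suc) (g ∘ Fin.suc)))
  (solve 4 (λ a b c d → (a :+ b) :+ (c :+ d) := (a :+ c) :+ (b :+ d)) refl
    (f Fin.zero) (g Fin.zero) (sumFin (f ∘ Fin.suc)) (sumFin (g ∘ Fin.suc)))

sumFin-*ˡ : (a : ℚ) (f : Fin n → ℚ) → sumFin (λ i → a *ℚ f i) ≡ a *ℚ sumFin f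
sumFin-*ˡ {zero}  a f = sym (ℚₚ.*-zeroʳ a)
sumFin-*ˡ {suc n} a f = trans (cong (a *ℚ f Fin.zero +ℚ_) (sumFin-*ˡ a (f ∘ Fin.suc)))
  (sym (ℚₚ.*-distribˡ-+ a (f Fin.zero) (sumFin (f ∘ Fin.suc))))

sumFin-swap : (f : Fin n → Fin n′ → ℚ) → sumFin (λ i → sumFin (f i)) ≡ sumFin (λ j → sumFin (λ i → f i j))
sumFin-swap {zero} {n′} f = sym (sumFin-0 {n′} {λ _ → 0ℚ} (λ _ → refl))
sumFin-swap {suc n} f = trans (cong (sumFin (f Fin.zero) +ℚ_) (sumFin-swap (f ∘ Fin.suc)))
  (sym (sumFin-+ (f Fin.zero) (λ j → sumFin (λ i → f (Fin.suc i) j))))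

sumFin-nonneg : {f : Fin n → ℚ} → (∀ i → 0ℚ ≤ℚ f i) → 0ℚ ≤ℚ sumFin f
sumFin-nonneg {zero}  f≥0 = ℚₚ.≤-refl
sumFin-nonneg {suc n} f≥0 = +-nonneg (f≥0 Fin.zero) (sumFin-nonneg (f≥0 ∘ Fin.suc))

sumFin≡0⇒≡0 : {f : Fin n → ℚ} → (∀ i → 0ℚ ≤ℚ f i) → sumFin f ≡ 0ℚ → ∀ i → f i ≡ 0ℚ
sumFin≡0⇒≡0 f≥0 eq Fin.zero = proj₁ (nonneg-+≡0 (f≥0 Fin.zero) (sumFin-nonneg (f≥0 ∘ Fin.suc)) eq)
sumFin≡0⇒≡0 f≥0 eq (Fin.suc i) =
  sumFin≡0⇒≡0 (f≥0 ∘ Fin.suc) (proj₂ (nonneg-+≡0 (f≥0 Fin.zero) (sumFin-nonneg (f≥0 ∘ Fin.suc)) eq)) i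

sumFin-pos : {f : Fin n → ℚ} → (∀ i → 0ℚ ≤ℚ f i) → ∀ i → 0ℚ <ℚ f i → 0ℚ <ℚ sumFin f
sumFin-pos f≥0 i fi>0 = nonneg∧≢0⇒pos (sumFin-nonneg f≥0) (λ eq → pos⇒≢0 fi>0 (sumFin≡0⇒≡0 f≥0 eq i))

sumFin-single : (i : Fin n) (f : Fin n → ℚ) → (∀ j → j ≢ i → f j ≡ 0ℚ) → sumFin f ≡ f i
sumFin-single Fin.zero f f≡0 = trans (cong (f Fin.zero +ℚ_) (sumFin-0 (λ j → f≡0 (Fin.suc j) λ ()))) (ℚₚ.+-identityʳ _)
sumFin-single (Fin.suc i) f f≡0 = trans (cong₂ _+ℚ_ (f≡0 Fin.zero λ ()) (sumFin-single i (f ∘ Fin.suc) (λ j j≢i → f≡0 (Fin.suc j) (j≢i ∘ Finₚ.suc-injective)))) (ℚₚ.+-identityˡ _)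

δ : Fin n → Point n
δ i j with i Fin.≟ j
... | yes _ = 1ℚ
... | no  _ = 0ℚ

δ-same : (i : Fin n) → δ i i ≡ 1ℚ
δ-same i with i Fin.≟ i
... | yes _  = refl
... | no i≢i = contradiction refl i≢i

δ-diff : {i j : Fin n} → i ≢ j → δ i j ≡ 0ℚ
δ-diff {i = i} {j} i≢j with i Fin.≟ j
... | yes i≡j = contradiction i≡j i≢j
... | no _    = refl

δ-nonneg : (i j : Fin n) → 0ℚ ≤ℚ δ i j
δ-nonneg i j with i Fin.≟ j
... | yes _ = ℚₚ.nonNegative⁻¹ 1ℚ
... | no  _ = ℚₚ.≤-refl

sumFin-δ : (i : Fin n) → sumFin (δ i) ≡ 1ℚ
sumFin-δ i = trans (sumFin-single i (δ i) (λ j j≢i → δ-diff (j≢i ∘ sym))) (δ-same i)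

-- Subsets, counting and principal simplices

⌊⌋⁺ : {A : Set} (d : Dec A) → A → ⌊ d ⌋ ≡ true
⌊⌋⁺ (yes _) _ = refl
⌊⌋⁺ (no ¬a) a = contradiction a ¬a

⌊⌋⁻ : {A : Set} (d : Dec A) → ⌊ d ⌋ ≡ true → A
⌊⌋⁻ (yes a) _ = a

∧⁺ : ∀ {a b} → a ≡ true → b ≡ true → a ∧ b ≡ true
∧⁺ refl refl = refl

∧⁻ : ∀ {a b} → a ∧ b ≡ true → a ≡ true × b ≡ true
∧⁻ {true} {true} _ = refl , refl

∨⁻ : ∀ {a b} → a ∨ b ≡ true → a ≡ true ⊎ b ≡ true
∨⁻ {true}  _ = inj₁ refl
∨⁻ {false} e = inj₂ e

∨⁺ˡ : ∀ {a b} → a ≡ true → a ∨ b ≡ true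
∨⁺ˡ refl = refl

∨⁺ʳ : ∀ {a b} → b ≡ true → a ∨ b ≡ true
∨⁺ʳ {false} e = e
∨⁺ʳ {true}  _ = refl

not⁺ : ∀ {a} → a ≢ true → not a ≡ true
not⁺ {false} _ = refl
not⁺ {true}  ¬a = contradiction refl ¬a

not⁻ : ∀ {a} → not a ≡ true → a ≢ true
not⁻ {false} _ ()

≡true-ext : ∀ {a b : Bool} → (a ≡ true → b ≡ true) → (b ≡ true → a ≡ true) → a ≡ b
≡true-ext {false} {false} f g = refl
≡true-ext {false} {true}  f g = g refl
≡true-ext {true}  {b}     f g = sym (f refl)

any⁺ : (P : A → Bool) {xs : List A} {x : A} → x ∈ˡ xs → P x ≡ true → any P xs ≡ true
any⁺ P {y ∷ xs} (here refl) Px = ∨⁺ˡ Px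
any⁺ P {y ∷ xs} (there x∈)  Px = ∨⁺ʳ {P y} (any⁺ P x∈ Px)

abstract
  any⁻ : (P : A → Bool) (xs : List A) → any P xs ≡ true → ∃[ x ] (x ∈ˡ xs × P x ≡ true)
  any⁻ P (y ∷ xs) e with ∨⁻ {P y} e
  ... | inj₁ Py = y , here refl , Py
  ... | inj₂ e′ with any⁻ P xs e′
  ... | x , x∈ , Px = x , there x∈ , Px

∈-allSubsets : (σ : Subset n) → σ ∈ˡ allSubsets n
∈-allSubsets []          = here refl
∈-allSubsets (true ∷ σ)  = ∈-++⁺ˡ (∈-map⁺ (true ∷_) (∈-allSubsets σ))
∈-allSubsets (false ∷ σ) = ∈-++⁺ʳ (map (true ∷_) (allSubsets _)) (∈-map⁺ (false ∷_) (∈-allSubsets σ))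

allSubsets-unique : ∀ n → Unique (allSubsets n)
allSubsets-unique zero    = [] ∷ []
allSubsets-unique (suc n) = Uniqueₚ.++⁺ (Uniqueₚ.map⁺ Vecₚ.∷-injectiveʳ (allSubsets-unique n)) (Uniqueₚ.map⁺ Vecₚ.∷-injectiveʳ (allSubsets-unique n)) disjoint
  where
  disjoint : ∀ {σ} → ¬ (σ ∈ˡ map (true ∷_) (allSubsets n) × σ ∈ˡ map (false ∷_) (allSubsets n))
  disjoint (a , b) with ∈-map⁻ (true ∷_) a | ∈-map⁻ (false ∷_) b
  ... | _ , _ , refl | _ , _ , ()

length-mono : {xs ys : List A} → Unique xs → (∀ {x} → x ∈ˡ xs → x ∈ˡ ys) → length xs ≤ length ys
length-mono {xs = []} _ _ = z≤n
length-mono {xs = x ∷ xs} {ys} (x∉ ∷ u) sub with ∈-∃++ (sub (here refl))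
... | as , bs , refl = subst (suc (length xs) ≤_) (sym eq) (s≤s (length-mono u sub′))
  where
  eq : length (as ++ x ∷ bs) ≡ suc (length (as ++ bs))
  eq = trans (Listₚ.length-++ as) (trans (ℕₚ.+-suc (length as) (length bs)) (cong suc (sym (Listₚ.length-++ as))))
  sub′ : ∀ {y} → y ∈ˡ xs → y ∈ˡ as ++ bs
  sub′ {y} y∈ with ∈-++⁻ as (sub (there y∈))
  ... | inj₁ y∈as         = ∈-++⁺ˡ y∈as
  ... | inj₂ (here refl)  = contradiction refl (All.lookup x∉ y∈)
  ... | inj₂ (there y∈bs) = ∈-++⁺ʳ as y∈bs

members : (Subset n → Bool) → List (Subset n)
members {n} P = filterᵇ P (allSubsets n)

∈-members⁺ : (P : Subset n → Bool) {σ : Subset n} → P σ ≡ true → σ ∈ˡ members P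
∈-members⁺ P {σ} Pσ = ∈-filter⁺ (λ x → T? (P x)) (∈-allSubsets σ) (subst T (sym Pσ) _)

∈-members⁻ : (P : Subset n → Bool) {σ : Subset n} → σ ∈ˡ members P → P σ ≡ true
∈-members⁻ {n} P {σ} σ∈ = T⇒≡ (proj₂ (∈-filter⁻ (λ x → T? (P x)) {xs = allSubsets n} σ∈))
  where
  T⇒≡ : ∀ {b} → T b → b ≡ true
  T⇒≡ {true} _ = refl

members-unique : (P : Subset n → Bool) → Unique (members P)
members-unique {n} P = Uniqueₚ.filter⁺ (λ x → T? (P x)) (allSubsets-unique n)

countB-members : (P : Subset n → Bool) → countB P ≡ length (members P)
countB-members {n} P = go (allSubsets n)
  where
  go : ∀ xs → sum (map (λ σ → if P σ then 1 else 0) xs) ≡ length (filterᵇ P xs)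
  go [] = refl
  go (x ∷ xs) with P x
  ... | true  = cong suc (go xs)
  ... | false = go xs

countB-enumerated : (P : Subset n → Bool) {xs : List (Subset n)} → Unique xs →
  (∀ {σ} → σ ∈ˡ xs → P σ ≡ true) → (∀ {σ} → P σ ≡ true → σ ∈ˡ xs) → countB P ≡ length xs
countB-enumerated P u sound complete = trans (countB-members P)
  (ℕₚ.≤-antisym (length-mono (members-unique P) (complete ∘ ∈-members⁻ P)) (length-mono u (∈-members⁺ P ∘ sound)))

abstract
  countB≡1⁻ : (P : Subset n → Bool) → countB P ≡ 1 → ∃[ σ ] (P σ ≡ true × (∀ {ρ} → P ρ ≡ true → ρ ≡ σ))
  countB≡1⁻ P e with members P in eq | trans (sym (countB-members P)) e
  ... | σ ∷ [] | _ = σ , ∈-members⁻ P (subst (σ ∈ˡ_) (sym eq) (here refl)) , λ Pρ → only (subst (_ ∈ˡ_) eq (∈-members⁺ P Pρ))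
    where
    only : ∀ {ρ} → ρ ∈ˡ σ ∷ [] → ρ ≡ σ
    only (here e) = e

_≟ₛ_ : (σ τ : Subset n) → Dec (σ ≡ τ)
_≟ₛ_ = Vecₚ.≡-dec Boolₚ._≟_

abstract
  countB≢1⁻ : (P : Subset n → Bool) {σ : Subset n} → P σ ≡ true → countB P ≢ 1 → ∃[ ρ ] (P ρ ≡ true × ρ ≢ σ)
  countB≢1⁻ P {σ} Pσ c≢1 with anySubset? (λ ρ → (P ρ Boolₚ.≟ true) ×-dec ¬? (ρ ≟ₛ σ))
  ... | yes r = r
  ... | no ¬r = contradiction (countB-enumerated P {σ ∷ []} ([] ∷ []) (λ { (here refl) → Pσ }) only) c≢1
    where
    only : ∀ {ρ} → P ρ ≡ true → ρ ∈ˡ σ ∷ []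
    only {ρ} Pρ = here (decidable-stable (ρ ≟ₛ σ) (λ ρ≢σ → ¬r (ρ , Pρ , ρ≢σ)))

infixl 6 _∖_

_∖_ : Subset n → Fin n → Subset n
p ∖ x = p ∩ ∁ ⁅ x ⁆

∈-∖⁺ : {p : Subset n} {x y : Fin n} → y ∈ p → y ≢ x → y ∈ p ∖ x
∈-∖⁺ y∈p y≢x = x∈p∩q⁺ (y∈p , x∉p⇒x∈∁p (x≢y⇒x∉⁅y⁆ y≢x))

∈-∖⁻ : {p : Subset n} {x y : Fin n} → y ∈ p ∖ x → y ∈ p × y ≢ x
∈-∖⁻ {p = p} {x} y∈ with x∈p∩q⁻ p (∁ ⁅ x ⁆) y∈
... | y∈p , y∈∁ = y∈p , λ { refl → x∈∁p⇒x∉p y∈∁ (x∈⁅x⁆ x) }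

∖-⊆ : {p : Subset n} {x : Fin n} → p ∖ x ⊆ p
∖-⊆ y∈ = proj₁ (∈-∖⁻ y∈)

x∉p∖x : {p : Subset n} {x : Fin n} → x ∉ p ∖ x
x∉p∖x x∈ = proj₂ (∈-∖⁻ x∈) refl

⊆-∖ : {p q : Subset n} {x : Fin n} → p ⊆ q → x ∉ p → p ⊆ q ∖ x
⊆-∖ p⊆q x∉p y∈ = ∈-∖⁺ (p⊆q y∈) (λ { refl → x∉p y∈ })

∈-insert⁻ : {p : Subset n} {x y : Fin n} → y ∈ ⁅ x ⁆ ∪ p → y ≡ x ⊎ y ∈ p
∈-insert⁻ {p = p} {x} y∈ with x∈p∪q⁻ ⁅ x ⁆ p y∈
... | inj₁ y∈x = inj₁ (x∈⁅y⁆⇒x≡y x y∈x)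
... | inj₂ y∈p = inj₂ y∈p

∈-insert-≢ : {p : Subset n} {x y : Fin n} → x ≢ y → y ∈ ⁅ x ⁆ ∪ p → y ∈ p
∈-insert-≢ x≢y y∈ with ∈-insert⁻ y∈
... | inj₁ y≡x = contradiction (sym y≡x) x≢y
... | inj₂ y∈p = y∈p

∈-insert⁺ : {p : Subset n} {x y : Fin n} → y ∈ p → y ∈ ⁅ x ⁆ ∪ p
∈-insert⁺ {p = p} {x} y∈p = q⊆p∪q ⁅ x ⁆ p y∈p

x∈insert : {p : Subset n} {x : Fin n} → x ∈ ⁅ x ⁆ ∪ p
x∈insert {p = p} {x} = p⊆p∪q p (x∈⁅x⁆ x)

insert-⊆ : {p q : Subset n} {x : Fin n} → x ∈ q → p ⊆ q → ⁅ x ⁆ ∪ p ⊆ q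
insert-⊆ x∈q p⊆q y∈ with ∈-insert⁻ y∈
... | inj₁ refl = x∈q
... | inj₂ y∈p  = p⊆q y∈p

abstract
  insert-∖ : {p : Subset n} {x : Fin n} → x ∈ p → ⁅ x ⁆ ∪ (p ∖ x) ≡ p
  insert-∖ {p = p} {x} x∈p = ⊆-antisym (insert-⊆ x∈p ∖-⊆) λ {y} y∈ → back y (y Fin.≟ x) y∈
    where
    back : ∀ y → Dec (y ≡ x) → y ∈ p → y ∈ ⁅ x ⁆ ∪ (p ∖ x)
    back y (yes refl) _ = x∈insert
    back y (no y≢x) y∈  = ∈-insert⁺ (∈-∖⁺ y∈ y≢x)

abstract
  ∖-insert : {p : Subset n} {x : Fin n} → x ∉ p → (⁅ x ⁆ ∪ p) ∖ x ≡ p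
  ∖-insert {p = p} {x} x∉p = ⊆-antisym to (⊆-∖ ∈-insert⁺ x∉p)
    where
    to : (⁅ x ⁆ ∪ p) ∖ x ⊆ p
    to y∈ with ∈-∖⁻ y∈
    ... | y∈′ , y≢x with ∈-insert⁻ y∈′
    ... | inj₁ y≡x = contradiction y≡x y≢x
    ... | inj₂ y∈p = y∈p

∣insert∣ : {p : Subset n} {x : Fin n} → x ∉ p → ∣ ⁅ x ⁆ ∪ p ∣ ≡ suc ∣ p ∣
∣insert∣ {p = true ∷ p}  {Fin.zero} x∉ = contradiction Vec.here x∉
∣insert∣ {p = false ∷ p} {Fin.zero} x∉ = cong (suc ∘ ∣_∣) (∪-identityˡ p)
∣insert∣ {p = true ∷ p}  {Fin.suc x} x∉ = cong suc (∣insert∣ (x∉ ∘ Vec.there))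
∣insert∣ {p = false ∷ p} {Fin.suc x} x∉ = ∣insert∣ (x∉ ∘ Vec.there)

∣∖∣ : {p : Subset n} {x : Fin n} → x ∈ p → ∣ p ∣ ≡ suc ∣ p ∖ x ∣
∣∖∣ {p = p} {x} x∈p = trans (cong ∣_∣ (sym (insert-∖ x∈p))) (∣insert∣ {p = p ∖ x} {x} (x∉p∖x {p = p}))

abstract
  ⊈-witness : {p q : Subset n} → ¬ (p ⊆ q) → ∃[ x ] (x ∈ p × x ∉ q)
  ⊈-witness {p = p} {q} p⊈q with Finₚ.any? (λ x → (x ∈? p) ×-dec ¬? (x ∈? q))
  ... | yes w = w
  ... | no ¬w = contradiction (λ {x} x∈p → decidable-stable (x ∈? q) (λ x∉q → ¬w (x , x∈p , x∉q))) p⊈q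

abstract
  ⊆∧∣≡∣⇒≡ : {p q : Subset n} → p ⊆ q → ∣ q ∣ ≤ ∣ p ∣ → p ≡ q
  ⊆∧∣≡∣⇒≡ {p = p} {q} p⊆q ≤∣ with q ⊆? p
  ... | yes q⊆p = ⊆-antisym p⊆q q⊆p
  ... | no  q⊈p = contradiction (p⊂q⇒∣p∣<∣q∣ (p⊆q , ⊈-witness q⊈p)) (ℕₚ.≤⇒≯ ≤∣)

∣p∣>0⇒nonempty : {p : Subset n} → 1 ≤ ∣ p ∣ → ∃[ x ] x ∈ p
∣p∣>0⇒nonempty {p = true ∷ p}  _ = Fin.zero , Vec.here
∣p∣>0⇒nonempty {p = false ∷ p} l with ∣p∣>0⇒nonempty l
... | x , x∈ = Fin.suc x , Vec.there x∈

⊆ᵇ⁺ : {σ τ : Subset n} → σ ⊆ τ → (σ ⊆ᵇ τ) ≡ true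
⊆ᵇ⁺ {σ = σ} {τ} = ⌊⌋⁺ (σ ⊆? τ)

⊆ᵇ⁻ : {σ τ : Subset n} → (σ ⊆ᵇ τ) ≡ true → σ ⊆ τ
⊆ᵇ⁻ {σ = σ} {τ} = ⌊⌋⁻ (σ ⊆? τ)

==ₛ⁺ : {σ τ : Subset n} → σ ≡ τ → (σ ==ₛ τ) ≡ true
==ₛ⁺ {σ = σ} {τ} = ⌊⌋⁺ (σ ≟ₛ τ)

==ₛ⁻ : {σ τ : Subset n} → (σ ==ₛ τ) ≡ true → σ ≡ τ
==ₛ⁻ {σ = σ} {τ} = ⌊⌋⁻ (σ ≟ₛ τ)

⊂ᵇ⁺ : {σ τ : Subset n} → σ ⊆ τ → σ ≢ τ → (σ ⊂ᵇ τ) ≡ true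
⊂ᵇ⁺ σ⊆τ σ≢τ = ∧⁺ (⊆ᵇ⁺ σ⊆τ) (not⁺ (σ≢τ ∘ ==ₛ⁻))

⊂ᵇ⁻ : {σ τ : Subset n} → (σ ⊂ᵇ τ) ≡ true → σ ⊆ τ × σ ≢ τ
⊂ᵇ⁻ e with ∧⁻ e
... | a , b = ⊆ᵇ⁻ a , not⁻ b ∘ ==ₛ⁺

record Principal {n} (K : Complex n) (σ : Subset n) : Set where
  constructor mkPrincipal
  field
    ∈K  : K σ ≡ true
    max : ∀ {τ} → K τ ≡ true → σ ⊆ τ → σ ≡ τ

abstract
  principal⁺ : {K : Complex n} {σ : Subset n} → Principal K σ → principal K σ ≡ true
  principal⁺ {n} {K} {σ} (mkPrincipal Kσ max) = ∧⁺ Kσ (not⁺ ¬bigger)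
    where
    ¬bigger : any (λ τ → K τ ∧ (σ ⊂ᵇ τ)) (allSubsets n) ≢ true
    ¬bigger e with any⁻ _ (allSubsets n) e
    ... | τ , _ , e′ with ∧⁻ e′
    ... | Kτ , σ⊂τ with ⊂ᵇ⁻ σ⊂τ
    ... | σ⊆τ , σ≢τ = σ≢τ (max Kτ σ⊆τ)

abstract
  principal⁻ : {K : Complex n} {σ : Subset n} → principal K σ ≡ true → Principal K σ
  principal⁻ {n} {K} {σ} e with ∧⁻ {K σ} e
  ... | Kσ , ¬bigger = mkPrincipal Kσ λ {τ} Kτ σ⊆τ → decidable-stable (σ ≟ₛ τ)
    λ σ≢τ → not⁻ ¬bigger (any⁺ (λ τ → K τ ∧ (σ ⊂ᵇ τ)) (∈-allSubsets τ) (∧⁺ Kτ (⊂ᵇ⁺ σ⊆τ σ≢τ)))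

abstract
  principal-above : (K : Complex n) {σ : Subset n} → K σ ≡ true → ∃[ τ ] (σ ⊆ τ × Principal K τ)
  principal-above {n} K {σ} Kσ = go n (ℕₚ.m≤n+m n ∣ σ ∣) Kσ
    where
    -- `k` is fuel: every strict enlargement of σ uses one unit, and a simplex has at most n
    -- vertices.
    go : ∀ k {σ} → n ≤ ∣ σ ∣ + k → K σ ≡ true → ∃[ τ ] (σ ⊆ τ × Principal K τ)
    go k {σ} n≤ Kσ with anySubset? (λ τ → (K τ Boolₚ.≟ true) ×-dec (σ ⊂? τ))
    ... | no ¬b = σ , (λ x → x) , mkPrincipal Kσ (λ {τ} Kτ σ⊆τ → ⊆∧∣≡∣⇒≡ σ⊆τ (ℕₚ.≮⇒≥ λ l → ¬b (τ , Kτ , σ⊆τ , ⊈-witness (λ τ⊆σ → ℕₚ.<⇒≱ l (p⊆q⇒∣p∣≤∣q∣ τ⊆σ)))))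
    go zero {σ} n≤ Kσ | yes (τ , Kτ , σ⊂τ) = contradiction (ℕₚ.<-≤-trans (p⊂q⇒∣p∣<∣q∣ σ⊂τ) (∣p∣≤n τ)) (ℕₚ.≤⇒≯ (subst (n ≤_) (ℕₚ.+-identityʳ ∣ σ ∣) n≤))
    go (suc k) {σ} n≤ Kσ | yes (τ , Kτ , σ⊂τ) with go k (ℕₚ.≤-trans n≤ (subst (_≤ ∣ τ ∣ + k) (sym (ℕₚ.+-suc ∣ σ ∣ k)) (ℕₚ.+-monoˡ-≤ k (p⊂q⇒∣p∣<∣q∣ σ⊂τ)))) Kτ
    ... | ρ , τ⊆ρ , pr = ρ , (λ x → τ⊆ρ (proj₁ σ⊂τ x)) , pr

elements : Subset n → List (Fin n)
elements []          = []
elements (true ∷ p)  = Fin.zero ∷ map Fin.suc (elements p)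
elements (false ∷ p) = map Fin.suc (elements p)

∈-elements⁺ : {p : Subset n} {x : Fin n} → x ∈ p → x ∈ˡ elements p
∈-elements⁺ Vec.here = here refl
∈-elements⁺ {p = true ∷ p}  (Vec.there x∈) = there (∈-map⁺ Fin.suc (∈-elements⁺ x∈))
∈-elements⁺ {p = false ∷ p} (Vec.there x∈) = ∈-map⁺ Fin.suc (∈-elements⁺ x∈)

∈-elements⁻ : (p : Subset n) {x : Fin n} → x ∈ˡ elements p → x ∈ p
∈-elements⁻ (true ∷ p) (here refl) = Vec.here
∈-elements⁻ (true ∷ p) (there x∈) with ∈-map⁻ Fin.suc x∈
... | y , y∈ , refl = Vec.there (∈-elements⁻ p y∈)
∈-elements⁻ (false ∷ p) x∈ with ∈-map⁻ Fin.suc x∈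
... | y , y∈ , refl = Vec.there (∈-elements⁻ p y∈)

elements-unique : (p : Subset n) → Unique (elements p)
elements-unique [] = []
elements-unique (true ∷ p)  = Allₚ.map⁺ (All.universal (λ _ ()) (elements p)) ∷ Uniqueₚ.map⁺ Finₚ.suc-injective (elements-unique p)
elements-unique (false ∷ p) = Uniqueₚ.map⁺ Finₚ.suc-injective (elements-unique p)

length-elements : (p : Subset n) → length (elements p) ≡ ∣ p ∣
length-elements [] = refl
length-elements (true ∷ p)  = cong suc (trans (Listₚ.length-map Fin.suc (elements p)) (length-elements p))
length-elements (false ∷ p) = trans (Listₚ.length-map Fin.suc (elements p)) (length-elements p)

to⇔ : ∀ {A B : Set} → A ⇔ B → A → B
to⇔ = Equivalence.to

from⇔ : ∀ {A B : Set} → A ⇔ B → B → A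
from⇔ = Equivalence.from

-- Open polyhedral cones and their slices

infix 4 _≐_

_≐_ : Point n → Point n → Set
x ≐ y = ∀ i → x i ≡ y i

infixr 6 _⊕_
infixr 7 _⊙_

_⊕_ : Point n → Point n → Point n
(x ⊕ y) i = x i +ℚ y i

_⊙_ : ℚ → Point n → Point n
(a ⊙ x) i = a *ℚ x i

-- All coefficients are strictly positive, so this is the relative interior of the closed cone on
-- the generators; only then are distinct cells of a subdivision disjoint. The empty list has the
-- origin as its cone.
data Cone {n} : List (Point n) → Point n → Set where
  nil  : ∀ {x} → (∀ i → x i ≡ 0ℚ) → Cone [] x
  cons : ∀ {p P x y} a → 0ℚ <ℚ a → Cone P y → x ≐ a ⊙ p ⊕ y → Cone (p ∷ P) x

cone-resp : {P : List (Point n)} {x y : Point n} → x ≐ y → Cone P x → Cone P y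
cone-resp x≐y (nil x≡0) = nil (λ i → trans (sym (x≐y i)) (x≡0 i))
cone-resp x≐y (cons a a>0 c eq) = cons a a>0 c (λ i → trans (sym (x≐y i)) (eq i))

cone-scale : {P : List (Point n)} {x : Point n} {a : ℚ} → 0ℚ <ℚ a → Cone P x → Cone P (a ⊙ x)
cone-scale {a = a} a>0 (nil x≡0) = nil (λ i → trans (cong (a *ℚ_) (x≡0 i)) (ℚₚ.*-zeroʳ a))
cone-scale {a = a} a>0 (cons {p = p} {y = y} b b>0 c eq) =
  cons (a *ℚ b) (*-pos a>0 b>0) (cone-scale a>0 c) (λ i → trans (cong (a *ℚ_) (eq i))
    (solve 4 (λ a b p y → a :* (b :* p :+ y) := a :* b :* p :+ a :* y) refl a b (p i) (y i)))

cone-add : {P : List (Point n)} {x y : Point n} → Cone P x → Cone P y → Cone P (x ⊕ y)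
cone-add (nil x≡0) (nil y≡0) = nil (λ i → cong₂ _+ℚ_ (x≡0 i) (y≡0 i))
cone-add (cons {p = p} {y = x′} a a>0 c eq) (cons {y = y′} b b>0 d eq′) =
  cons (a +ℚ b) (+-pos-nonneg a>0 (ℚₚ.<⇒≤ b>0)) (cone-add c d) (λ i → trans (cong₂ _+ℚ_ (eq i) (eq′ i))
    (solve 5 (λ a b p x y → (a :* p :+ x) :+ (b :* p :+ y) := (a :+ b) :* p :+ (x :+ y)) refl a b (p i) (x′ i) (y′ i)))

cone-++⁺ : {P Q : List (Point n)} {x y : Point n} → Cone P x → Cone Q y → Cone (P ++ Q) (x ⊕ y)
cone-++⁺ {y = y} (nil x≡0) d = cone-resp (λ i → sym (trans (cong (_+ℚ y i) (x≡0 i)) (ℚₚ.+-identityˡ (y i)))) d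
cone-++⁺ {y = y} (cons {p = p} {y = x′} a a>0 c eq) d = cons a a>0 (cone-++⁺ c d)
  (λ i → trans (cong (_+ℚ y i) (eq i)) (ℚₚ.+-assoc (a *ℚ p i) (x′ i) (y i)))

cone-++⁻ : (P : List (Point n)) {Q : List (Point n)} {x : Point n} → Cone (P ++ Q) x →
           ∃[ y ] ∃[ z ] (Cone P y × Cone Q z × x ≐ y ⊕ z)
cone-++⁻ [] {x = x} c = (λ _ → 0ℚ) , x , nil (λ _ → refl) , c , λ i → sym (ℚₚ.+-identityˡ (x i))
cone-++⁻ (p ∷ P) (cons a a>0 c eq) with cone-++⁻ P c
... | y , z , cy , cz , eq′ = a ⊙ p ⊕ y , z , cons a a>0 cy (λ _ → refl) , cz ,
  λ i → trans (eq i) (trans (cong (a *ℚ p i +ℚ_) (eq′ i)) (sym (ℚₚ.+-assoc (a *ℚ p i) (y i) (z i))))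

cone-inhabited : (P : List (Point n)) → ∃[ x ] Cone P x
cone-inhabited [] = (λ _ → 0ℚ) , nil (λ _ → refl)
cone-inhabited (p ∷ P) with cone-inhabited P
... | x , c = 1ℚ ⊙ p ⊕ x , cons 1ℚ (ℚₚ.positive⁻¹ 1ℚ) c (λ _ → refl)

-- Points are functions compared by `≐`. Stating linearity for every x pointwise equal to the
-- combination makes `app` respect `≐` without function extensionality.
record Linear (n : ℕ) : Set where
  field
    app    : Point n → ℚ
    linear : ∀ a p y {x} → x ≐ a ⊙ p ⊕ y → app x ≡ a *ℚ app p +ℚ app y

  app-zero : ∀ {x} → (∀ i → x i ≡ 0ℚ) → app x ≡ 0ℚ
  app-zero {x} x≡0 = trans (linear (-ℚ 1ℚ) x x (λ i → trans (x≡0 i) (sym (cong₂ (λ u v → -ℚ 1ℚ *ℚ u +ℚ v) (x≡0 i) (x≡0 i)))))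
    (solve 1 (λ u → :- con 1ℚ :* u :+ u := con 0ℚ) refl (app x))

  app-resp : ∀ {x y} → x ≐ y → app x ≡ app y
  app-resp {x} {y} x≐y = trans (linear 0ℚ y y (λ i → trans (x≐y i) (solve 1 (λ u → u := con 0ℚ :* u :+ u) refl (y i))))
    (solve 1 (λ u → con 0ℚ :* u :+ u := u) refl (app y))

  app-⊕ : ∀ x y → app (x ⊕ y) ≡ app x +ℚ app y
  app-⊕ x y = trans (linear 1ℚ x y (λ i → solve 2 (λ u v → u :+ v := con 1ℚ :* u :+ v) refl (x i) (y i)))
    (solve 2 (λ u v → con 1ℚ :* u :+ v := u :+ v) refl (app x) (app y))

  app-⊙ : ∀ a x → app (a ⊙ x) ≡ a *ℚ app x
  app-⊙ a x = trans (linear a x (λ _ → 0ℚ) (λ i → sym (ℚₚ.+-identityʳ (a *ℚ x i))))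
    (trans (cong (a *ℚ app x +ℚ_) (app-zero {λ _ → 0ℚ} (λ _ → refl))) (ℚₚ.+-identityʳ _))

  app-lin₂ : ∀ a x b y → app (a ⊙ x ⊕ b ⊙ y) ≡ a *ℚ app x +ℚ b *ℚ app y
  app-lin₂ a x b y = trans (app-⊕ (a ⊙ x) (b ⊙ y)) (cong₂ _+ℚ_ (app-⊙ a x) (app-⊙ b y))

PositivelyClosed : (Point n → Set) → Set
PositivelyClosed Q = ∀ {p q a b} → 0ℚ <ℚ a → 0ℚ <ℚ b → Q p → Q q → Q (a ⊙ p ⊕ b ⊙ q)

-- Slicing an open cone by the hyperplane ℓ = 0: the slice is generated by the generators on the
-- hyperplane and by the points where the segments joining both open sides cross it.
module Slice {n} (ℓ : Linear n) where
  open Linear ℓ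

  data Split : List (Point n) → List (Point n) → List (Point n) → List (Point n) → Set where
    done : Split [] [] [] []
    neg  : ∀ {p P N Z U} → app p <ℚ 0ℚ → Split P N Z U → Split (p ∷ P) (p ∷ N) Z U
    zer  : ∀ {p P N Z U} → app p ≡ 0ℚ → Split P N Z U → Split (p ∷ P) N (p ∷ Z) U
    pos  : ∀ {p P N Z U} → 0ℚ <ℚ app p → Split P N Z U → Split (p ∷ P) N Z (p ∷ U)

  split : ∀ P → ∃[ N ] ∃[ Z ] ∃[ U ] Split P N Z U
  split [] = [] , [] , [] , done
  split (p ∷ P) with split P | ℚₚ.<-cmp (app p) 0ℚ
  ... | N , Z , U , s | tri< p<0 _ _ = p ∷ N , Z , U , neg p<0 s
  ... | N , Z , U , s | tri≈ _ p≡0 _ = N , p ∷ Z , U , zer p≡0 s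
  ... | N , Z , U , s | tri> _ _ p>0 = N , Z , p ∷ U , pos p>0 s

  private
    variable
      P N Z U : List (Point n)
      x y z : Point n

  split-All : {Q : Point n → Set} → Split P N Z U → All Q P →
              All (λ p → Q p × app p <ℚ 0ℚ) N × All (λ p → Q p × app p ≡ 0ℚ) Z × All (λ p → Q p × 0ℚ <ℚ app p) U
  split-All done [] = [] , [] , []
  split-All (neg s S) (q ∷ qs) with split-All S qs
  ... | a , b , c = (q , s) ∷ a , b , c
  split-All (zer s S) (q ∷ qs) with split-All S qs
  ... | a , b , c = a , (q , s) ∷ b , c
  split-All (pos s S) (q ∷ qs) with split-All S qs
  ... | a , b , c = a , b , (q , s) ∷ c

  negs : Split P N Z U → All (λ p → app p <ℚ 0ℚ) N
  negs {P = P} S = All.map proj₂ (proj₁ (split-All S (All.universal (λ _ → tt) P)))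

  zers : Split P N Z U → All (λ p → app p ≡ 0ℚ) Z
  zers {P = P} S = All.map proj₂ (proj₁ (proj₂ (split-All S (All.universal (λ _ → tt) P))))

  poss : Split P N Z U → All (λ p → 0ℚ <ℚ app p) U
  poss {P = P} S = All.map proj₂ (proj₂ (proj₂ (split-All S (All.universal (λ _ → tt) P))))

  split-neg : Split P N Z U → ∀ {p} → p ∈ˡ P → app p <ℚ 0ℚ → p ∈ˡ N
  split-neg (neg s S) (here refl) _ = here refl
  split-neg (zer s S) (here refl) l = contradiction s (ℚₚ.<⇒≢ l)
  split-neg (pos s S) (here refl) l = contradiction s (ℚₚ.<-asym l)
  split-neg (neg s S) (there i) l = there (split-neg S i l)
  split-neg (zer s S) (there i) l = split-neg S i l
  split-neg (pos s S) (there i) l = split-neg S i l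

  split-pos : Split P N Z U → ∀ {p} → p ∈ˡ P → 0ℚ <ℚ app p → p ∈ˡ U
  split-pos (pos s S) (here refl) _ = here refl
  split-pos (zer s S) (here refl) l = contradiction (sym s) (ℚₚ.<⇒≢ l)
  split-pos (neg s S) (here refl) l = contradiction s (ℚₚ.<-asym l)
  split-pos (neg s S) (there i) l = split-pos S i l
  split-pos (zer s S) (there i) l = split-pos S i l
  split-pos (pos s S) (there i) l = there (split-pos S i l)

  split-neg⁻ : Split P N Z U → ∀ {p} → p ∈ˡ N → p ∈ˡ P
  split-neg⁻ (neg s S) (here refl) = here refl
  split-neg⁻ (neg s S) (there i) = there (split-neg⁻ S i)
  split-neg⁻ (zer s S) i = there (split-neg⁻ S i)
  split-neg⁻ (pos s S) i = there (split-neg⁻ S i)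

  split-pos⁻ : Split P N Z U → ∀ {p} → p ∈ˡ U → p ∈ˡ P
  split-pos⁻ (pos s S) (here refl) = here refl
  split-pos⁻ (neg s S) i = there (split-pos⁻ S i)
  split-pos⁻ (zer s S) i = there (split-pos⁻ S i)
  split-pos⁻ (pos s S) (there i) = there (split-pos⁻ S i)

  split-cone⁺ : Split P N Z U → Cone P x →
                ∃[ xn ] ∃[ xz ] ∃[ xu ] (Cone N xn × Cone Z xz × Cone U xu × x ≐ (xn ⊕ xz) ⊕ xu)
  split-cone⁺ {x = x} done (nil x≡0) = x , x , x , nil x≡0 , nil x≡0 , nil x≡0 ,
    λ i → trans (x≡0 i) (sym (cong₂ _+ℚ_ (cong₂ _+ℚ_ (x≡0 i) (x≡0 i)) (x≡0 i)))
  split-cone⁺ (neg {p = p} s S) (cons a a>0 c eq) with split-cone⁺ S c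
  ... | xn , xz , xu , cn , cz , cu , e = a ⊙ p ⊕ xn , xz , xu , cons a a>0 cn (λ _ → refl) , cz , cu ,
    λ i → trans (eq i) (trans (cong (a *ℚ p i +ℚ_) (e i))
      (solve 4 (λ w u v t → w :+ ((u :+ v) :+ t) := ((w :+ u) :+ v) :+ t) refl (a *ℚ p i) (xn i) (xz i) (xu i)))
  split-cone⁺ (zer {p = p} s S) (cons a a>0 c eq) with split-cone⁺ S c
  ... | xn , xz , xu , cn , cz , cu , e = xn , a ⊙ p ⊕ xz , xu , cn , cons a a>0 cz (λ _ → refl) , cu ,
    λ i → trans (eq i) (trans (cong (a *ℚ p i +ℚ_) (e i))
      (solve 4 (λ w u v t → w :+ ((u :+ v) :+ t) := (u :+ (w :+ v)) :+ t) refl (a *ℚ p i) (xn i) (xz i) (xu i)))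
  split-cone⁺ (pos {p = p} s S) (cons a a>0 c eq) with split-cone⁺ S c
  ... | xn , xz , xu , cn , cz , cu , e = xn , xz , a ⊙ p ⊕ xu , cn , cz , cons a a>0 cu (λ _ → refl) ,
    λ i → trans (eq i) (trans (cong (a *ℚ p i +ℚ_) (e i))
      (solve 4 (λ w u v t → w :+ ((u :+ v) :+ t) := (u :+ v) :+ (w :+ t)) refl (a *ℚ p i) (xn i) (xz i) (xu i)))

  split-cone⁻ : Split P N Z U → Cone N x → Cone Z y → Cone U z → Cone P ((x ⊕ y) ⊕ z)
  split-cone⁻ done (nil x≡0) (nil y≡0) (nil z≡0) = nil (λ i → cong₂ _+ℚ_ (cong₂ _+ℚ_ (x≡0 i) (y≡0 i)) (z≡0 i))
  split-cone⁻ {y = y} {z = z} (neg {p = p} s S) (cons {y = x} a a>0 cn eq) cz cu = cons a a>0 (split-cone⁻ S cn cz cu)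
    (λ i → trans (cong (λ w → (w +ℚ y i) +ℚ z i) (eq i))
      (solve 4 (λ w u v t → ((w :+ u) :+ v) :+ t := w :+ ((u :+ v) :+ t)) refl (a *ℚ p i) (x i) (y i) (z i)))
  split-cone⁻ {x = x} {z = z} (zer {p = p} s S) cn (cons {y = y} a a>0 cz eq) cu = cons a a>0 (split-cone⁻ S cn cz cu)
    (λ i → trans (cong (λ w → (x i +ℚ w) +ℚ z i) (eq i))
      (solve 4 (λ w u v t → (u :+ (w :+ v)) :+ t := w :+ ((u :+ v) :+ t)) refl (a *ℚ p i) (x i) (y i) (z i)))
  split-cone⁻ {x = x} {y = y} (pos {p = p} s S) cn cz (cons {y = z} a a>0 cu eq) = cons a a>0 (split-cone⁻ S cn cz cu)
    (λ i → trans (cong (λ w → (x i +ℚ y i) +ℚ w) (eq i))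
      (solve 4 (λ w u v t → (u :+ v) :+ (w :+ t) := w :+ ((u :+ v) :+ t)) refl (a *ℚ p i) (x i) (y i) (z i)))

  app-cone≡0 : All (λ p → app p ≡ 0ℚ) P → Cone P x → app x ≡ 0ℚ
  app-cone≡0 [] (nil x≡0) = app-zero x≡0
  app-cone≡0 (e ∷ es) (cons {p = p} {y = y} a _ c eq) = trans (linear a p y eq)
    (trans (cong₂ (λ u v → a *ℚ u +ℚ v) e (app-cone≡0 es c)) (trans (ℚₚ.+-identityʳ _) (ℚₚ.*-zeroʳ a)))

  app-cone≥0 : All (λ p → 0ℚ <ℚ app p) P → Cone P x → 0ℚ ≤ℚ app x
  app-cone≥0 [] (nil x≡0) = ℚₚ.≤-reflexive (sym (app-zero x≡0))
  app-cone≥0 (l ∷ ls) (cons {p = p} {y = y} a a>0 c eq) = subst (0ℚ ≤ℚ_) (sym (linear a p y eq)) (+-nonneg (ℚₚ.<⇒≤ (*-pos a>0 l)) (app-cone≥0 ls c))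

  app-cone>0 : ∀ {p} → All (λ p → 0ℚ <ℚ app p) (p ∷ P) → Cone (p ∷ P) x → 0ℚ <ℚ app x
  app-cone>0 (l ∷ ls) (cons {p = p} {y = y} a a>0 c eq) = subst (0ℚ <ℚ_) (sym (linear a p y eq)) (+-pos-nonneg (*-pos a>0 l) (app-cone≥0 ls c))

  *-neg : ∀ {a b} → 0ℚ <ℚ a → b <ℚ 0ℚ → a *ℚ b <ℚ 0ℚ
  *-neg {a} {b} a>0 b<0 = subst (a *ℚ b <ℚ_) (ℚₚ.*-zeroʳ a) (ℚₚ.*-monoʳ-<-pos a {{positive a>0}} b<0)

  app-cone≤0 : All (λ p → app p <ℚ 0ℚ) P → Cone P x → app x ≤ℚ 0ℚ
  app-cone≤0 [] (nil x≡0) = ℚₚ.≤-reflexive (app-zero x≡0)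
  app-cone≤0 (l ∷ ls) (cons {p = p} {y = y} a a>0 c eq) = subst (_≤ℚ 0ℚ) (sym (linear a p y eq)) (ℚₚ.+-mono-≤ (ℚₚ.<⇒≤ (*-neg a>0 l)) (app-cone≤0 ls c))

  app-cone<0 : ∀ {p} → All (λ p → app p <ℚ 0ℚ) (p ∷ P) → Cone (p ∷ P) x → app x <ℚ 0ℚ
  app-cone<0 (l ∷ ls) (cons {p = p} {y = y} a a>0 c eq) = subst (_<ℚ 0ℚ) (sym (linear a p y eq)) (ℚₚ.+-mono-<-≤ (*-neg a>0 l) (app-cone≤0 ls c))

  -- A positive multiple of the point where the segment from p to q meets ℓ = 0: for p on the
  -- negative and q on the positive side both coefficients are positive, and no division occurs.
  crossing : Point n → Point n → Point n
  crossing p q = app q ⊙ p ⊕ (-ℚ app p) ⊙ q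

  app-crossing : ∀ p q → app (crossing p q) ≡ 0ℚ
  app-crossing p q = trans (app-lin₂ (app q) p (-ℚ app p) q)
    (solve 2 (λ u v → v :* u :+ :- u :* v := con 0ℚ) refl (app p) (app q))

  crossings : List (Point n) → List (Point n) → List (Point n)
  crossings N U = concatMap (λ p → map (crossing p) U) N

  row⁺ : ∀ p → Cone U y → Cone (map (crossing p) U) (crossing p y)
  row⁺ {y = y} p (nil y≡0) = nil (λ i → trans (cong₂ (λ u v → u *ℚ p i +ℚ (-ℚ app p) *ℚ v) (app-zero y≡0) (y≡0 i))
    (solve 2 (λ u v → con 0ℚ :* u :+ v :* con 0ℚ := con 0ℚ) refl (p i) (-ℚ app p)))
  row⁺ p (cons {p = q} {y = y} a a>0 c eq) = cons a a>0 (row⁺ p c)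
    (λ i → trans (cong₂ (λ u v → u *ℚ p i +ℚ (-ℚ app p) *ℚ v) (linear a q y eq) (eq i))
      (solve 7 (λ a lq ly pi lp qi yi → (a :* lq :+ ly) :* pi :+ :- lp :* (a :* qi :+ yi)
                  := a :* (lq :* pi :+ :- lp :* qi) :+ (ly :* pi :+ :- lp :* yi)) refl
        a (app q) (app y) (p i) (app p) (q i) (y i)))

  -- `crossing` is bilinear, so for x = Σ a_p p and y = Σ b_q q it equals Σ a_p b_q `crossing p q`,
  -- again with positive coefficients.
  crossings⁺ : Cone N x → Cone U y → Cone (crossings N U) (crossing x y)
  crossings⁺ {x = x} {y = y} (nil x≡0) d = nil (λ i → trans (cong₂ (λ u v → app y *ℚ u +ℚ (-ℚ v) *ℚ y i) (x≡0 i) (app-zero x≡0))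
    (solve 2 (λ u v → u :* con 0ℚ :+ :- con 0ℚ :* v := con 0ℚ) refl (app y) (y i)))
  crossings⁺ {y = y} (cons {p = p} {y = x} a a>0 c eq) d =
    cone-resp (λ i → sym (trans (cong₂ (λ u v → app y *ℚ u +ℚ (-ℚ v) *ℚ y i) (eq i) (linear a p x eq))
        (solve 7 (λ a ly pi xi lp lx yi → ly :* (a :* pi :+ xi) :+ :- (a :* lp :+ lx) :* yi
                    := a :* (ly :* pi :+ :- lp :* yi) :+ (ly :* xi :+ :- lx :* yi)) refl
          a (app y) (p i) (x i) (app p) (app x) (y i))))
      (cone-++⁺ (cone-scale a>0 (row⁺ p d)) (crossings⁺ c d))

  -- The coefficient a of p is the sum of the terms c · `app q` along the row. It is positive except
  -- for the empty row, through which the recursion passes.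
  row⁻ : ∀ {p} → app p <ℚ 0ℚ → All (λ q → 0ℚ <ℚ app q) U → Cone (map (crossing p) U) y →
         ∃[ a ] ∃[ z ] (0ℚ ≤ℚ a × (U ≢ [] → 0ℚ <ℚ a) × Cone U z × y ≐ a ⊙ p ⊕ z)
  row⁻ {U = []} {y = y} {p} _ _ (nil y≡0) = 0ℚ , y , ℚₚ.≤-refl , contradiction refl , nil y≡0 ,
    λ i → solve 2 (λ u v → v := con 0ℚ :* u :+ v) refl (p i) (y i)
  row⁻ {U = q ∷ U} {p = p} p<0 (q>0 ∷ qs) (cons c c>0 d eq) with row⁻ p<0 qs d
  ... | a , z , a≥0 , _ , cz , e = c *ℚ app q +ℚ a , (c *ℚ (-ℚ app p)) ⊙ q ⊕ z ,
    ℚₚ.<⇒≤ a′>0 , (λ _ → a′>0) , cons (c *ℚ (-ℚ app p)) (*-pos c>0 (neg-pos p<0)) cz (λ _ → refl) ,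
    λ i → trans (eq i) (trans (cong (c *ℚ (app q *ℚ p i +ℚ (-ℚ app p) *ℚ q i) +ℚ_) (e i))
      (solve 7 (λ c lq pi lp qi a zi → c :* (lq :* pi :+ :- lp :* qi) :+ (a :* pi :+ zi)
                  := (c :* lq :+ a) :* pi :+ (c :* :- lp :* qi :+ zi)) refl
        c (app q) (p i) (app p) (q i) a (z i)))
    where
    a′>0 : 0ℚ <ℚ c *ℚ app q +ℚ a
    a′>0 = +-pos-nonneg (*-pos c>0 q>0) a≥0

  crossings⁻ : ∀ {p q} → All (λ p → app p <ℚ 0ℚ) (p ∷ N) → All (λ q → 0ℚ <ℚ app q) (q ∷ U) →
               Cone (crossings (p ∷ N) (q ∷ U)) y → ∃[ xn ] ∃[ xu ] (Cone (p ∷ N) xn × Cone (q ∷ U) xu × y ≐ xn ⊕ xu)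
  crossings⁻ {N = []} {U = U} {y = y} {p} {q} (p<0 ∷ []) qs c with cone-++⁻ (map (crossing p) (q ∷ U)) c
  ... | y₁ , y₂ , c₁ , nil y₂≡0 , e with row⁻ p<0 qs c₁
  ... | a , z , _ , a>0 , cz , e′ = a ⊙ p , z , cons a (a>0 λ ()) (nil {x = λ _ → 0ℚ} λ _ → refl) (λ i → sym (ℚₚ.+-identityʳ _)) , cz ,
    λ i → trans (e i) (trans (cong (y₁ i +ℚ_) (y₂≡0 i)) (trans (ℚₚ.+-identityʳ _) (e′ i)))
  crossings⁻ {N = p′ ∷ N} {U = U} {p = p} {q} (p<0 ∷ ps) qs c with cone-++⁻ (map (crossing p) (q ∷ U)) c
  ... | y₁ , y₂ , c₁ , c₂ , e with row⁻ p<0 qs c₁ | crossings⁻ {N = N} {U = U} ps qs c₂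
  ... | a , z , _ , a>0 , cz , e′ | xn , xu , cn , cu , e″ =
    a ⊙ p ⊕ xn , z ⊕ xu , cons a (a>0 λ ()) cn (λ _ → refl) , cone-add cz cu ,
    λ i → trans (e i) (trans (cong₂ _+ℚ_ (e′ i) (e″ i))
      (solve 4 (λ u v w t → (u :+ v) :+ (w :+ t) := (u :+ w) :+ (v :+ t)) refl (a *ℚ p i) (z i) (xn i) (xu i)))

  -- If only one open side contains generators, the open cone misses the hyperplane, which is
  -- recorded by `[]`. Since `Cone []` still contains the origin, membership can be read back only
  -- from a nonempty list; hence the last hypothesis of `join⁻` and `slice⁻`.
  join : List (Point n) → List (Point n) → List (Point n) → List (Point n)
  join []      Z []      = Z
  join (p ∷ N) Z (q ∷ U) = Z ++ crossings (p ∷ N) (q ∷ U)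
  join []      Z (_ ∷ _) = []
  join (_ ∷ _) Z []      = []

  slice : List (Point n) → List (Point n)
  slice P = join (proj₁ (split P)) (proj₁ (proj₂ (split P))) (proj₁ (proj₂ (proj₂ (split P))))

  join⁺ : Split P N Z U → Cone P x → app x ≡ 0ℚ → Cone (join N Z U) x
  join⁺ {P = P} {x = x} S c x≡0 with split-cone⁺ S c
  ... | xn , xz , xu , cn , cz , cu , e = go S cn cz cu
    where
    sum≡0 : app xn +ℚ app xu ≡ 0ℚ
    sum≡0 = begin
      app xn +ℚ app xu                   ≡⟨ solve 2 (λ u v → u :+ v := (u :+ con 0ℚ) :+ v) refl (app xn) (app xu) ⟩
      (app xn +ℚ 0ℚ) +ℚ app xu           ≡⟨ cong (λ u → (app xn +ℚ u) +ℚ app xu) (sym (app-cone≡0 (zers S) cz)) ⟩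
      (app xn +ℚ app xz) +ℚ app xu       ≡⟨ cong (_+ℚ app xu) (sym (app-⊕ xn xz)) ⟩
      app (xn ⊕ xz) +ℚ app xu            ≡⟨ sym (app-⊕ (xn ⊕ xz) xu) ⟩
      app ((xn ⊕ xz) ⊕ xu)               ≡⟨ sym (app-resp e) ⟩
      app x                              ≡⟨ x≡0 ⟩
      0ℚ                                 ∎
      where open ≡-Reasoning
    go : ∀ {N Z U} → Split P N Z U → Cone N xn → Cone Z xz → Cone U xu → Cone (join N Z U) x
    go {[]} {Z} {[]} S (nil n≡0) cz (nil u≡0) = cone-resp
      (λ i → sym (trans (e i) (trans (cong₂ (λ u v → (u +ℚ xz i) +ℚ v) (n≡0 i) (u≡0 i))
        (solve 1 (λ u → (con 0ℚ :+ u) :+ con 0ℚ := u) refl (xz i))))) cz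
    go {[]} {Z} {q ∷ U} S (nil n≡0) cz cu = contradiction
      (trans (sym (trans (cong (_+ℚ app xu) (app-zero n≡0)) (ℚₚ.+-identityˡ _))) sum≡0) (pos⇒≢0 (app-cone>0 (poss S) cu))
    go {p ∷ N} {Z} {[]} S cn cz (nil u≡0) = contradiction
      (trans (sym (trans (cong (app xn +ℚ_) (app-zero u≡0)) (ℚₚ.+-identityʳ _))) sum≡0) (ℚₚ.<⇒≢ (app-cone<0 (negs S) cn))
    -- Here `app xn` = - `app xu`, so `crossing xn xu` is `app xu` times `xn ⊕ xu`; dividing by this
    -- positive number restores the sum.
    go {p ∷ N} {Z} {q ∷ U} S cn cz cu = cone-resp eq (cone-++⁺ cz (cone-scale (inv-pos D>0) (crossings⁺ cn cu)))
      where
      D = app xu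
      D>0 : 0ℚ <ℚ D
      D>0 = app-cone>0 (poss S) cu
      -n≡D : -ℚ app xn ≡ D
      -n≡D = trans (solve 2 (λ u v → :- u := :- (u :+ v) :+ v) refl (app xn) D) (trans (cong (λ w → -ℚ w +ℚ D) sum≡0) (ℚₚ.+-identityˡ D))
      eq : xz ⊕ inv D ⊙ crossing xn xu ≐ x
      eq i = begin
        xz i +ℚ inv D *ℚ (D *ℚ xn i +ℚ (-ℚ app xn) *ℚ xu i) ≡⟨ cong (λ w → xz i +ℚ inv D *ℚ (D *ℚ xn i +ℚ w *ℚ xu i)) -n≡D ⟩
        xz i +ℚ inv D *ℚ (D *ℚ xn i +ℚ D *ℚ xu i) ≡⟨ solve 5 (λ a b c d e → a :+ b :* (c :* d :+ c :* e) := a :+ (c :* b) :* (d :+ e)) refl (xz i) (inv D) D (xn i) (xu i) ⟩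
        xz i +ℚ (D *ℚ inv D) *ℚ (xn i +ℚ xu i) ≡⟨ cong (λ w → xz i +ℚ w *ℚ (xn i +ℚ xu i)) (*-inv-pos D>0) ⟩
        xz i +ℚ 1ℚ *ℚ (xn i +ℚ xu i) ≡⟨ solve 3 (λ a d e → a :+ con 1ℚ :* (d :+ e) := (d :+ a) :+ e) refl (xz i) (xn i) (xu i) ⟩
        (xn i +ℚ xz i) +ℚ xu i ≡⟨ sym (e i) ⟩
        x i ∎
        where open ≡-Reasoning

  slice⁺ : Cone P x → app x ≡ 0ℚ → Cone (slice P) x
  slice⁺ {P = P} = join⁺ (proj₂ (proj₂ (proj₂ (split P))))

  join⁻ : Split P N Z U → Cone (join N Z U) x → join N Z U ≢ [] → Cone P x
  join⁻ {N = []} {Z} {[]} {x} S c _ = cone-resp (λ i → solve 1 (λ u → (con 0ℚ :+ u) :+ con 0ℚ := u) refl (x i))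
    (split-cone⁻ S (nil {x = λ _ → 0ℚ} (λ _ → refl)) c (nil {x = λ _ → 0ℚ} (λ _ → refl)))
  join⁻ {N = p ∷ N} {Z} {q ∷ U} S c _ with cone-++⁻ Z c
  ... | xz , y , cz , cy , e with crossings⁻ {N = N} {U = U} (negs S) (poss S) cy
  ... | xn , xu , cn , cu , e′ = cone-resp
    (λ i → sym (trans (e i) (trans (cong (xz i +ℚ_) (e′ i)) (solve 3 (λ u v w → u :+ (v :+ w) := (v :+ u) :+ w) refl (xz i) (xn i) (xu i)))))
    (split-cone⁻ S cn cz cu)
  join⁻ {N = []} {Z} {_ ∷ _} S c ne = contradiction refl ne
  join⁻ {N = _ ∷ _} {Z} {[]} S c ne = contradiction refl ne

  slice⁻ : Cone (slice P) x → slice P ≢ [] → Cone P x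
  slice⁻ {P = P} = join⁻ (proj₂ (proj₂ (proj₂ (split P))))

  row-All : {Q R : Point n → Set} → ∀ {p} → (∀ {q} → R q → Q (crossing p q)) → All R U → All Q (map (crossing p) U)
  row-All f [] = []
  row-All f (r ∷ rs) = f r ∷ row-All f rs

  crossings-All : {Q R T : Point n → Set} → (∀ {p q} → R p → T q → Q (crossing p q)) → All R N → All T U → All Q (crossings N U)
  crossings-All f [] ts = []
  crossings-All f (r ∷ rs) ts = Allₚ.++⁺ (row-All (f r) ts) (crossings-All f rs ts)

  join-All : {Q : Point n → Set} → PositivelyClosed Q → Split P N Z U → All Q P → All (λ p → Q p × app p ≡ 0ℚ) (join N Z U)
  join-All {N = []} {U = []} cl S qs = proj₁ (proj₂ (split-All S qs))
  join-All {N = []} {U = _ ∷ _} cl S qs = []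
  join-All {N = _ ∷ _} {U = []} cl S qs = []
  join-All {N = _ ∷ _} {U = _ ∷ _} cl S qs with split-All S qs
  ... | as , bs , cs = Allₚ.++⁺ bs (crossings-All (λ { {p} {q} (Qp , p<0) (Qq , q>0) → cl q>0 (neg-pos p<0) Qp Qq , app-crossing p q }) as cs)

  slice-All : {Q : Point n → Set} → PositivelyClosed Q → All Q P → All (λ p → Q p × app p ≡ 0ℚ) (slice P)
  slice-All {P = P} cl = join-All cl (proj₂ (proj₂ (proj₂ (split P))))

-- Euler characteristic modulo 2

parity : (A → Bool) → List A → Bool
parity f []       = false
parity f (x ∷ xs) = f x xor parity f xs

parity-cong : {f g : A → Bool} (xs : List A) → (∀ {x} → x ∈ˡ xs → f x ≡ g x) → parity f xs ≡ parity g xs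
parity-cong []       f≗g = refl
parity-cong (x ∷ xs) f≗g = cong₂ _xor_ (f≗g (here refl)) (parity-cong xs (f≗g ∘ there))

parity-false : {f : A → Bool} (xs : List A) → (∀ {x} → x ∈ˡ xs → f x ≡ false) → parity f xs ≡ false
parity-false []       f≗0 = refl
parity-false (x ∷ xs) f≗0 = cong₂ _xor_ (f≗0 (here refl)) (parity-false xs (f≗0 ∘ there))

xor-interchange : ∀ a b c d → (a xor b) xor (c xor d) ≡ (a xor c) xor (b xor d)
xor-interchange false false c d = refl
xor-interchange false true  false d = refl
xor-interchange false true  true  false = refl
xor-interchange false true  true  true  = refl
xor-interchange true  false false d = refl
xor-interchange true  false true  false = refl
xor-interchange true  false true  true  = refl
xor-interchange true  true  false false = refl
xor-interchange true  true  false true  = refl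
xor-interchange true  true  true  false = refl
xor-interchange true  true  true  true  = refl

parity-xor : (f g : A → Bool) (xs : List A) → parity (λ x → f x xor g x) xs ≡ parity f xs xor parity g xs
parity-xor f g []       = refl
parity-xor f g (x ∷ xs) = trans (cong ((f x xor g x) xor_) (parity-xor f g xs))
  (xor-interchange (f x) (g x) (parity f xs) (parity g xs))

parity-swap : (f : A → B → Bool) (xs : List A) (ys : List B) →
              parity (λ x → parity (f x) ys) xs ≡ parity (λ y → parity (λ x → f x y) xs) ys
parity-swap f []       ys = sym (parity-false ys (λ _ → refl))
parity-swap f (x ∷ xs) ys = trans (cong (parity (f x) ys xor_) (parity-swap f xs ys))
  (sym (parity-xor (f x) (λ y → parity (λ x → f x y) xs) ys))

parity-unique : {f : A → Bool} {x : A} {xs : List A} → Unique xs → x ∈ˡ xs → f x ≡ true →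
                (∀ {y} → y ∈ˡ xs → f y ≡ true → y ≡ x) → parity f xs ≡ true
parity-unique {f = f} {xs = x ∷ xs} (x∉ ∷ u) (here refl) fx uniq = cong₂ _xor_ fx (parity-false xs none)
  where
  none : ∀ {y} → y ∈ˡ xs → f y ≡ false
  none {y} y∈ with f y in eq
  ... | false = refl
  ... | true  = contradiction (sym (uniq (there y∈) eq)) (All.lookup x∉ y∈)
parity-unique {f = f} {xs = y ∷ xs} (y∉ ∷ u) (there x∈) fx uniq with f y in eq
... | false = parity-unique u x∈ fx (uniq ∘ there)
... | true  = contradiction (uniq (here refl) eq) (All.lookup y∉ x∈)

-- Critical heights and the parity of sample points

insert : ℚ → List ℚ → List ℚ
insert c [] = c ∷ []
insert c (d ∷ ds) with ℚₚ.<-cmp c d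
... | tri< _ _ _ = c ∷ d ∷ ds
... | tri≈ _ _ _ = d ∷ ds
... | tri> _ _ _ = d ∷ insert c ds

∈-insert : ∀ c ds → c ∈ˡ insert c ds
∈-insert c [] = here refl
∈-insert c (d ∷ ds) with ℚₚ.<-cmp c d
... | tri< _ _ _    = here refl
... | tri≈ _ refl _ = here refl
... | tri> _ _ _    = there (∈-insert c ds)

insert-⊇ : ∀ c ds {x} → x ∈ˡ ds → x ∈ˡ insert c ds
insert-⊇ c (d ∷ ds) x∈ with ℚₚ.<-cmp c d
insert-⊇ c (d ∷ ds) x∈         | tri< _ _ _ = there x∈
insert-⊇ c (d ∷ ds) x∈         | tri≈ _ _ _ = x∈
insert-⊇ c (d ∷ ds) (here eq)  | tri> _ _ _ = here eq
insert-⊇ c (d ∷ ds) (there x∈) | tri> _ _ _ = there (insert-⊇ c ds x∈)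

insert-All : {Q : ℚ → Set} → ∀ {c ds} → Q c → All Q ds → All Q (insert c ds)
insert-All qc [] = qc ∷ []
insert-All {c = c} {d ∷ ds} qc (qd ∷ qs) with ℚₚ.<-cmp c d
... | tri< _ _ _ = qc ∷ qd ∷ qs
... | tri≈ _ _ _ = qd ∷ qs
... | tri> _ _ _ = qd ∷ insert-All qc qs

insert-sorted : ∀ c {ds} → AllPairs _<ℚ_ ds → AllPairs _<ℚ_ (insert c ds)
insert-sorted c [] = [] ∷ []
insert-sorted c {d ∷ ds} (d< ∷ s) with ℚₚ.<-cmp c d
... | tri< c<d _ _ = (c<d ∷ All.map (ℚₚ.<-trans c<d) d<) ∷ d< ∷ s
... | tri≈ _ _ _   = d< ∷ s
... | tri> _ _ d<c = insert-All d<c d< ∷ insert-sorted c s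

sort : List ℚ → List ℚ
sort []       = []
sort (c ∷ cs) = insert c (sort cs)

sort-sorted : ∀ cs → AllPairs _<ℚ_ (sort cs)
sort-sorted []       = []
sort-sorted (c ∷ cs) = insert-sorted c (sort-sorted cs)

∈-sort : ∀ {x} cs → x ∈ˡ cs → x ∈ˡ sort cs
∈-sort (c ∷ cs) (here refl) = ∈-insert c (sort cs)
∈-sort (c ∷ cs) (there x∈)  = insert-⊇ c (sort cs) (∈-sort cs x∈)

sort-All : {Q : ℚ → Set} → ∀ {cs} → All Q cs → All Q (sort cs)
sort-All []       = []
sort-All (q ∷ qs) = insert-All q (sort-All qs)

mid : ℚ → ℚ → ℚ
mid c d = ½ *ℚ (c +ℚ d)

½-double : ∀ c → ½ *ℚ (c +ℚ c) ≡ c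
½-double c = solve 1 (λ c → con ½ :* (c :+ c) := c) refl c

mid-> : ∀ {c d} → c <ℚ d → c <ℚ mid c d
mid-> {c} {d} c<d = subst (_<ℚ mid c d) (½-double c) (ℚₚ.*-monoʳ-<-pos ½ (ℚₚ.+-monoʳ-< c c<d))

mid-< : ∀ {c d} → c <ℚ d → mid c d <ℚ d
mid-< {c} {d} c<d = subst (mid c d <ℚ_) (½-double d) (ℚₚ.*-monoʳ-<-pos ½ (ℚₚ.+-monoˡ-< d c<d))

samples : List ℚ → List ℚ
samples []           = []
samples (c ∷ [])     = c ∷ []
samples (c ∷ d ∷ cs) = c ∷ mid c d ∷ samples (d ∷ cs)

samples-All : {Q : ℚ → Set} → (∀ {c d} → Q c → Q d → Q (mid c d)) → ∀ {cs} → All Q cs → All Q (samples cs)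
samples-All f []             = []
samples-All f (q ∷ [])       = q ∷ []
samples-All f (q ∷ q′ ∷ qs)  = q ∷ f q q′ ∷ samples-All f (q′ ∷ qs)

samples-≥ : ∀ {c cs} → AllPairs _<ℚ_ (c ∷ cs) → All (c ≤ℚ_) (samples (c ∷ cs))
samples-≥ {cs = []} _ = ℚₚ.≤-refl ∷ []
samples-≥ {c} {d ∷ cs} ((c<d ∷ _) ∷ s) = ℚₚ.≤-refl ∷ ℚₚ.<⇒≤ (mid-> c<d) ∷ All.map (ℚₚ.≤-trans (ℚₚ.<⇒≤ c<d)) (samples-≥ s)

lt le : ℚ → ℚ → Bool
lt c s = ⌊ s ℚₚ.<? c ⌋
le c s = ⌊ s ℚₚ.≤? c ⌋

lt-true : ∀ {c s} → s <ℚ c → lt c s ≡ true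
lt-true {c} {s} s<c with s ℚₚ.<? c
... | yes _   = refl
... | no  s≮c = contradiction s<c s≮c

lt-false : ∀ {c s} → c ≤ℚ s → lt c s ≡ false
lt-false {c} {s} c≤s with s ℚₚ.<? c
... | yes s<c = contradiction (ℚₚ.<-≤-trans s<c c≤s) (ℚₚ.<-irrefl refl)
... | no  _   = refl

le-true : ∀ {c s} → s ≤ℚ c → le c s ≡ true
le-true {c} {s} s≤c with s ℚₚ.≤? c
... | yes _   = refl
... | no  s≰c = contradiction s≤c s≰c

le-false : ∀ {c s} → c <ℚ s → le c s ≡ false
le-false {c} {s} c<s with s ℚₚ.≤? c
... | yes s≤c = contradiction (ℚₚ.<-≤-trans c<s s≤c) (ℚₚ.<-irrefl refl)
... | no  _   = refl

samples-odd : ∀ c cs → parity (λ _ → true) (samples (c ∷ cs)) ≡ true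
samples-odd c []       = refl
samples-odd c (d ∷ cs) = cong (λ b → not (not b)) (samples-odd d cs)

head-≤ : ∀ {d cs} → AllPairs _<ℚ_ (d ∷ cs) → ∀ {e} → e ∈ˡ d ∷ cs → d ≤ℚ e
head-≤ _        (here refl) = ℚₚ.≤-refl
head-≤ (d< ∷ _) (there e∈)  = ℚₚ.<⇒≤ (All.lookup d< e∈)

samples-odd′ : ∀ {cs} → ∃[ c ] c ∈ˡ cs → parity (λ _ → true) (samples cs) ≡ true
samples-odd′ {c ∷ cs} _ = samples-odd c cs

-- The samples below c come in pairs, each critical height with the midpoint of the gap after it.
samples-lt : ∀ {cs} → AllPairs _<ℚ_ cs → ∀ {c} → c ∈ˡ cs → parity (lt c) (samples cs) ≡ false
samples-lt {c ∷ cs} s (here refl) = parity-false (samples (c ∷ cs)) (λ x∈ → lt-false (All.lookup (samples-≥ s) x∈))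
samples-lt {c ∷ d ∷ cs} ((c<d ∷ c<) ∷ s) (there e∈) =
  cong₂ _xor_ (lt-true (All.lookup (c<d ∷ c<) e∈))
    (cong₂ _xor_ (lt-true (ℚₚ.<-≤-trans (mid-< c<d) (head-≤ s e∈))) (samples-lt s e∈))

-- To the pairs below c, the sample c itself is added.
samples-le : ∀ {cs} → AllPairs _<ℚ_ cs → ∀ {c} → c ∈ˡ cs → parity (le c) (samples cs) ≡ true
samples-le {c ∷ []} s (here refl) = cong (_xor false) (le-true (ℚₚ.≤-refl {c}))
samples-le {c ∷ d ∷ cs} ((c<d ∷ c<) ∷ s) (here refl) =
  cong₂ _xor_ (le-true (ℚₚ.≤-refl {c})) (cong₂ _xor_ (le-false (mid-> c<d))
    (parity-false {f = le c} (samples (d ∷ cs)) (λ x∈ → le-false (ℚₚ.<-≤-trans c<d (All.lookup (samples-≥ s) x∈)))))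
samples-le {c ∷ d ∷ cs} ((c<d ∷ c<) ∷ s) (there e∈) =
  cong₂ _xor_ (le-true (ℚₚ.<⇒≤ (All.lookup (c<d ∷ c<) e∈)))
    (cong₂ _xor_ (le-true (ℚₚ.<⇒≤ (ℚₚ.<-≤-trans (mid-< c<d) (head-≤ s e∈)))) (samples-le s e∈))

minimum : (f : A → ℚ) (x : A) (xs : List A) → ∃[ y ] (y ∈ˡ x ∷ xs × (∀ {z} → z ∈ˡ x ∷ xs → f y ≤ℚ f z))
minimum f x [] = x , here refl , λ { (here refl) → ℚₚ.≤-refl }
minimum f x (x′ ∷ xs) with minimum f x′ xs
... | y , y∈ , y≤ with ℚₚ.≤-total (f x) (f y)
... | inj₁ x≤y = x , here refl , λ { (here refl) → ℚₚ.≤-refl ; (there z∈) → ℚₚ.≤-trans x≤y (y≤ z∈) }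
... | inj₂ y≤x = y , there y∈ , λ { (here refl) → y≤x ; (there z∈) → y≤ z∈ }

maximum : (f : A → ℚ) (x : A) (xs : List A) → ∃[ y ] (y ∈ˡ x ∷ xs × (∀ {z} → z ∈ˡ x ∷ xs → f z ≤ℚ f y))
maximum f x [] = x , here refl , λ { (here refl) → ℚₚ.≤-refl }
maximum f x (x′ ∷ xs) with maximum f x′ xs
... | y , y∈ , y≥ with ℚₚ.≤-total (f x) (f y)
... | inj₂ y≤x = x , here refl , λ { (here refl) → ℚₚ.≤-refl ; (there z∈) → ℚₚ.≤-trans (y≥ z∈) y≤x }
... | inj₁ x≤y = y , there y∈ , λ { (here refl) → x≤y ; (there z∈) → y≥ z∈ }

nonempty : List A → Bool
nonempty []      = false
nonempty (_ ∷ _) = true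

nonempty-true⁺ : {xs : List A} → xs ≢ [] → nonempty xs ≡ true
nonempty-true⁺ {xs = []}    xs≢[] = contradiction refl xs≢[]
nonempty-true⁺ {xs = _ ∷ _} _     = refl

nonempty-true⁻ : (xs : List A) → nonempty xs ≡ true → xs ≢ []
nonempty-true⁻ (_ ∷ _) _ ()

nonempty-∈ : {xs : List A} {x : A} → x ∈ˡ xs → nonempty xs ≡ true
nonempty-∈ {xs = _ ∷ _} _ = refl

-- Sweeping a cell decomposition along one coordinate

total : Point n → ℚ
total = sumFin

total-linear : ∀ a (p y : Point n) {x : Point n} → x ≐ a ⊙ p ⊕ y → total x ≡ a *ℚ total p +ℚ total y
total-linear a p y eq = trans (sumFin-cong eq) (trans (sumFin-+ (a ⊙ p) y) (cong (_+ℚ total y) (sumFin-*ˡ a p)))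

totalL : ∀ n → Linear n
totalL n = record { app = total ; linear = total-linear }

-- Homogeneous form of the equation x_j = s on the hyperplane of total 1; at a point p of positive
-- total its sign is that of `ratio j p` - s.
level : Fin n → ℚ → Linear n
level j s = record
  { app    = λ x → x j +ℚ (-ℚ s) *ℚ total x
  ; linear = λ a p y {x} eq → trans (cong₂ (λ u v → u +ℚ (-ℚ s) *ℚ v) (eq j) (total-linear a p y eq))
      (solve 6 (λ a pj yj s hp hy → (a :* pj :+ yj) :+ :- s :* (a :* hp :+ hy)
                 := a :* (pj :+ :- s :* hp) :+ (yj :+ :- s :* hy)) refl a (p j) (y j) s (total p) (total y))
  }

ratio : Fin n → Point n → ℚ
ratio j p = p j *ℚ inv (total p)

ratio-* : (j : Fin n) (p : Point n) → 0ℚ <ℚ total p → p j ≡ ratio j p *ℚ total p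
ratio-* j p h>0 = begin
  p j                                ≡⟨ sym (ℚₚ.*-identityʳ (p j)) ⟩
  p j *ℚ 1ℚ                          ≡⟨ cong (p j *ℚ_) (sym (*-inv-pos h>0)) ⟩
  p j *ℚ (total p *ℚ inv (total p))  ≡⟨ solve 3 (λ a b c → a :* (b :* c) := (a :* c) :* b) refl (p j) (total p) (inv (total p)) ⟩
  ratio j p *ℚ total p               ∎
  where open ≡-Reasoning

level-app : (j : Fin n) (s : ℚ) (p : Point n) → 0ℚ <ℚ total p →
            Linear.app (level j s) p ≡ (ratio j p +ℚ (-ℚ s)) *ℚ total p
level-app j s p h>0 = trans (cong (_+ℚ (-ℚ s) *ℚ total p) (ratio-* j p h>0))
  (sym (ℚₚ.*-distribʳ-+ (total p) (ratio j p) (-ℚ s)))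

module _ (j : Fin n) (s : ℚ) (p : Point n) (h>0 : 0ℚ <ℚ total p) where
  open Linear (level j s)

  private
    instance
      _ = positive h>0
      _ = ℚₚ.pos⇒nonNeg (total p)

    lhs : app p ≡ (ratio j p +ℚ (-ℚ s)) *ℚ total p
    lhs = level-app j s p h>0

  level-neg⁺ : ratio j p <ℚ s → app p <ℚ 0ℚ
  level-neg⁺ r<s = subst (_<ℚ 0ℚ) (sym lhs) (subst ((ratio j p +ℚ (-ℚ s)) *ℚ total p <ℚ_) (ℚₚ.*-zeroˡ (total p))
    (ℚₚ.*-monoˡ-<-pos (total p) (subst (ratio j p +ℚ (-ℚ s) <ℚ_) (ℚₚ.+-inverseʳ s) (ℚₚ.+-monoˡ-< (-ℚ s) r<s))))

  level-pos⁺ : s <ℚ ratio j p → 0ℚ <ℚ app p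
  level-pos⁺ s<r = subst (0ℚ <ℚ_) (sym lhs) (subst (_<ℚ (ratio j p +ℚ (-ℚ s)) *ℚ total p) (ℚₚ.*-zeroˡ (total p))
    (ℚₚ.*-monoˡ-<-pos (total p) (subst (_<ℚ ratio j p +ℚ (-ℚ s)) (ℚₚ.+-inverseʳ s) (ℚₚ.+-monoˡ-< (-ℚ s) s<r))))

  level-zero⁺ : ratio j p ≡ s → app p ≡ 0ℚ
  level-zero⁺ r≡s = trans lhs (trans (cong (λ u → (u +ℚ (-ℚ s)) *ℚ total p) r≡s)
    (trans (cong (_*ℚ total p) (ℚₚ.+-inverseʳ s)) (ℚₚ.*-zeroˡ (total p))))

  level-neg⁻ : app p <ℚ 0ℚ → ratio j p <ℚ s
  level-neg⁻ p<0 with ℚₚ.<-cmp (ratio j p) s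
  ... | tri< r<s _ _ = r<s
  ... | tri≈ _ r≡s _ = contradiction (level-zero⁺ r≡s) (ℚₚ.<⇒≢ p<0)
  ... | tri> _ _ s<r = contradiction (level-pos⁺ s<r) (ℚₚ.<-asym p<0)

  level-pos⁻ : 0ℚ <ℚ app p → s <ℚ ratio j p
  level-pos⁻ p>0 with ℚₚ.<-cmp (ratio j p) s
  ... | tri< r<s _ _ = contradiction (level-neg⁺ r<s) (ℚₚ.<-asym p>0)
  ... | tri≈ _ r≡s _ = contradiction (level-zero⁺ r≡s) (pos⇒≢0 p>0)
  ... | tri> _ _ s<r = s<r

-- The slice at height s is nonempty exactly for min < s < max, or s = min = max; the two cases
-- have the common expression [s < max] xor [s ≤ min].
module _ (j : Fin n) (s : ℚ) where
  open Slice (level j s)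
  open Linear (level j s)

  nonempty-join : ∀ {P N Z U} → Split P N Z U → P ≢ [] → All (λ p → 0ℚ <ℚ total p) P → ∀ {a b} → a ∈ˡ P → b ∈ˡ P →
    (∀ {p} → p ∈ˡ P → ratio j a ≤ℚ ratio j p) → (∀ {p} → p ∈ˡ P → ratio j p ≤ℚ ratio j b) →
    nonempty (join N Z U) ≡ lt (ratio j b) s xor le (ratio j a) s
  nonempty-join {P} {N} {Z} {U} S P≢[] h {a} {b} a∈ b∈ a≤ ≤b with s ℚₚ.≤? ratio j a | s ℚₚ.<? ratio j b
  ... | yes s≤a | yes s<b = go (split-pos S b∈ (level-pos⁺ j s b (All.lookup h b∈) s<b)) noN
    where
    noN : ∀ {p} → p ∈ˡ N → Void
    noN {p} p∈ = ℚₚ.<-irrefl refl (ℚₚ.<-≤-trans (level-neg⁻ j s p (All.lookup h (split-neg⁻ S p∈)) (All.lookup (negs S) p∈)) (ℚₚ.≤-trans s≤a (a≤ (split-neg⁻ S p∈))))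
    go : ∀ {N U} {u : Point n} → u ∈ˡ U → (∀ {p} → p ∈ˡ N → Void) → nonempty (join N Z U) ≡ false
    go {[]} {_ ∷ _} _ _ = refl
    go {_ ∷ _} {_ ∷ _} _ none = ⊥-elim (none (here refl))
  ... | yes s≤a | no s≮b = go S P≢[] noN noU
    where
    b≤s : ratio j b ≤ℚ s
    b≤s = ℚₚ.≮⇒≥ s≮b
    noN : ∀ {p} → p ∈ˡ N → Void
    noN {p} p∈ = ℚₚ.<-irrefl refl (ℚₚ.<-≤-trans (level-neg⁻ j s p (All.lookup h (split-neg⁻ S p∈)) (All.lookup (negs S) p∈)) (ℚₚ.≤-trans s≤a (a≤ (split-neg⁻ S p∈))))
    noU : ∀ {p} → p ∈ˡ U → Void
    noU {p} p∈ = ℚₚ.<-irrefl refl (ℚₚ.<-≤-trans (level-pos⁻ j s p (All.lookup h (split-pos⁻ S p∈)) (All.lookup (poss S) p∈)) (ℚₚ.≤-trans (≤b (split-pos⁻ S p∈)) b≤s))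
    go : ∀ {P N Z U} → Split P N Z U → P ≢ [] → (∀ {p} → p ∈ˡ N → Void) → (∀ {p} → p ∈ˡ U → Void) → nonempty (join N Z U) ≡ true
    go done ne _ _ = contradiction refl ne
    go (neg _ _) _ none _ = ⊥-elim (none (here refl))
    go (pos _ _) _ _ none = ⊥-elim (none (here refl))
    go {N = []} {U = []} (zer _ _) _ _ _ = refl
    go {N = _ ∷ _} (zer _ _) _ none _ = ⊥-elim (none (here refl))
    go {U = _ ∷ _} (zer _ _) _ _ none = ⊥-elim (none (here refl))
  ... | no s≰a | yes s<b = go (split-neg S a∈ (level-neg⁺ j s a (All.lookup h a∈) (ℚₚ.≰⇒> s≰a)))
                              (split-pos S b∈ (level-pos⁺ j s b (All.lookup h b∈) s<b)) Z
    where
    go : ∀ {N U} {u v : Point n} → v ∈ˡ N → u ∈ˡ U → ∀ Z → nonempty (join N Z U) ≡ true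
    go {_ ∷ _} {_ ∷ _} _ _ []      = refl
    go {_ ∷ _} {_ ∷ _} _ _ (_ ∷ _) = refl
  ... | no s≰a | no s≮b = go (split-neg S a∈ (level-neg⁺ j s a (All.lookup h a∈) (ℚₚ.≰⇒> s≰a))) noU
    where
    noU : ∀ {p} → p ∈ˡ U → Void
    noU {p} p∈ = ℚₚ.<-irrefl refl (ℚₚ.<-≤-trans (level-pos⁻ j s p (All.lookup h (split-pos⁻ S p∈)) (All.lookup (poss S) p∈)) (ℚₚ.≤-trans (≤b (split-pos⁻ S p∈)) (ℚₚ.≮⇒≥ s≮b)))
    go : ∀ {N U} {v : Point n} → v ∈ˡ N → (∀ {p} → p ∈ˡ U → Void) → nonempty (join N Z U) ≡ false
    go {_ ∷ _} {[]} _ _ = refl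
    go {_ ∷ _} {_ ∷ _} _ none = ⊥-elim (none (here refl))

-- Both points are scaled to total 1 before they are added; the sum has total 2, and `inv` of this
-- closed rational evaluates to ½.
ratio-mid : (j : Fin n) (p q : Point n) → 0ℚ <ℚ total p → 0ℚ <ℚ total q →
  ratio j (inv (total p) ⊙ p ⊕ inv (total q) ⊙ q) ≡ mid (ratio j p) (ratio j q)
ratio-mid {n} j p q hp hq = begin
  (a *ℚ p j +ℚ b *ℚ q j) *ℚ inv (total (a ⊙ p ⊕ b ⊙ q)) ≡⟨ cong₂ _*ℚ_ (cong₂ _+ℚ_ (ℚₚ.*-comm a (p j)) (ℚₚ.*-comm b (q j))) inverse ⟩
  (ratio j p +ℚ ratio j q) *ℚ ½                         ≡⟨ ℚₚ.*-comm (ratio j p +ℚ ratio j q) ½ ⟩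
  mid (ratio j p) (ratio j q)                            ∎
  where
  open ≡-Reasoning
  a = inv (total p)
  b = inv (total q)
  two : total (a ⊙ p ⊕ b ⊙ q) ≡ 1ℚ +ℚ 1ℚ
  two = trans (Linear.app-lin₂ (totalL n) a p b q)
    (cong₂ _+ℚ_ (trans (ℚₚ.*-comm a (total p)) (*-inv-pos hp)) (trans (ℚₚ.*-comm b (total q)) (*-inv-pos hq)))
  inverse : inv (total (a ⊙ p ⊕ b ⊙ q)) ≡ ½
  inverse = cong inv two

-- The samples strictly below the largest ratio are even in number, those up to the smallest ratio
-- are odd in number; by `nonempty-join` a nonempty cell thus has an odd number of nonempty slices.
slices-parity : (j : Fin n) {cs : List ℚ} → AllPairs _<ℚ_ cs → (P : List (Point n)) → All (λ p → 0ℚ <ℚ total p) P →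
  (∀ {p} → p ∈ˡ P → ratio j p ∈ˡ cs) → parity (λ s → nonempty (Slice.slice (level j s) P)) (samples cs) ≡ nonempty P
slices-parity j {cs} sorted [] _ _ = parity-false (samples cs) (λ _ → refl)
slices-parity j {cs} sorted (p ∷ ps) h ∈cs = go (minimum (ratio j) p ps) (maximum (ratio j) p ps)
  where
  open ≡-Reasoning
  go : ∃[ a ] (a ∈ˡ p ∷ ps × (∀ {z} → z ∈ˡ p ∷ ps → ratio j a ≤ℚ ratio j z)) →
       ∃[ b ] (b ∈ˡ p ∷ ps × (∀ {z} → z ∈ˡ p ∷ ps → ratio j z ≤ℚ ratio j b)) →
       parity (λ s → nonempty (Slice.slice (level j s) (p ∷ ps))) (samples cs) ≡ true
  go (a , a∈ , a≤) (b , b∈ , ≤b) = begin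
    parity (λ s → nonempty (Slice.slice (level j s) (p ∷ ps))) (samples cs)
      ≡⟨ parity-cong (samples cs) (λ {s} _ → nonempty-join j s (proj₂ (proj₂ (proj₂ (Slice.split (level j s) (p ∷ ps))))) (λ ()) h a∈ b∈ a≤ ≤b) ⟩
    parity (λ s → lt (ratio j b) s xor le (ratio j a) s) (samples cs)
      ≡⟨ parity-xor (lt (ratio j b)) (le (ratio j a)) (samples cs) ⟩
    parity (lt (ratio j b)) (samples cs) xor parity (le (ratio j a)) (samples cs)
      ≡⟨ cong₂ _xor_ (samples-lt sorted (∈cs b∈)) (samples-le sorted (∈cs a∈)) ⟩
    true ∎

cone-closed : {Q : Point n → Set} → PositivelyClosed Q → (∀ {x y} → x ≐ y → Q x → Q y) →
              ∀ {P x} → Cone P x → P ≢ [] → All Q P → Q x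
cone-closed cl resp (nil _) ne _ = contradiction refl ne
-- `PositivelyClosed` speaks of two summands only, so a · p is split as ½ a · p + ½ a · p.
cone-closed cl resp (cons {p = p} {y = y} a a>0 (nil y≡0) eq) _ (q ∷ []) =
  resp (λ i → sym (trans (eq i) (trans (cong (a *ℚ p i +ℚ_) (y≡0 i)) (solve 2 (λ a p → a :* p :+ con 0ℚ := con ½ :* a :* p :+ con ½ :* a :* p) refl a (p i)))))
    (cl (*-pos (ℚₚ.positive⁻¹ ½) a>0) (*-pos (ℚₚ.positive⁻¹ ½) a>0) q q)
cone-closed cl resp (cons {p = p} {y = y} a a>0 c@(cons _ _ _ _) eq) _ (q ∷ qs) =
  resp (λ i → sym (trans (eq i) (cong (a *ℚ p i +ℚ_) (sym (ℚₚ.*-identityˡ (y i))))))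
    (cl a>0 (ℚₚ.positive⁻¹ 1ℚ) q (cone-closed cl resp c (λ ()) qs))

-- Q is a convex cone without the origin, partitioned by the open cells. `js` lists the coordinates
-- still to be swept: by `rigid` they determine a point of Q up to scale, where cross-multiplied
-- totals replace division. For `js` = [] all of Q is a single ray.
record CellDecomposition {A : Set} (js : List (Fin n)) (xs : List A) (cell : A → List (Point n)) (Q : Point n → Set) : Set where
  field
    unique   : Unique xs
    closed   : PositivelyClosed Q
    resp     : ∀ {x y} → x ≐ y → Q x → Q y
    total>0  : ∀ {p} → Q p → 0ℚ <ℚ total p
    gens     : ∀ {x} → x ∈ˡ xs → All Q (cell x)
    rigid    : ∀ {p q} → Q p → Q q → (∀ j → j ∈ˡ js → p j *ℚ total q ≡ q j *ℚ total p) → ∀ j → p j *ℚ total q ≡ q j *ℚ total p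
    cover    : ∀ {p} → Q p → ∃[ x ] (x ∈ˡ xs × Cone (cell x) p)
    disjoint : ∀ {p x y} → Q p → x ∈ˡ xs → y ∈ˡ xs → Cone (cell x) p → Cone (cell y) p → x ≡ y
    point    : ∃[ p ] Q p

  cone-nonempty : ∀ {P p} → Q p → Cone P p → P ≢ []
  cone-nonempty Qp (nil p≡0) refl = pos⇒≢0 (total>0 Qp) (Linear.app-zero (totalL n) p≡0)

module _ {xs : List A} {cell : A → List (Point n)} {Q : Point n → Set} where

  -- By `rigid` all points of Q are proportional, so any two nonempty cells share a point and
  -- coincide.
  point-odd : CellDecomposition [] xs cell Q → parity (nonempty ∘ cell) xs ≡ true
  point-odd D = go (cover (proj₂ point))
    where
    open CellDecomposition D
    open ≡-Reasoning
    p = proj₁ point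
    Qp = proj₂ point
    rescale : ∀ {q} → Q q → (total p *ℚ inv (total q)) ⊙ q ≐ p
    rescale {q} Qq i = begin
      (total p *ℚ inv (total q)) *ℚ q i   ≡⟨ solve 3 (λ a b c → (a :* b) :* c := (c :* a) :* b) refl (total p) (inv (total q)) (q i) ⟩
      (q i *ℚ total p) *ℚ inv (total q)   ≡⟨ cong (_*ℚ inv (total q)) (rigid Qq Qp (λ _ ()) i) ⟩
      (p i *ℚ total q) *ℚ inv (total q)   ≡⟨ ℚₚ.*-assoc (p i) (total q) (inv (total q)) ⟩
      p i *ℚ (total q *ℚ inv (total q))   ≡⟨ cong (p i *ℚ_) (*-inv-pos (total>0 Qq)) ⟩
      p i *ℚ 1ℚ                           ≡⟨ ℚₚ.*-identityʳ (p i) ⟩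
      p i                                 ∎
    go : ∃[ x ] (x ∈ˡ xs × Cone (cell x) p) → parity (nonempty ∘ cell) xs ≡ true
    go (x , x∈ , cx) = parity-unique unique x∈ (nonempty-true⁺ (cone-nonempty Qp cx)) only
      where
      only : ∀ {y} → y ∈ˡ xs → nonempty (cell y) ≡ true → y ≡ x
      only {y} y∈ ney = disjoint Qp y∈ x∈ (cone-resp (rescale Qq) (cone-scale (*-pos (total>0 Qp) (inv-pos (total>0 Qq))) cq)) cx
        where
        q = proj₁ (cone-inhabited (cell y))
        cq = proj₂ (cone-inhabited (cell y))
        Qq : Q q
        Qq = cone-closed closed resp cq (nonempty-true⁻ (cell y) ney) (gens y∈)

  -- On the slice, coordinate j is s times the total, so it agrees automatically and leaves the list
  -- compared by `rigid`. The given point at height s keeps the slice of Q nonempty.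
  slice-decomposition : ∀ {j js} → CellDecomposition (j ∷ js) xs cell Q → ∀ s → ∃[ p ] (Q p × ratio j p ≡ s) →
    CellDecomposition js xs (λ x → Slice.slice (level j s) (cell x)) (λ p → Q p × Linear.app (level j s) p ≡ 0ℚ)
  slice-decomposition {j} D s (p₀ , Qp₀ , rp₀) = record
    { unique   = unique
    ; closed   = λ { {p} {q} {a} {b} a>0 b>0 (Qp , p≡0) (Qq , q≡0) → closed a>0 b>0 Qp Qq ,
         trans (app-lin₂ a p b q) (trans (cong₂ (λ u v → a *ℚ u +ℚ b *ℚ v) p≡0 q≡0) (solve 2 (λ a b → a :* con 0ℚ :+ b :* con 0ℚ := con 0ℚ) refl a b)) }
    ; resp     = λ { x≐y (Qx , x≡0) → resp x≐y Qx , trans (sym (app-resp x≐y)) x≡0 }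
    ; total>0  = λ (Qp , _) → total>0 Qp
    ; gens     = λ x∈ → Slice.slice-All (level j s) closed (gens x∈)
    ; rigid    = λ { {p} {q} (Qp , p≡0) (Qq , q≡0) r → rigid Qp Qq (λ { i (here refl) → fixed p q p≡0 q≡0 ; i (there i∈) → r i i∈ }) }
    ; cover    = λ { {p} (Qp , p≡0) → let (x , x∈ , cx) = cover Qp in x , x∈ , Slice.slice⁺ (level j s) {P = cell x} {x = p} cx p≡0 }
    ; disjoint = λ { {p} {x} {y} (Qp , _) x∈ y∈ cx cy → disjoint Qp x∈ y∈
                   (Slice.slice⁻ (level j s) {P = cell x} {x = p} cx (cone-nonempty Qp cx))
                   (Slice.slice⁻ (level j s) {P = cell y} {x = p} cy (cone-nonempty Qp cy)) }
    ; point    = p₀ , Qp₀ , level-zero⁺ j s p₀ (total>0 Qp₀) rp₀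
    }
    where
    open CellDecomposition D
    open Linear (level j s)
    solved : ∀ p → app p ≡ 0ℚ → p j ≡ s *ℚ total p
    solved p p≡0 = trans (solve 3 (λ a s h → a := (a :+ :- s :* h) :+ s :* h) refl (p j) s (total p))
      (trans (cong (_+ℚ s *ℚ total p) p≡0) (ℚₚ.+-identityˡ _))
    fixed : ∀ p q → app p ≡ 0ℚ → app q ≡ 0ℚ → p j *ℚ total q ≡ q j *ℚ total p
    fixed p q p≡0 q≡0 = trans (cong (_*ℚ total q) (solved p p≡0))
      (trans (solve 3 (λ s a b → (s :* a) :* b := (s :* b) :* a) refl s (total p) (total q)) (cong (_*ℚ total p) (sym (solved q q≡0))))

  module Heights {j js} (D : CellDecomposition (j ∷ js) xs cell Q) where
    open CellDecomposition D

    heights : List ℚ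
    heights = concatMap (λ x → map (ratio j) (cell x)) xs

    ∈-heights : ∀ {x p} → x ∈ˡ xs → p ∈ˡ cell x → ratio j p ∈ˡ sort heights
    ∈-heights {x} x∈ p∈ = ∈-sort heights (∈-concat⁺′ (∈-map⁺ (ratio j) p∈) (∈-map⁺ (λ x → map (ratio j) (cell x)) x∈))

    Witness : ℚ → Set
    Witness s = ∃[ p ] (Q p × ratio j p ≡ s)

    heights-witness : ∀ {c} → c ∈ˡ heights → Witness c
    heights-witness c∈ with ∈-concat⁻′ (map (λ x → map (ratio j) (cell x)) xs) c∈
    ... | l , c∈l , l∈ with ∈-map⁻ (λ x → map (ratio j) (cell x)) l∈
    ... | x , x∈ , refl with ∈-map⁻ (ratio j) c∈l
    ... | p , p∈ , c≡ = p , All.lookup (gens x∈) p∈ , sym c≡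

    -- Convexity of Q supplies a point at the midpoint of two attained heights;
    -- `slice-decomposition` asks for one at every sample, not just at the critical heights.
    mid-witness : ∀ {c d} → Witness c → Witness d → Witness (mid c d)
    mid-witness (p , Qp , rp) (q , Qq , rq) = _ , closed (inv-pos (total>0 Qp)) (inv-pos (total>0 Qq)) Qp Qq ,
      trans (ratio-mid j p q (total>0 Qp) (total>0 Qq)) (cong₂ mid rp rq)

    witnesses : All Witness (samples (sort heights))
    witnesses = samples-All mid-witness (sort-All (All.tabulate heights-witness))

    height : ∃[ c ] c ∈ˡ sort heights
    height with cover (proj₂ point)
    ... | x , x∈ , cx = go cx (∈-heights x∈)
      where
      go : ∀ {P} → Cone P (proj₁ point) → (∀ {p} → p ∈ˡ P → ratio j p ∈ˡ sort heights) → ∃[ c ] c ∈ˡ sort heights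
      go (nil p≡0) _ = contradiction (Linear.app-zero (totalL n) p≡0) (pos⇒≢0 (total>0 (proj₂ point)))
      go (cons {p = p} _ _ _ _) ∈cs = ratio j p , ∈cs (here refl)

-- Mod 2 Euler characteristic by Hadwiger's sweep: the parity is unchanged when the cells are
-- replaced by their slices at all critical heights and at one height in each gap between them.
cells-odd : (js : List (Fin n)) {xs : List A} {cell : A → List (Point n)} {Q : Point n → Set} →
            CellDecomposition js xs cell Q → parity (nonempty ∘ cell) xs ≡ true
cells-odd [] D = point-odd D
cells-odd (j ∷ js) {xs} {cell} D = begin
  parity (nonempty ∘ cell) xs
    ≡⟨ parity-cong xs (λ {x} x∈ → sym (slices-parity j (sort-sorted heights) (cell x) (All.map total>0 (gens x∈)) (∈-heights x∈))) ⟩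
  parity (λ x → parity (λ s → nonempty (Slice.slice (level j s) (cell x))) (samples (sort heights))) xs
    ≡⟨ parity-swap (λ x s → nonempty (Slice.slice (level j s) (cell x))) xs (samples (sort heights)) ⟩
  parity (λ s → parity (λ x → nonempty (Slice.slice (level j s) (cell x))) xs) (samples (sort heights))
    ≡⟨ parity-cong (samples (sort heights)) (λ {s} s∈ → cells-odd js (slice-decomposition D s (All.lookup witnesses s∈))) ⟩
  parity (λ _ → true) (samples (sort heights))
    ≡⟨ samples-odd′ height ⟩
  true ∎
  where
  open ≡-Reasoning
  open CellDecomposition D
  open Heights D

-- Subdivisions and collapsibility

combination : (Fin n → ℚ) → (Fin n → Point n′) → Point n′
combination μ f i = sumFin (λ v → μ v *ℚ f v i)

cone-combination⁺ : (f : Fin n → Point n′) (τ : Subset n) (μ : Fin n → ℚ) → (∀ {v} → v ∈ τ → 0ℚ <ℚ μ v) → (∀ {v} → v ∉ τ → μ v ≡ 0ℚ) →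
                    Cone (map f (elements τ)) (combination μ f)
cone-combination⁺ f [] μ _ _ = nil (λ _ → refl)
cone-combination⁺ f (true ∷ τ) μ pos zer = cons (μ Fin.zero) (pos Vec.here)
  (subst (λ P → Cone P (combination (μ ∘ Fin.suc) (f ∘ Fin.suc))) (Listₚ.map-∘ (elements τ))
    (cone-combination⁺ (f ∘ Fin.suc) τ (μ ∘ Fin.suc) (pos ∘ Vec.there) (λ v∉ → zer λ { (Vec.there v∈) → v∉ v∈ })))
  (λ _ → refl)
cone-combination⁺ f (false ∷ τ) μ pos zer =
  cone-resp (λ i → sym (trans (cong (_+ℚ combination (μ ∘ Fin.suc) (f ∘ Fin.suc) i) (trans (cong (_*ℚ f Fin.zero i) (zer λ ())) (ℚₚ.*-zeroˡ (f Fin.zero i)))) (ℚₚ.+-identityˡ _)))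
  (subst (λ P → Cone P (combination (μ ∘ Fin.suc) (f ∘ Fin.suc))) (Listₚ.map-∘ (elements τ))
    (cone-combination⁺ (f ∘ Fin.suc) τ (μ ∘ Fin.suc) (pos ∘ Vec.there) (λ v∉ → zer λ { (Vec.there v∈) → v∉ v∈ })))

cone-combination⁻ : (f : Fin n → Point n′) (τ : Subset n) {p : Point n′} → Cone (map f (elements τ)) p →
                    ∃[ μ ] ((∀ {v} → v ∈ τ → 0ℚ <ℚ μ v) × (∀ {v} → v ∉ τ → μ v ≡ 0ℚ) × p ≐ combination μ f)
cone-combination⁻ f [] (nil p≡0) = (λ ()) , (λ ()) , (λ { {()} }) , p≡0
cone-combination⁻ f (true ∷ τ) (cons a a>0 c eq) with cone-combination⁻ (f ∘ Fin.suc) τ (subst (λ P → Cone P _) (sym (Listₚ.map-∘ (elements τ))) c)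
... | μ , pos , zer , eq′ = (λ { Fin.zero → a ; (Fin.suc v) → μ v }) ,
  (λ { Vec.here → a>0 ; (Vec.there v∈) → pos v∈ }) ,
  (λ { {Fin.zero} z∉ → contradiction Vec.here z∉ ; {Fin.suc v} v∉ → zer (v∉ ∘ Vec.there) }) ,
  (λ i → trans (eq i) (cong (a *ℚ f Fin.zero i +ℚ_) (eq′ i)))
cone-combination⁻ f (false ∷ τ) c with cone-combination⁻ (f ∘ Fin.suc) τ (subst (λ P → Cone P _) (sym (Listₚ.map-∘ (elements τ))) c)
... | μ , pos , zer , eq′ = (λ { Fin.zero → 0ℚ ; (Fin.suc v) → μ v }) ,
  (λ { (Vec.there v∈) → pos v∈ }) ,
  (λ { {Fin.zero} _ → refl ; {Fin.suc v} v∉ → zer (v∉ ∘ Vec.there) }) ,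
  (λ i → trans (eq′ i) (sym (trans (cong (_+ℚ combination μ (f ∘ Fin.suc) i) (ℚₚ.*-zeroˡ (f Fin.zero i))) (ℚₚ.+-identityˡ _))))

parity-members : (P : Subset n → Bool) → parity P (allSubsets n) ≡ parity (λ _ → true) (members P)
parity-members {n} P = go (allSubsets n)
  where
  go : ∀ xs → parity P xs ≡ parity (λ _ → true) (filterᵇ P xs)
  go [] = refl
  go (x ∷ xs) with P x
  ... | true  = cong not (go xs)
  ... | false = go xs

parity-single : (σ : Subset n) → parity (_==ₛ σ) (allSubsets n) ≡ true
parity-single {n} σ = parity-unique (allSubsets-unique n) (∈-allSubsets σ) (==ₛ⁺ refl) (λ _ → ==ₛ⁻)

module Subdivision {J : Complex n} {f : Fin n → Point n′} {K : Complex n′} (sub : IsSubdivision J f K) where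

  J-complex : IsComplex J
  J-complex = proj₁ sub

  J-independent : ∀ σ → J σ ≡ true → AffinelyIndependent f σ
  J-independent = proj₁ (proj₂ sub)

  J-carrier : ∀ σ → J σ ≡ true → ∃[ ρ ] (K ρ ≡ true × (∀ v → v ∈ σ → InSimplex ρ (f v)))
  J-carrier = proj₁ (proj₂ (proj₂ sub))

  J-meet : ∀ σ ρ p → J σ ≡ true → J ρ ≡ true → InHull f σ p → InHull f ρ p → InHull f (σ ∩ ρ) p
  J-meet = proj₁ (proj₂ (proj₂ (proj₂ sub)))

  J-cover : ∀ p → InRealization K p → ∃[ σ ] (J σ ≡ true × InHull f σ p)
  J-cover = proj₂ (proj₂ (proj₂ (proj₂ sub)))

  vertex-nonneg : ∀ {σ} → J σ ≡ true → ∀ {v} → v ∈ σ → ∀ i → 0ℚ ≤ℚ f v i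
  vertex-nonneg Jσ v∈ = proj₁ (proj₂ (proj₂ (J-carrier _ Jσ)) _ v∈)

  vertex-total : ∀ {σ} → J σ ≡ true → ∀ {v} → v ∈ σ → total (f v) ≡ 1ℚ
  vertex-total Jσ v∈ = proj₂ (proj₂ (proj₂ (proj₂ (J-carrier _ Jσ)) _ v∈))

  combination-total : ∀ {σ} → J σ ≡ true → (μ : Fin n → ℚ) → (∀ {v} → v ∉ σ → μ v ≡ 0ℚ) → total (combination μ f) ≡ sumFin μ
  combination-total {σ} Jσ μ zer = trans (sumFin-swap (λ i v → μ v *ℚ f v i)) (sumFin-cong λ v → trans (sumFin-*ˡ (μ v) (f v)) (one v (v ∈? σ)))
    where
    one : ∀ v → Dec (v ∈ σ) → μ v *ℚ total (f v) ≡ μ v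
    one v (yes v∈) = trans (cong (μ v *ℚ_) (vertex-total Jσ v∈)) (ℚₚ.*-identityʳ (μ v))
    one v (no v∉)  = trans (cong (_*ℚ total (f v)) (zer v∉)) (trans (ℚₚ.*-zeroˡ (total (f v))) (sym (zer v∉)))

  -- The face spanned by G is convex, so containment of a cell can be tested on its vertices and is
  -- decidable.
  Within : Subset n′ → Subset n → Set
  Within G σ = ∀ v → v ∈ σ → ∀ i → i ∉ G → f v i ≡ 0ℚ

  within? : ∀ G σ → Dec (Within G σ)
  within? G σ = Finₚ.all? λ v → (v ∈? σ) →-dec Finₚ.all? λ i → ¬? (i ∈? G) →-dec (f v i ℚₚ.≟ 0ℚ)

  abstract
    within : Subset n′ → Subset n → Bool
    within G σ = ⌊ within? G σ ⌋

    within⁺ : ∀ {G σ} → Within G σ → within G σ ≡ true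
    within⁺ {G} {σ} = ⌊⌋⁺ (within? G σ)

    within⁻ : ∀ {G σ} → within G σ ≡ true → Within G σ
    within⁻ {G} {σ} = ⌊⌋⁻ (within? G σ)

  -- The open cells of J inside a nonempty simplex G of K partition G, which is convex.
  module _ {G : Subset n′} (KG : K G ≡ true) {g : Fin n′} (g∈G : g ∈ G) where

    InG : Point n′ → Set
    InG p = (∀ i → 0ℚ ≤ℚ p i) × (∀ i → i ∉ G → p i ≡ 0ℚ) × 0ℚ <ℚ total p

    cellᵇ : Subset n → Bool
    cellᵇ σ = J σ ∧ within G σ ∧ not (σ ==ₛ ⊥)

    cellᵇ⁻ : ∀ {σ} → σ ∈ˡ members cellᵇ → J σ ≡ true × Within G σ × σ ≢ ⊥
    cellᵇ⁻ {σ} σ∈ with ∧⁻ {J σ} (∈-members⁻ cellᵇ σ∈)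
    ... | Jσ , e with ∧⁻ {within G σ} e
    ... | w , ne = Jσ , within⁻ w , not⁻ ne ∘ ==ₛ⁺

    cellᵇ⁺ : ∀ {σ} → J σ ≡ true → Within G σ → σ ≢ ⊥ → σ ∈ˡ members cellᵇ
    cellᵇ⁺ Jσ w ne = ∈-members⁺ cellᵇ (∧⁺ Jσ (∧⁺ (within⁺ w) (not⁺ (ne ∘ ==ₛ⁻))))

    cell : Subset n → List (Point n′)
    cell σ = map f (elements σ)

    normalised : ∀ {p} → InG p → InSimplex G (inv (total p) ⊙ p)
    normalised {p} (p≥0 , p≡0 , t>0) =
      (λ i → *-nonneg (ℚₚ.<⇒≤ (inv-pos t>0)) (p≥0 i)) ,
      (λ i i∉ → trans (cong (inv (total p) *ℚ_) (p≡0 i i∉)) (ℚₚ.*-zeroʳ (inv (total p)))) ,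
      trans (sumFin-*ˡ (inv (total p)) p) (trans (ℚₚ.*-comm (inv (total p)) (total p)) (*-inv-pos t>0))

    unnormalised : ∀ {p : Point n′} → 0ℚ <ℚ total p → total p ⊙ inv (total p) ⊙ p ≐ p
    unnormalised {p} t>0 i = trans (sym (ℚₚ.*-assoc (total p) (inv (total p)) (p i)))
      (trans (cong (_*ℚ p i) (*-inv-pos t>0)) (ℚₚ.*-identityˡ (p i)))

    cone⇒hull : ∀ {σ p} → J σ ≡ true → Cone (cell σ) p → total p ≡ 1ℚ →
                ∃[ μ ] ((∀ {v} → v ∈ σ → 0ℚ <ℚ μ v) × InSimplex σ μ × (∀ i → p i ≡ combination μ f i))
    cone⇒hull {σ} {p} Jσ c t≡1 with cone-combination⁻ f σ c
    ... | μ , pos , zer , eq = μ , pos , ((λ v → nonneg v (v ∈? σ)) , (λ v → zer) , trans (sym (combination-total Jσ μ zer)) (trans (sym (sumFin-cong eq)) t≡1)) , eq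
      where
      nonneg : ∀ v → Dec (v ∈ σ) → 0ℚ ≤ℚ μ v
      nonneg v (yes v∈) = ℚₚ.<⇒≤ (pos v∈)
      nonneg v (no v∉)  = ℚₚ.≤-reflexive (sym (zer v∉))

    cells-cover : ∀ {p} → InG p → ∃[ σ ] (σ ∈ˡ members cellᵇ × Cone (cell σ) p)
    cells-cover {p} Gp@(p≥0 , p≡0 , t>0) with J-cover (inv (total p) ⊙ p) (G , KG , normalised Gp)
    ... | σ , Jσ , μ , (μ≥0 , μ≡0 , Σμ) , eq = τ , cellᵇ⁺ (J-complex σ τ Jσ τ⊆σ) inside τ≢⊥ ,
        cone-resp (unnormalised t>0) (cone-scale t>0 (cone-resp (sym ∘ eq) (cone-combination⁺ f τ μ pos zer)))
      where
      τ : Subset n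
      -- The open cell through the point is spanned by the support of its barycentric coordinates.
      τ = tabulate (λ v → ⌊ 0ℚ ℚₚ.<? μ v ⌋)
      pos : ∀ {v} → v ∈ τ → 0ℚ <ℚ μ v
      pos {v} v∈ = ⌊⌋⁻ (0ℚ ℚₚ.<? μ v) (trans (sym (Vecₚ.lookup∘tabulate _ v)) (Vecₚ.[]=⇒lookup v∈))
      ∈τ : ∀ {v} → 0ℚ <ℚ μ v → v ∈ τ
      ∈τ {v} l = Vecₚ.lookup⇒[]= v τ (trans (Vecₚ.lookup∘tabulate _ v) (⌊⌋⁺ (0ℚ ℚₚ.<? μ v) l))
      zer : ∀ {v} → v ∉ τ → μ v ≡ 0ℚ
      zer {v} v∉ = ℚₚ.≤-antisym (ℚₚ.≮⇒≥ (v∉ ∘ ∈τ)) (μ≥0 v)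
      τ⊆σ : τ ⊆ σ
      τ⊆σ {v} v∈ = decidable-stable (v ∈? σ) (λ v∉ → pos⇒≢0 (pos v∈) (μ≡0 v v∉))
      inside : Within G τ
      -- Coordinate i of the point vanishes and is a sum of nonnegative terms μ u · f u i, so each
      -- term vanishes, in particular the one with μ v > 0.
      inside v v∈ i i∉ = *-zero⁻ (μ v) (f v i) (sumFin≡0⇒≡0 (λ u → term u (u ∈? σ)) (trans (sym (eq i)) (trans (cong (inv (total p) *ℚ_) (p≡0 i i∉)) (ℚₚ.*-zeroʳ (inv (total p))))) v) (pos⇒≢0 (pos v∈))
        where
        term : ∀ u → Dec (u ∈ σ) → 0ℚ ≤ℚ μ u *ℚ f u i
        term u (yes u∈) = *-nonneg (μ≥0 u) (vertex-nonneg Jσ u∈ i)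
        term u (no u∉)  = ℚₚ.≤-reflexive (sym (trans (cong (_*ℚ f u i) (μ≡0 u u∉)) (ℚₚ.*-zeroˡ (f u i))))
      τ≢⊥ : τ ≢ ⊥
      τ≢⊥ τ≡⊥ = ℚₚ.1≢0 (trans (sym Σμ) (sumFin-0 (λ v → zer (λ v∈ → ∉⊥ (subst (v ∈_) τ≡⊥ v∈)))))

    -- The point p has barycentric coordinates μ on σ and, by the intersection axiom, κ on σ ∩ ρ.
    -- Affine independence of σ gives μ = κ, and μ is positive on all of σ.
    cells-⊆ : ∀ {σ ρ p} → J σ ≡ true → J ρ ≡ true → total p ≡ 1ℚ → Cone (cell σ) p → Cone (cell ρ) p → σ ⊆ ρ
    cells-⊆ {σ} {ρ} {p} Jσ Jρ t≡1 cσ cρ {v} v∈ with cone⇒hull Jσ cσ t≡1 | cone⇒hull Jρ cρ t≡1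
    ... | μ , μ>0 , μs@(_ , μ≡0 , Σμ) , eqμ | ν , _ , νs , eqν with J-meet σ ρ p Jσ Jρ (μ , μs , eqμ) (ν , νs , eqν)
    ... | κ , (_ , κ≡0 , Σκ) , eqκ = decidable-stable (v ∈? ρ) (λ v∉ → pos⇒≢0 (μ>0 v∈)
          (trans (sym (trans (cong (μ v +ℚ_) (trans (cong ((-ℚ 1ℚ) *ℚ_) (κ≡0 v (v∉ ∘ proj₂ ∘ x∈p∩q⁻ σ ρ))) (ℚₚ.*-zeroʳ (-ℚ 1ℚ)))) (ℚₚ.+-identityʳ _))) (vanish v)))
      where
      cancel : ∀ {a b c} → a ≡ c → b ≡ c → a +ℚ (-ℚ 1ℚ) *ℚ b ≡ 0ℚ
      cancel {c = c} refl refl = solve 1 (λ c → c :+ :- con 1ℚ :* c := con 0ℚ) refl c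
      vanish : ∀ v → μ v +ℚ (-ℚ 1ℚ) *ℚ κ v ≡ 0ℚ
      vanish = J-independent σ Jσ (λ v → μ v +ℚ (-ℚ 1ℚ) *ℚ κ v)
        (λ v v∉ → cancel {c = 0ℚ} (μ≡0 v v∉) (κ≡0 v (v∉ ∘ proj₁ ∘ x∈p∩q⁻ σ ρ)))
        (trans (sumFin-+ μ (λ v → (-ℚ 1ℚ) *ℚ κ v)) (trans (cong (sumFin μ +ℚ_) (sumFin-*ˡ (-ℚ 1ℚ) κ)) (cancel Σμ Σκ)))
        (λ i → trans (sumFin-cong λ v → solve 3 (λ a b c → (a :+ :- con 1ℚ :* b) :* c := a :* c :+ :- con 1ℚ :* (b :* c)) refl (μ v) (κ v) (f v i))
          (trans (sumFin-+ (λ v → μ v *ℚ f v i) (λ v → (-ℚ 1ℚ) *ℚ (κ v *ℚ f v i)))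
            (trans (cong (combination μ f i +ℚ_) (sumFin-*ˡ (-ℚ 1ℚ) (λ v → κ v *ℚ f v i))) (cancel (sym (eqμ i)) (sym (eqκ i))))))

    simplex-decomposition : CellDecomposition (allFin n′) (members cellᵇ) cell InG
    simplex-decomposition = record
      { unique   = members-unique cellᵇ
      ; closed   = λ { {p} {q} {a} {b} a>0 b>0 (p≥0 , p≡0 , tp) (q≥0 , q≡0 , tq) →
            (λ i → +-nonneg (*-nonneg (ℚₚ.<⇒≤ a>0) (p≥0 i)) (*-nonneg (ℚₚ.<⇒≤ b>0) (q≥0 i)))
          , (λ i i∉ → trans (cong₂ (λ u v → a *ℚ u +ℚ b *ℚ v) (p≡0 i i∉) (q≡0 i i∉)) (solve 2 (λ a b → a :* con 0ℚ :+ b :* con 0ℚ := con 0ℚ) refl a b))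
          , subst (0ℚ <ℚ_) (sym (Linear.app-lin₂ (totalL n′) a p b q)) (+-pos-nonneg (*-pos a>0 tp) (ℚₚ.<⇒≤ (*-pos b>0 tq))) }
      ; resp     = λ { x≐y (x≥0 , x≡0 , tx) → (λ i → subst (0ℚ ≤ℚ_) (x≐y i) (x≥0 i)) , (λ i i∉ → trans (sym (x≐y i)) (x≡0 i i∉)) , subst (0ℚ <ℚ_) (sumFin-cong x≐y) tx }
      ; total>0  = λ (_ , _ , t>0) → t>0
      ; gens     = λ {σ} σ∈ → let (Jσ , w , _) = cellᵇ⁻ σ∈ in Allₚ.map⁺ (All.tabulate λ {v} v∈ → let v∈σ = ∈-elements⁻ σ v∈ in
                     vertex-nonneg Jσ v∈σ , w v v∈σ , subst (0ℚ <ℚ_) (sym (vertex-total Jσ v∈σ)) (ℚₚ.positive⁻¹ 1ℚ))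
      ; rigid    = λ _ _ r j → r j (∈-allFin j)
      ; cover    = cells-cover
      ; disjoint = λ {p} {σ} {ρ} Gp@(_ , _ , t>0) σ∈ ρ∈ cσ cρ →
          let Jσ = proj₁ (cellᵇ⁻ σ∈)
              Jρ = proj₁ (cellᵇ⁻ ρ∈)
              t≡1 = proj₂ (proj₂ (normalised Gp))
              cσ′ = cone-scale (inv-pos t>0) cσ
              cρ′ = cone-scale (inv-pos t>0) cρ
          in ⊆-antisym (cells-⊆ Jσ Jρ t≡1 cσ′ cρ′) (cells-⊆ Jρ Jσ t≡1 cρ′ cσ′)
      ; point    = δ g , δ-nonneg g , (λ i i∉ → δ-diff {i = g} {i} λ { refl → i∉ g∈G }) , subst (0ℚ <ℚ_) (sym (sumFin-δ g)) (ℚₚ.positive⁻¹ 1ℚ)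
      }

    J-⊥ : J ⊥ ≡ true
    J-⊥ = let (σ , σ∈ , _) = cells-cover (proj₂ (CellDecomposition.point simplex-decomposition))
          in J-complex σ ⊥ (proj₁ (cellᵇ⁻ σ∈)) ⊥⊆

    nonempty-cells-odd : parity cellᵇ (allSubsets n) ≡ true
    nonempty-cells-odd = trans (parity-members cellᵇ) (trans (parity-cong (members cellᵇ) (λ σ∈ → sym (ne (proj₂ (proj₂ (cellᵇ⁻ σ∈))))))
        (cells-odd (allFin n′) simplex-decomposition))
      where
      ne : ∀ {σ} → σ ≢ ⊥ → nonempty (cell σ) ≡ true
      ne {σ} σ≢⊥ with nonempty? σ
      ... | yes (x , x∈) = nonempty-∈ (∈-map⁺ f (∈-elements⁺ x∈))
      ... | no empty     = contradiction (Empty-unique empty) σ≢⊥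

    -- Counting the empty simplex as well turns the odd number of nonempty cells into an even one:
    -- the reduced Euler characteristic of a simplex is 0.
    simplex-even : parity (λ σ → J σ ∧ within G σ) (allSubsets n) ≡ false
    simplex-even = trans (parity-cong (allSubsets n) (λ {σ} _ → pointwise σ))
        (trans (parity-xor cellᵇ (_==ₛ ⊥) (allSubsets n)) (cong₂ _xor_ nonempty-cells-odd (parity-single {n} ⊥)))
      where
      boolean : ∀ a b c → (c ≡ true → a ∧ b ≡ true) → a ∧ b ≡ (a ∧ b ∧ not c) xor c
      boolean false b false _ = refl
      boolean true false false _ = refl
      boolean true true false _ = refl
      boolean a b true h with h refl
      boolean true true true _ | _ = refl
      pointwise : ∀ σ → J σ ∧ within G σ ≡ cellᵇ σ xor (σ ==ₛ ⊥)
      pointwise σ = boolean (J σ) (within G σ) (σ ==ₛ ⊥) (λ e → subst (λ σ → J σ ∧ within G σ ≡ true) (sym (==ₛ⁻ e)) (∧⁺ J-⊥ (within⁺ λ v v∈ → contradiction v∈ ∉⊥)))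

collapse-parity : {K K′ : Complex n} → ElemCollapse K K′ → parity K (allSubsets n) ≡ parity K′ (allSubsets n)
collapse-parity {n} {K} {K′} (σ , τ , Kσ , Kτ , σ⊂τ , _ , eq) = begin
  parity K (allSubsets n)
    ≡⟨ parity-cong (allSubsets n) (λ {ρ} _ → trans (boolean (K ρ) (ρ ==ₛ σ) (ρ ==ₛ τ)
         (λ e → subst (λ ρ → K ρ ≡ true) (sym (==ₛ⁻ e)) Kσ) (λ e → subst (λ ρ → K ρ ≡ true) (sym (==ₛ⁻ e)) Kτ)
         (λ e e′ → proj₂ (⊂ᵇ⁻ σ⊂τ) (trans (sym (==ₛ⁻ e)) (==ₛ⁻ e′))))
         (cong (_xor ((ρ ==ₛ σ) xor (ρ ==ₛ τ))) (sym (eq ρ)))) ⟩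
  parity (λ ρ → K′ ρ xor ((ρ ==ₛ σ) xor (ρ ==ₛ τ))) (allSubsets n)
    ≡⟨ parity-xor K′ _ (allSubsets n) ⟩
  parity K′ (allSubsets n) xor parity (λ ρ → (ρ ==ₛ σ) xor (ρ ==ₛ τ)) (allSubsets n)
    ≡⟨ cong (parity K′ (allSubsets n) xor_) (trans (parity-xor (_==ₛ σ) (_==ₛ τ) (allSubsets n)) (cong₂ _xor_ (parity-single σ) (parity-single τ))) ⟩
  parity K′ (allSubsets n) xor false
    ≡⟨ xor-comm _ false ⟩
  parity K′ (allSubsets n) ∎
  where
  open ≡-Reasoning
  boolean : ∀ a b c → (b ≡ true → a ≡ true) → (c ≡ true → a ≡ true) → (b ≡ true → c ≢ true) → a ≡ (a ∧ not b ∧ not c) xor (b xor c)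
  boolean false false false _ _ _ = refl
  boolean true false false _ _ _ = refl
  boolean true false true _ _ _ = refl
  boolean true true false _ _ _ = refl
  boolean false true _ f _ _ = contradiction (f refl) (λ ())
  boolean false false true _ g _ = contradiction (g refl) (λ ())
  boolean true true true _ _ h = contradiction refl (h refl)

collapsible-even : {K : Complex n} → CollapsesToVertex K → parity K (allSubsets n) ≡ false
collapsible-even {n} (K′ , steps , v , eq) = go steps
  where
  point : parity K′ (allSubsets n) ≡ false
  point = trans (parity-cong (allSubsets n) (λ {ρ} _ → pointwise ρ)) (trans (parity-xor (_==ₛ ⊥) (_==ₛ ⁅ v ⁆) (allSubsets n)) (cong₂ _xor_ (parity-single {n} ⊥) (parity-single ⁅ v ⁆)))
    where
    pointwise : ∀ ρ → K′ ρ ≡ (ρ ==ₛ ⊥) xor (ρ ==ₛ ⁅ v ⁆)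
    pointwise ρ with ρ ≟ₛ ⊥ | ρ ≟ₛ ⁅ v ⁆
    ... | yes refl | yes e = contradiction (subst (v ∈_) (sym e) (x∈⁅x⁆ v)) ∉⊥
    ... | yes refl | no _ = from⇔ (eq ⊥) ⊥⊆
    ... | no _ | yes refl = from⇔ (eq ⁅ v ⁆) (λ x → x)
    ... | no ρ≢⊥ | no ρ≢v = Boolₚ.¬-not (λ Kρ → other (to⇔ (eq ρ) Kρ))
      where
      other : ¬ (ρ ⊆ ⁅ v ⁆)
      other ρ⊆v with v ∈? ρ
      ... | yes v∈ = ρ≢v (⊆-antisym ρ⊆v (λ {x} x∈ → subst (_∈ ρ) (sym (x∈⁅y⁆⇒x≡y v x∈)) v∈))
      ... | no v∉ = ρ≢⊥ (Empty-unique λ (x , x∈) → v∉ (subst (_∈ ρ) (x∈⁅y⁆⇒x≡y v (ρ⊆v x∈)) x∈))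
  go : ∀ {K} → Star ElemCollapse K K′ → parity K (allSubsets n) ≡ false
  go ε = point
  go (c ◅ cs) = trans (collapse-parity c) (go cs)

-- Every intersection of G with a proper subfamily is nonempty, but the total intersection is empty.
Critical : Subset n → List (Subset n) → Set
Critical G []       = ∀ x → x ∉ G
Critical G (F ∷ Fs) = (∃[ x ] (x ∈ G × (∀ {F′} → F′ ∈ˡ Fs → x ∈ F′))) × Critical (G ∩ F) Fs

-- Inclusion-exclusion modulo 2 on the cells of a collapsing subdivision: only the total
-- intersection could contribute an odd number of cells.
collapsible⇒¬critical : {K : Complex n} → IsComplex K → Collapsible K → (Fs : List (Subset n)) →
  (∀ {F} → F ∈ˡ Fs → K F ≡ true) → (∀ {σ} → K σ ≡ true → ∃[ F ] (F ∈ˡ Fs × σ ⊆ F)) → ¬ Critical ⊤ Fs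
collapsible⇒¬critical {n} {K} complex (n₀ , J , f , sub , collapses) Fs Fs∈K covered crit = true≢false (trans (sym (odd ⊤ Fs Fs∈K even-⊤ crit)) none)
  where
  open Subdivision sub
  open ≡-Reasoning
  true≢false : true ≢ false
  true≢false ()

  outside : Subset n → List (Subset n) → Subset n₀ → Bool
  outside G Fs σ = J σ ∧ within G σ ∧ not (any (λ F → within F σ) Fs)

  Even : Subset n → Set
  Even G = ∀ {x} → x ∈ G → parity (λ σ → J σ ∧ within G σ) (allSubsets n₀) ≡ false

  even-⊤ : Even ⊤
  even-⊤ _ = trans (parity-cong (allSubsets n₀) (λ {σ} _ → trans (cong (J σ ∧_) (within⁺ {⊤} {σ} (λ v v∈ i i∉ → contradiction ∈⊤ i∉))) (∧-identityʳ (J σ))))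
    (collapsible-even collapses)

  even-K : ∀ {G} → K G ≡ true → Even G
  even-K KG x∈ = simplex-even KG x∈

  J⊥ : J ⊥ ≡ true
  J⊥ = nonvoid (J ⊥ Boolₚ.≟ true)
    where
    nonvoid : Dec (J ⊥ ≡ true) → J ⊥ ≡ true
    nonvoid (yes e) = e
    nonvoid (no ¬J⊥) = contradiction (point collapses) ¬J⊥
      where
      point : CollapsesToVertex J → J ⊥ ≡ true
      point (K′ , ε , v , eq) = from⇔ (eq ⊥) ⊥⊆
      point (K′ , (σ , _ , Jσ , _) ◅ _ , _) = J-complex σ ⊥ Jσ ⊥⊆

  -- The cells inside G that lie in no member of `Fs` either lie outside F as well or lie inside G ∩
  -- F; modulo 2 the difference becomes a sum.
  step : ∀ G F Fs → parity (outside G (F ∷ Fs)) (allSubsets n₀) ≡ parity (outside G Fs) (allSubsets n₀) xor parity (outside (G ∩ F) Fs) (allSubsets n₀)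
  step G F Fs = trans (parity-cong (allSubsets n₀) (λ {σ} _ → pointwise σ)) (parity-xor (outside G Fs) (outside (G ∩ F) Fs) (allSubsets n₀))
    where
    boolean : ∀ a g b c → a ∧ g ∧ not (b ∨ c) ≡ (a ∧ g ∧ not c) xor (a ∧ (g ∧ b) ∧ not c)
    boolean false _ _ _ = refl
    boolean true false _ _ = refl
    boolean true true false false = refl
    boolean true true false true = refl
    boolean true true true false = refl
    boolean true true true true = refl
    within-∩ : ∀ σ → within G σ ∧ within F σ ≡ within (G ∩ F) σ
    within-∩ σ = ≡true-ext
      (λ e → let (wG , wF) = ∧⁻ {within G σ} e in within⁺ (λ v v∈ i i∉ → both v v∈ i i∉ (i ∈? G) (within⁻ wG) (within⁻ wF)))
      (λ e → ∧⁺ (within⁺ (λ v v∈ i i∉ → within⁻ e v v∈ i (i∉ ∘ proj₁ ∘ x∈p∩q⁻ G F))) (within⁺ (λ v v∈ i i∉ → within⁻ e v v∈ i (i∉ ∘ proj₂ ∘ x∈p∩q⁻ G F))))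
      where
      both : ∀ v → v ∈ σ → ∀ i → i ∉ G ∩ F → Dec (i ∈ G) → Within G σ → Within F σ → f v i ≡ 0ℚ
      both v v∈ i i∉ (yes i∈G) _ wF = wF v v∈ i (λ i∈F → i∉ (x∈p∩q⁺ (i∈G , i∈F)))
      both v v∈ i i∉ (no i∉G) wG _ = wG v v∈ i i∉G
    pointwise : ∀ σ → outside G (F ∷ Fs) σ ≡ outside G Fs σ xor outside (G ∩ F) Fs σ
    pointwise σ = trans (boolean (J σ) (within G σ) (within F σ) (any (λ F → within F σ) Fs))
      (cong (λ w → outside G Fs σ xor (J σ ∧ w ∧ not (any (λ F → within F σ) Fs))) (within-∩ σ))

  start : ∀ G → parity (outside G []) (allSubsets n₀) ≡ parity (λ σ → J σ ∧ within G σ) (allSubsets n₀)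
  start G = parity-cong (allSubsets n₀) (λ {σ} _ → cong (J σ ∧_) (∧-identityʳ (within G σ)))

  even-∩ : ∀ G {F} → K F ≡ true → Even (G ∩ F)
  even-∩ G {F} KF = even-K (complex F (G ∩ F) KF (p∩q⊆q G F))

  -- With a common element x, every intersection met in the expansion is nonempty and contributes an
  -- even number of cells.
  common : ∀ G Fs → (∀ {F} → F ∈ˡ Fs → K F ≡ true) → Even G → ∀ {x} → x ∈ G → (∀ {F} → F ∈ˡ Fs → x ∈ F) → parity (outside G Fs) (allSubsets n₀) ≡ false
  common G [] _ even x∈G _ = trans (start G) (even x∈G)
  common G (F ∷ Fs) KFs even x∈G x∈Fs = trans (step G F Fs) (cong₂ _xor_ (common G Fs (KFs ∘ there) even x∈G (x∈Fs ∘ there))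
    (common (G ∩ F) Fs (KFs ∘ there) (even-∩ G (KFs (here refl))) (x∈p∩q⁺ (x∈G , x∈Fs (here refl))) (x∈Fs ∘ there)))

  odd : ∀ G Fs → (∀ {F} → F ∈ˡ Fs → K F ≡ true) → Even G → Critical G Fs → parity (outside G Fs) (allSubsets n₀) ≡ true
  -- Vertices of J have total 1, so only the empty simplex lies inside an empty G. This is the one
  -- odd contribution.
  odd G [] _ _ empty = trans (start G) (parity-unique (allSubsets-unique n₀) (∈-allSubsets ⊥) (∧⁺ J⊥ (within⁺ λ v v∈ → contradiction v∈ ∉⊥)) only)
    where
    only : ∀ {σ} → σ ∈ˡ allSubsets n₀ → J σ ∧ within G σ ≡ true → σ ≡ ⊥
    only {σ} _ e = Empty-unique λ (v , v∈) → let (Jσ , w) = ∧⁻ {J σ} e in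
      ℚₚ.1≢0 (trans (sym (vertex-total Jσ v∈)) (sumFin-0 (λ i → within⁻ w v v∈ i (empty i))))
  odd G (F ∷ Fs) KFs even ((x , x∈G , x∈Fs) , crit) = trans (step G F Fs)
    (cong₂ _xor_ (common G Fs (KFs ∘ there) even x∈G x∈Fs) (odd (G ∩ F) Fs (KFs ∘ there) (even-∩ G (KFs (here refl))) crit))

  -- Every cell is carried by a simplex of K and hence lies inside some member of the cover.
  none : parity (outside ⊤ Fs) (allSubsets n₀) ≡ false
  none = parity-false (allSubsets n₀) (λ {σ} _ → Boolₚ.¬-not (λ e → absurd σ e))
    where
    absurd : ∀ σ → outside ⊤ Fs σ ≢ true
    absurd σ e with ∧⁻ {J σ} e
    ... | Jσ , e′ with J-carrier σ Jσ | ∧⁻ {within ⊤ σ} e′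
    ... | ρ , Kρ , inρ | _ , ¬any with covered Kρ
    ... | F , F∈ , ρ⊆F = not⁻ ¬any (any⁺ (λ F → within F σ) F∈ (within⁺ λ v v∈ i i∉ → proj₁ (proj₂ (inρ v v∈)) i (i∉ ∘ ρ⊆F)))

-- Dimension of combinatorial balls

dot : Point n → Point n → ℚ
dot r c = sumFin (λ i → r i *ℚ c i)

dot-linearˡ : ∀ (x : Point n) a y c → dot (x ⊕ a ⊙ y) c ≡ dot x c +ℚ a *ℚ dot y c
dot-linearˡ x a y c = trans (sumFin-cong (λ i → solve 4 (λ x a y c → (x :+ a :* y) :* c := x :* c :+ a :* (y :* c)) refl (x i) a (y i) (c i)))
  (trans (sumFin-+ (λ i → x i *ℚ c i) (λ i → a *ℚ (y i *ℚ c i))) (cong (dot x c +ℚ_) (sumFin-*ˡ a (λ i → y i *ℚ c i))))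

dot-comm : (x y : Point n) → dot x y ≡ dot y x
dot-comm x y = sumFin-cong (λ i → ℚₚ.*-comm (x i) (y i))

dot-δ : (v : Fin n) (c : Point n) → dot (δ v) c ≡ c v
dot-δ v c = trans (sumFin-single v (λ i → δ v i *ℚ c i) (λ i i≢v → trans (cong (_*ℚ c i) (δ-diff {i = v} {i} (i≢v ∘ sym))) (ℚₚ.*-zeroˡ (c i))))
  (trans (cong (_*ℚ c v) (δ-same v)) (ℚₚ.*-identityˡ (c v)))

pivot : (rows : List (Point (suc n))) →
  All (λ r → r Fin.zero ≡ 0ℚ) rows ⊎ ∃[ as ] ∃[ r ] ∃[ bs ] (rows ≡ as ++ r ∷ bs × r Fin.zero ≢ 0ℚ)
pivot [] = inj₁ []
pivot (r ∷ rows) with r Fin.zero ℚₚ.≟ 0ℚ | pivot rows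
... | no r≢0  | _ = inj₂ ([] , r , rows , refl , r≢0)
... | yes r≡0 | inj₁ all = inj₁ (r≡0 ∷ all)
... | yes _   | inj₂ (as , r′ , bs , refl , r≢0) = inj₂ (r ∷ as , r′ , bs , refl , r≢0)

-- Gaussian elimination. Without a pivot in the first column the first unit vector is a solution;
-- otherwise the first unknown is eliminated and recovered by back substitution.
kernel : (rows : List (Point n)) → length rows < n → ∃[ c ] ((∃[ i ] c i ≢ 0ℚ) × All (λ r → dot r c ≡ 0ℚ) rows)
kernel {suc n} rows l with pivot rows
... | inj₁ zeros = δ Fin.zero , (Fin.zero , ℚₚ.1≢0) ,
  All.map (λ {r} r≡0 → trans (dot-comm r (δ Fin.zero)) (trans (dot-δ Fin.zero r) r≡0)) zeros
... | inj₂ (as , r , bs , refl , r≢0) with kernel (map elim (as ++ bs)) shorter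
  where
  elim : Point (suc n) → Point n
  elim s = (s ∘ Fin.suc) ⊕ (-ℚ (s Fin.zero *ℚ inv (r Fin.zero))) ⊙ (r ∘ Fin.suc)
  shorter : length (map elim (as ++ bs)) < n
  shorter = subst (_< n) (sym (trans (Listₚ.length-map elim (as ++ bs)) (Listₚ.length-++ as)))
    (ℕₚ.≤-pred (subst (_< suc n) (trans (Listₚ.length-++ as) (ℕₚ.+-suc (length as) (length bs))) l))
... | c , (i , ci≢0) , sols = c₀ , (Fin.suc i , ci≢0) , Allₚ.++⁺ (Allₚ.++⁻ˡ as sols′) (pivot-row ∷ Allₚ.++⁻ʳ as sols′)
  where
  D = dot (r ∘ Fin.suc) c
  c₀ : Point (suc n)
  c₀ Fin.zero    = -ℚ (inv (r Fin.zero) *ℚ D)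
  c₀ (Fin.suc i) = c i
  pivot-row : dot r c₀ ≡ 0ℚ
  pivot-row = trans (solve 3 (λ r i d → r :* :- (i :* d) :+ d := (con 1ℚ :+ :- (r :* i)) :* d) refl (r Fin.zero) (inv (r Fin.zero)) D)
    (trans (cong (λ u → (1ℚ +ℚ (-ℚ u)) *ℚ D) (*-inv r≢0)) (ℚₚ.*-zeroˡ D))
  sols′ : All (λ s → dot s c₀ ≡ 0ℚ) (as ++ bs)
  sols′ = All.map (λ {s} e → trans (solve 4 (λ s i d e → s :* :- (i :* d) :+ e := e :+ :- (s :* i) :* d) refl (s Fin.zero) (inv (r Fin.zero)) D (dot (s ∘ Fin.suc) c))
      (trans (sym (dot-linearˡ (s ∘ Fin.suc) (-ℚ (s Fin.zero *ℚ inv (r Fin.zero))) (r ∘ Fin.suc) c)) e)) (Allₚ.map⁻ sols)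

-- The support condition is imposed by one unit row for each of the n - ∣ τ ∣ coordinates outside τ,
-- which leaves fewer than n equations.
kernel-on : (rows : List (Point n)) (τ : Subset n) → length rows < ∣ τ ∣ →
  ∃[ c ] ((∃[ i ] c i ≢ 0ℚ) × (∀ {i} → i ∉ τ → c i ≡ 0ℚ) × All (λ r → dot r c ≡ 0ℚ) rows)
kernel-on {n} rows τ l with kernel (rows ++ map δ (elements (∁ τ))) bound
  where
  bound : length (rows ++ map δ (elements (∁ τ))) < n
  bound = subst (_< n) (sym (trans (Listₚ.length-++ rows) (cong (length rows +_) (trans (Listₚ.length-map δ (elements (∁ τ))) (trans (length-elements (∁ τ)) (∣∁p∣≡n∸∣p∣ τ))))))
    (ℕₚ.<-≤-trans (ℕₚ.+-monoˡ-< (n ∸ ∣ τ ∣) l) (ℕₚ.≤-reflexive (ℕₚ.m+[n∸m]≡n (∣p∣≤n τ))))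
... | c , c≢0 , sols = c , c≢0 ,
  (λ {i} i∉ → trans (sym (dot-δ i c)) (All.lookup (Allₚ.++⁻ʳ rows sols) (∈-map⁺ δ (∈-elements⁺ (x∉p⇒x∈∁p i∉))))) , Allₚ.++⁻ˡ rows sols

upper : (xs : List ℚ) → ∃[ t ] (0ℚ <ℚ t × All (_<ℚ t) xs)
upper [] = 1ℚ , ℚₚ.positive⁻¹ 1ℚ , []
upper (x ∷ xs) with upper xs
... | t , t>0 , xs<t with x ℚₚ.<? t
... | yes x<t = t , t>0 , x<t ∷ xs<t
... | no x≮t  = x +ℚ 1ℚ , ℚₚ.<-trans t>0 t<x+1 , x<x+1 ∷ All.map (λ y<t → ℚₚ.<-trans y<t t<x+1) xs<t
  where
  x<x+1 : x <ℚ x +ℚ 1ℚ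
  x<x+1 = subst (_<ℚ x +ℚ 1ℚ) (ℚₚ.+-identityʳ x) (ℚₚ.+-monoʳ-< x (ℚₚ.positive⁻¹ 1ℚ))
  t<x+1 : t <ℚ x +ℚ 1ℚ
  t<x+1 = ℚₚ.≤-<-trans (ℚₚ.≮⇒≥ x≮t) x<x+1

-- Each a x + t · b x has at most one root in t, so t is taken beyond all of them. Where b x
-- vanishes the listed root is the default value 0, which is harmless.
large-nonzero : {A : Set} (a b : A → ℚ) (xs : List A) → All (λ x → a x ≢ 0ℚ ⊎ b x ≢ 0ℚ) xs →
                ∃[ t ] (0ℚ <ℚ t × All (λ x → a x +ℚ t *ℚ b x ≢ 0ℚ) xs)
large-nonzero {A} a b xs nz with upper (map (λ x → -ℚ (a x) *ℚ inv (b x)) xs)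
... | t , t>0 , below = t , t>0 , All.zipWith (λ { {x} (l , z) → avoid x l z }) (Allₚ.map⁻ below , nz)
  where
  root : ∀ u v w → v ≢ 0ℚ → u +ℚ w *ℚ v ≡ 0ℚ → w ≡ -ℚ u *ℚ inv v
  root u v w v≢0 e = begin
    w                                     ≡⟨ solve 1 (λ w → w := w :* con 1ℚ) refl w ⟩
    w *ℚ 1ℚ                               ≡⟨ cong (w *ℚ_) (sym (*-inv v≢0)) ⟩
    w *ℚ (v *ℚ inv v)                     ≡⟨ solve 4 (λ u v w i → w :* (v :* i) := ((u :+ w :* v) :+ :- u) :* i) refl u v w (inv v) ⟩
    ((u +ℚ w *ℚ v) +ℚ (-ℚ u)) *ℚ inv v    ≡⟨ cong (λ z → (z +ℚ (-ℚ u)) *ℚ inv v) e ⟩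
    (0ℚ +ℚ (-ℚ u)) *ℚ inv v               ≡⟨ cong (_*ℚ inv v) (ℚₚ.+-identityˡ (-ℚ u)) ⟩
    -ℚ u *ℚ inv v                         ∎
    where open ≡-Reasoning
  avoid : ∀ x → -ℚ (a x) *ℚ inv (b x) <ℚ t → a x ≢ 0ℚ ⊎ b x ≢ 0ℚ → a x +ℚ t *ℚ b x ≢ 0ℚ
  avoid x l z e = go (b x ℚₚ.≟ 0ℚ) z
    where
    go : Dec (b x ≡ 0ℚ) → ¬ (a x ≢ 0ℚ ⊎ b x ≢ 0ℚ)
    go (no b≢0)  _          = ℚₚ.<⇒≢ l (sym (root (a x) (b x) t b≢0 e))
    go (yes b≡0) (inj₂ b≢0) = b≢0 b≡0
    go (yes b≡0) (inj₁ a≢0) = a≢0 (trans (sym (trans (cong (λ u → a x +ℚ t *ℚ u) b≡0) (trans (cong (a x +ℚ_) (ℚₚ.*-zeroʳ t)) (ℚₚ.+-identityʳ (a x))))) e)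

-- For each further functional c the point moves along a coordinate i with c i ≠ 0, by an amount t
-- for which neither c nor any earlier functional vanishes. Positivity on τ survives since t > 0.
generic-point : (τ : Subset n) (cs : List (Point n)) → All (λ c → (∃[ i ] c i ≢ 0ℚ) × (∀ {i} → i ∉ τ → c i ≡ 0ℚ)) cs →
  ∃[ p ] ((∀ {i} → i ∈ τ → 0ℚ <ℚ p i) × (∀ {i} → i ∉ τ → p i ≡ 0ℚ) × All (λ c → dot c p ≢ 0ℚ) cs)
generic-point {n} τ [] [] = p , inside , outside , []
  where
  p : Point n
  p i with i ∈? τ
  ... | yes _ = 1ℚ
  ... | no  _ = 0ℚ
  inside : ∀ {i} → i ∈ τ → 0ℚ <ℚ p i
  inside {i} i∈ with i ∈? τ
  ... | yes _ = ℚₚ.positive⁻¹ 1ℚ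
  ... | no i∉ = contradiction i∈ i∉
  outside : ∀ {i} → i ∉ τ → p i ≡ 0ℚ
  outside {i} i∉ with i ∈? τ
  ... | yes i∈ = contradiction i∈ i∉
  ... | no _   = refl
generic-point {n} τ (c ∷ cs) (((i , ci≢0) , c-supp) ∷ good) with generic-point τ cs good
... | p , p>0 , p≡0 , avoids with large-nonzero (λ d → dot d p) (λ d → d i) (c ∷ cs) (inj₂ ci≢0 ∷ All.map inj₁ avoids)
... | t , t>0 , nz = p ⊕ t ⊙ δ i ,
    (λ {j} j∈ → +-pos-nonneg (p>0 j∈) (*-nonneg (ℚₚ.<⇒≤ t>0) (δ-nonneg i j))) ,
    (λ {j} j∉ → trans (cong₂ (λ u v → u +ℚ t *ℚ v) (p≡0 j∉) (δ-diff {i = i} {j} λ { refl → ci≢0 (c-supp j∉) })) (trans (ℚₚ.+-identityˡ _) (ℚₚ.*-zeroʳ t))) ,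
    All.map (λ {d} ne e → ne (trans (sym (value d)) e)) nz
  where
  value : ∀ d → dot d (p ⊕ t ⊙ δ i) ≡ dot d p +ℚ t *ℚ d i
  value d = trans (dot-comm d (p ⊕ t ⊙ δ i)) (trans (dot-linearˡ p t (δ i) d) (cong₂ (λ u v → u +ℚ t *ℚ v) (dot-comm p d) (dot-δ i d)))

module _ {J : Complex n} {f : Fin n → Point n′} {K : Complex n′} (sub : IsSubdivision J f K) where
  open Subdivision sub

  -- The n′ coordinate equations already force a relation among the vertices to have coefficient sum
  -- 0, because every vertex has total 1. Hence the bound is n′ and not n′ + 1.
  cell-size : ∀ {σ} → J σ ≡ true → ∣ σ ∣ ≤ n′
  cell-size {σ} Jσ = ℕₚ.≮⇒≥ impossible
    where
    rows : List (Point n)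
    rows = map (λ i v → f v i) (allFin n′)
    impossible : ¬ (n′ < ∣ σ ∣)
    impossible l with kernel-on rows σ (subst (_< ∣ σ ∣) (sym (trans (Listₚ.length-map _ (allFin n′)) (Listₚ.length-tabulate {n = n′} (λ i → i)))) l)
    ... | μ , (v , μv≢0) , μ≡0 , sols = μv≢0 (J-independent σ Jσ μ (λ v → μ≡0)
          (trans (sym (combination-total Jσ μ μ≡0)) (sumFin-0 relation)) relation v)
      where
      relation : ∀ i → sumFin (λ v → μ v *ℚ f v i) ≡ 0ℚ
      relation i = trans (dot-comm μ (λ v → f v i)) (All.lookup sols (∈-map⁺ (λ i v → f v i) (∈-allFin i)))

  -- A point of τ in general position lies in no cell of smaller dimension.
  simplex-size : ∀ {s} → (∀ {σ} → J σ ≡ true → ∣ σ ∣ ≤ s) → ∀ {τ} → K τ ≡ true → ∣ τ ∣ ≤ s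
  simplex-size {s} small {τ} Kτ = ℕₚ.≮⇒≥ impossible
    where
    Annihilates : Subset n → Point n′ → Set
    Annihilates σ c = ∀ {v} → v ∈ σ → dot (f v) c ≡ 0ℚ

    Good : Point n′ → Set
    Good c = (∃[ i ] c i ≢ 0ℚ) × (∀ {i} → i ∉ τ → c i ≡ 0ℚ)

    -- At most s vertices of the cell give fewer equations than the ∣ τ ∣ unknowns, so some nonzero
    -- functional supported on τ kills the whole cell.
    functional : s < ∣ τ ∣ → ∀ {σ} → J σ ≡ true → ∃[ c ] (Good c × Annihilates σ c)
    functional l {σ} Jσ with kernel-on (map f (elements σ)) τ
      (ℕₚ.≤-<-trans (subst (_≤ s) (sym (trans (Listₚ.length-map f (elements σ)) (length-elements σ))) (small Jσ)) l)
    ... | c , c≢0 , supp , sols = c , (c≢0 , supp) , λ v∈ → All.lookup sols (∈-map⁺ f (∈-elements⁺ v∈))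

    functionals : s < ∣ τ ∣ → (σs : List (Subset n)) → All (λ σ → J σ ≡ true) σs →
      ∃[ cs ] (All Good cs × (∀ {σ} → σ ∈ˡ σs → ∃[ c ] (c ∈ˡ cs × Annihilates σ c)))
    functionals l [] [] = [] , [] , λ ()
    functionals l (σ ∷ σs) (Jσ ∷ Jσs) with functional l Jσ | functionals l σs Jσs
    ... | c , good , ann | cs , goods , anns = c ∷ cs , good ∷ goods ,
      λ { (here refl) → c , here refl , ann ; (there σ∈) → let (d , d∈ , a) = anns σ∈ in d , there d∈ , a }

    impossible : ¬ (s < ∣ τ ∣)
    impossible l with functionals l (members J) (All.tabulate (∈-members⁻ J))
    ... | cs , goods , anns with generic-point τ cs goods | ∣p∣>0⇒nonempty (ℕₚ.≤-trans (s≤s z≤n) l)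
    ... | p , p>0 , p≡0 , avoids | x , x∈ = contra (J-cover p̂ (τ , Kτ , normal))
      where
      p≥0 : ∀ i → Dec (i ∈ τ) → 0ℚ ≤ℚ p i
      p≥0 i (yes i∈) = ℚₚ.<⇒≤ (p>0 i∈)
      p≥0 i (no i∉)  = ℚₚ.≤-reflexive (sym (p≡0 i∉))
      t>0 : 0ℚ <ℚ total p
      t>0 = sumFin-pos (λ i → p≥0 i (i ∈? τ)) x (p>0 x∈)
      p̂ : Point n′
      p̂ = inv (total p) ⊙ p
      normal : InSimplex τ p̂
      normal = (λ i → *-nonneg (ℚₚ.<⇒≤ (inv-pos t>0)) (p≥0 i (i ∈? τ))) ,
        (λ i i∉ → trans (cong (inv (total p) *ℚ_) (p≡0 i∉)) (ℚₚ.*-zeroʳ (inv (total p)))) ,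
        trans (sumFin-*ˡ (inv (total p)) p) (trans (ℚₚ.*-comm (inv (total p)) (total p)) (*-inv-pos t>0))
      contra : ¬ (∃[ σ ] (J σ ≡ true × InHull f σ p̂))
      contra (σ , Jσ , μ , (_ , μ≡0 , _) , eq) with anns (∈-members⁺ J Jσ)
      ... | c , c∈ , ann = All.lookup avoids c∈ (*-zero⁻ (inv (total p)) (dot c p) (trans (sym scaled) vanishes) (pos⇒≢0 (inv-pos t>0)))
        where
        scaled : dot c p̂ ≡ inv (total p) *ℚ dot c p
        scaled = trans (sumFin-cong (λ i → solve 3 (λ c a p → c :* (a :* p) := a :* (c :* p)) refl (c i) (inv (total p)) (p i))) (sumFin-*ˡ (inv (total p)) (λ i → c i *ℚ p i))
        term : ∀ v → Dec (v ∈ σ) → μ v *ℚ dot (f v) c ≡ 0ℚ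
        term v (yes v∈) = trans (cong (μ v *ℚ_) (ann v∈)) (ℚₚ.*-zeroʳ (μ v))
        term v (no v∉)  = trans (cong (_*ℚ dot (f v) c) (μ≡0 v v∉)) (ℚₚ.*-zeroˡ (dot (f v) c))
        vanishes : dot c p̂ ≡ 0ℚ
        vanishes = begin
          sumFin (λ i → c i *ℚ p̂ i)                          ≡⟨ sumFin-cong (λ i → trans (cong (c i *ℚ_) (eq i)) (sym (sumFin-*ˡ (c i) (λ v → μ v *ℚ f v i)))) ⟩
          sumFin (λ i → sumFin (λ v → c i *ℚ (μ v *ℚ f v i))) ≡⟨ sumFin-swap (λ i v → c i *ℚ (μ v *ℚ f v i)) ⟩
          sumFin (λ v → sumFin (λ i → c i *ℚ (μ v *ℚ f v i))) ≡⟨ sumFin-cong (λ v → trans (sumFin-cong (λ i → solve 3 (λ c m f → c :* (m :* f) := m :* (f :* c)) refl (c i) (μ v) (f v i))) (sumFin-*ˡ (μ v) (λ i → f v i *ℚ c i))) ⟩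
          sumFin (λ v → μ v *ℚ dot (f v) c)                   ≡⟨ sumFin-0 (λ v → term v (v ∈? σ)) ⟩
          0ℚ                                                  ∎
          where open ≡-Reasoning

abstract
  -- The k-simplex lives on k + 1 coordinates, so the cells of the common subdivision have at most k
  -- + 1 vertices by `cell-size`; `simplex-size` carries the bound over to L.
  combBall-size : ∀ {k} {L : Complex n} → IsCombBall k L → ∀ {σ} → L σ ≡ true → ∣ σ ∣ ≤ suc k
  combBall-size (_ , _ , _ , _ , _ , subL , subΔ) = simplex-size subL (cell-size subΔ)

abstract
  combBall-⊥ : ∀ {k} {L : Complex n} → IsCombBall k L → L ⊥ ≡ true
  combBall-⊥ {k = k} {L} (complex , _ , J , f , g , subL , subΔ) =
    let (σ , Jσ , _) = Subdivision.J-cover subΔ (δ Fin.zero)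
          (⊤ , refl , δ-nonneg Fin.zero , (λ i i∉ → contradiction ∈⊤ i∉) , sumFin-δ {suc k} Fin.zero)
        (ρ , Lρ , _) = Subdivision.J-carrier subL σ Jσ
    in complex ρ ⊥ Lρ ⊥⊆

-- Facets of minimal NH-spheres

≡ᵇ⁻ : ∀ {a b} → (a ≡ᵇ b) ≡ true → a ≡ b
≡ᵇ⁻ {a} {b} e = ℕₚ.≡ᵇ⇒≡ a b (subst T (sym e) _)

≡ᵇ⁺ : ∀ {a b} → a ≡ b → (a ≡ᵇ b) ≡ true
≡ᵇ⁺ {zero}  refl = refl
≡ᵇ⁺ {suc a} refl = ≡ᵇ⁺ {a} refl

-- The predicate counted inside `∂`, kept in the same form so that both agree by definition.
coface : ℕ → Complex n → Subset n → Subset n → Bool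
coface k L ρ ρ′ = L ρ′ ∧ (∣ ρ′ ∣ ≡ᵇ suc k) ∧ (ρ ⊆ᵇ ρ′)

abstract
  coface⁺ : ∀ {k} {L : Complex n} {ρ ρ′} → L ρ′ ≡ true → ∣ ρ′ ∣ ≡ suc k → ρ ⊆ ρ′ → coface k L ρ ρ′ ≡ true
  coface⁺ {k = k} {ρ′ = ρ′} Lρ′ size ρ⊆ρ′ = ∧⁺ Lρ′ (∧⁺ (≡ᵇ⁺ {∣ ρ′ ∣} {suc k} size) (⊆ᵇ⁺ ρ⊆ρ′))

abstract
  coface⁻ : ∀ {k} {L : Complex n} {ρ ρ′} → coface k L ρ ρ′ ≡ true → L ρ′ ≡ true × ∣ ρ′ ∣ ≡ suc k × ρ ⊆ ρ′
  coface⁻ {k = k} {L} {ρ} {ρ′} e =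
    let (a , e′) = ∧⁻ {L ρ′} e
        (b , c) = ∧⁻ {∣ ρ′ ∣ ≡ᵇ suc k} e′
    in a , ≡ᵇ⁻ {∣ ρ′ ∣} b , ⊆ᵇ⁻ c

abstract
  ∂⁺ : ∀ {k} {L : Complex n} {σ} ρ → σ ⊆ ρ → L ρ ≡ true → ∣ ρ ∣ ≡ k → countB (coface k L ρ) ≡ 1 → ∂ k L σ ≡ true
  ∂⁺ {n} {k} {L} {σ} ρ σ⊆ρ Lρ size count =
    any⁺ (λ ρ → (σ ⊆ᵇ ρ) ∧ L ρ ∧ (∣ ρ ∣ ≡ᵇ k) ∧ (countB (coface k L ρ) ≡ᵇ 1)) (∈-allSubsets ρ)
      (∧⁺ (⊆ᵇ⁺ σ⊆ρ) (∧⁺ Lρ (∧⁺ (≡ᵇ⁺ {∣ ρ ∣} size) (≡ᵇ⁺ {countB (coface k L ρ)} count))))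

abstract
  ∂⁻ : ∀ {k} {L : Complex n} {σ} → ∂ k L σ ≡ true → ∃[ ρ ] (σ ⊆ ρ × L ρ ≡ true × ∣ ρ ∣ ≡ k × countB (coface k L ρ) ≡ 1)
  ∂⁻ {n} {k} {L} {σ} e =
    let (ρ , _ , e₁) = any⁻ (λ ρ → (σ ⊆ᵇ ρ) ∧ L ρ ∧ (∣ ρ ∣ ≡ᵇ k) ∧ (countB (coface k L ρ) ≡ᵇ 1)) (allSubsets n) e
        (a , e₂) = ∧⁻ {σ ⊆ᵇ ρ} e₁
        (b , e₃) = ∧⁻ {L ρ} e₂
        (c , d) = ∧⁻ {∣ ρ ∣ ≡ᵇ k} e₃
    in ρ , ⊆ᵇ⁻ a , b , ≡ᵇ⁻ {∣ ρ ∣} c , ≡ᵇ⁻ {countB (coface k L ρ)} d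

-- For facets F ≠ G this says that F leaves a single vertex in the link of F ∩ G.
Thin : Subset n → Subset n → Set
Thin F G = ∃[ x ] (∀ {y} → y ∈ F → y ∉ G → y ≡ x)

record Decomposition {n} (k : ℕ) (S B L : Complex n) : Set where
  field
    B-complex   : IsComplex B
    B-⊥         : B ⊥ ≡ true
    B-top       : TopGenerated B S
    L-ball      : IsCombBall k L
    L-top       : TopGenerated L S
    union       : (B +ₖ L) ≈ₖ S
    boundary    : (B ∩ₖ L) ≈ₖ ∂ k L

  L-complex : IsComplex L
  L-complex = proj₁ L-ball

  B⊆S : ∀ {σ} → B σ ≡ true → S σ ≡ true
  B⊆S {σ} Bσ = trans (sym (union σ)) (∨⁺ˡ Bσ)

  L⊆S : ∀ {σ} → L σ ≡ true → S σ ≡ true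
  L⊆S {σ} Lσ = trans (sym (union σ)) (∨⁺ʳ {B σ} Lσ)

  S⊆B⊎L : ∀ {σ} → S σ ≡ true → B σ ≡ true ⊎ L σ ≡ true
  S⊆B⊎L {σ} Sσ = ∨⁻ {B σ} (trans (union σ) Sσ)

  -- B ∩ L = ∂L is generated by simplices with only k vertices.
  L-cell∉B : ∀ {μ} → L μ ≡ true → ∣ μ ∣ ≡ suc k → B μ ≢ true
  L-cell∉B {μ} Lμ size Bμ =
    let (ρ , μ⊆ρ , _ , ∣ρ∣ , _) = ∂⁻ {k = k} {L} {μ} (trans (sym (boundary μ)) (∧⁺ Bμ Lμ))
    in ℕₚ.<⇒≱ (ℕₚ.n<1+n k) (subst (_≤ k) size (subst (∣ μ ∣ ≤_) ∣ρ∣ (p⊆q⇒∣p∣≤∣q∣ μ⊆ρ)))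

  B-facet-above : ∀ {σ} → B σ ≡ true → ∃[ G ] (σ ⊆ G × Principal S G × B G ≡ true)
  B-facet-above Bσ =
    let (G , σ⊆G , pr) = principal-above B Bσ
    in G , σ⊆G , principal⁻ (B-top G (principal⁺ pr)) , Principal.∈K pr

  -- If μ is the only k-simplex of L on the ridge, then the ridge lies in ∂L ⊆ B and a facet of B
  -- above it differs from μ, which is not in B. Otherwise L has a second k-simplex there; a facet
  -- above it equal to μ would force the two k-simplices to coincide, having equal size.
  ridge : ∀ {μ v} → L μ ≡ true → ∣ μ ∣ ≡ suc k → v ∈ μ → ∃[ G ] (Principal S G × μ ∖ v ⊆ G × G ≢ μ)
  ridge {μ} {v} Lμ size v∈μ with countB (coface k L (μ ∖ v)) ℕₚ.≟ 1
  ... | yes one =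
    let ∂ρ = ∂⁺ {k = k} {L} (μ ∖ v) (λ x → x) (L-complex μ (μ ∖ v) Lμ (∖-⊆ {p = μ})) (ℕₚ.suc-injective (trans (sym (∣∖∣ v∈μ)) size)) one
        (G , ρ⊆G , pr , BG) = B-facet-above (proj₁ (∧⁻ (trans (boundary (μ ∖ v)) ∂ρ)))
    in G , pr , ρ⊆G , λ e → L-cell∉B Lμ size (subst (λ τ → B τ ≡ true) e BG)
  ... | no ≢1 =
    let (ρ , Pρ , ρ≢μ) = countB≢1⁻ (coface k L (μ ∖ v)) (coface⁺ {k = k} {L} Lμ size (∖-⊆ {p = μ})) ≢1
        (Lρ , ∣ρ∣ , ⊆ρ) = coface⁻ {k = k} {L} Pρ
        (G , ρ⊆G , pr) = principal-above S (L⊆S Lρ)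
    in G , pr , (λ x → ρ⊆G (⊆ρ x)) , λ e → ρ≢μ (⊆∧∣≡∣⇒≡ (λ {x} x∈ → subst (x ∈_) e (ρ⊆G x∈)) (ℕₚ.≤-reflexive (trans size (sym ∣ρ∣))))

  -- The empty simplex lies in ∂L, so some ρ with k vertices has a unique coface μ of size k + 1. A
  -- face of L beyond μ by a vertex x would contain ρ + x, a second coface, so μ is principal in L.
  L-facet : ∃[ μ ] (L μ ≡ true × ∣ μ ∣ ≡ suc k × Principal S μ)
  L-facet =
    let (ρ , _ , _ , ∣ρ∣ , one) = ∂⁻ {k = k} {L} {⊥} (trans (sym (boundary ⊥)) (∧⁺ B-⊥ (combBall-⊥ L-ball)))
        (μ , Pμ , uniq) = countB≡1⁻ (coface k L ρ) one
        (Lμ , ∣μ∣ , ρ⊆μ) = coface⁻ {k = k} {L} Pμ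
    in μ , Lμ , ∣μ∣ , principal⁻ (L-top μ (principal⁺ (mkPrincipal Lμ (λ {τ} Lτ μ⊆τ → ⊆-antisym μ⊆τ (λ {x} x∈τ →
         decidable-stable (x ∈? μ) (λ x∉μ → x∉μ (subst (x ∈_)
           (uniq (coface⁺ {k = k} {L} (L-complex τ (⁅ x ⁆ ∪ ρ) Lτ (insert-⊆ x∈τ (λ y → μ⊆τ (ρ⊆μ y))))
             (trans (∣insert∣ (λ x∈ρ → x∉μ (ρ⊆μ x∈ρ))) (cong suc ∣ρ∣)) ∈-insert⁺)) x∈insert)))))))

  -- If only two facets exist, the principal k-simplex of L has all its ridges in the other one.
  two-facets-thin : ∀ {F G} → (∀ {H} → Principal S H → H ≡ F ⊎ H ≡ G) → Thin F G ⊎ Thin G F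
  two-facets-thin only with L-facet
  ... | μ , Lμ , ∣μ∣ , pr with ∣p∣>0⇒nonempty (subst (1 ≤_) (sym ∣μ∣) (s≤s z≤n))
  ... | v , v∈μ with ridge Lμ ∣μ∣ v∈μ
  ... | H , prH , ⊆H , H≢μ with only pr | only prH
  ... | inj₁ refl | inj₁ refl = contradiction refl H≢μ
  ... | inj₂ refl | inj₂ refl = contradiction refl H≢μ
  ... | inj₁ refl | inj₂ refl = inj₁ (v , λ {y} y∈ y∉ → decidable-stable (y Fin.≟ v) (λ y≢v → y∉ (⊆H (∈-∖⁺ y∈ y≢v))))
  ... | inj₂ refl | inj₁ refl = inj₂ (v , λ {y} y∈ y∉ → decidable-stable (y Fin.≟ v) (λ y≢v → y∉ (⊆H (∈-∖⁺ y∈ y≢v))))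

hasDim-⊥ : ∀ {d} {K : Complex n} → IsComplex K → HasDim K d → K ⊥ ≡ true
hasDim-⊥ complex ((σ , Kσ , _) , _) = complex σ ⊥ Kσ ⊥⊆

sphere-decomposition : ∀ {d k} {S : Complex n} → NHSphere (suc d) k S → ∃[ B ] ∃[ L ] (Decomposition k S B L × Collapsible B)
sphere-decomposition (_ , B , L , ((B-complex , B-dim , _) , coll) , B-top , L-ball , L-top , union , boundary) = B , L , record
  { B-complex = B-complex ; B-⊥ = hasDim-⊥ B-complex B-dim ; B-top = B-top ; L-ball = L-ball ; L-top = L-top ; union = union ; boundary = boundary } , coll

manifold-complex : ∀ d {K : Complex n} → NHManifold d K → IsComplex K
manifold-complex zero    (c , _)     = c
manifold-complex (suc d) (c , _ , _) = c

-- Links and pairs of facets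

lk⁺ : {K : Complex n} {v : Fin n} {ρ : Subset n} → K (⁅ v ⁆ ∪ ρ) ≡ true → v ∉ ρ → lk v K ρ ≡ true
lk⁺ {v = v} {ρ} Kρ v∉ = ∧⁺ Kρ (not⁺ (v∉ ∘ ⌊⌋⁻ (v ∈? ρ)))

lk⁻ : {K : Complex n} {v : Fin n} {ρ : Subset n} → lk v K ρ ≡ true → K (⁅ v ⁆ ∪ ρ) ≡ true × v ∉ ρ
lk⁻ {K = K} {v} {ρ} e = let (a , b) = ∧⁻ {K (⁅ v ⁆ ∪ ρ)} e in a , not⁻ b ∘ ⌊⌋⁺ (v ∈? ρ)

module _ {K : Complex n} {v : Fin n} where

  lk-principal⁺ : ∀ {F} → Principal K F → v ∈ F → Principal (lk v K) (F ∖ v)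
  lk-principal⁺ {F} (mkPrincipal KF max) v∈F = mkPrincipal (lk⁺ {K = K} {v} {F ∖ v} (subst (λ τ → K τ ≡ true) (sym (insert-∖ v∈F)) KF) (x∉p∖x {p = F}))
    λ {ρ} lkρ F∖v⊆ρ → let (Kρ , v∉ρ) = lk⁻ {K = K} lkρ in
      trans (cong (_∖ v) (max Kρ (λ {y} y∈ → [ (λ { refl → x∈insert }) , ∈-insert⁺ ∘ F∖v⊆ρ ]′ (∈-insert⁻ (subst (y ∈_) (sym (insert-∖ v∈F)) y∈)))))
        (∖-insert v∉ρ)

  lk-principal⁻ : ∀ {H} → Principal (lk v K) H → Principal K (⁅ v ⁆ ∪ H) × v ∉ H
  lk-principal⁻ {H} (mkPrincipal lkH max) = let (KH , v∉H) = lk⁻ {K = K} lkH in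
    mkPrincipal KH (λ {τ} Kτ ⊆τ → let v∈τ = ⊆τ x∈insert in
      trans (cong (⁅ v ⁆ ∪_) (max (lk⁺ {K = K} {v} {τ ∖ v} (subst (λ τ → K τ ≡ true) (sym (insert-∖ v∈τ)) Kτ) (x∉p∖x {p = τ})) (⊆-∖ (⊆τ ∘ ∈-insert⁺) v∉H))) (insert-∖ v∈τ)) , v∉H

-- F ∩ G lies in no third facet, so its link is the disjoint union of the two simplices F - G and G
-- - F; the codimension of F ∩ G is arbitrary.
record Ridge {n} (K : Complex n) (F G : Subset n) : Set where
  field
    prF  : Principal K F
    prG  : Principal K G
    F≢G  : F ≢ G
    only : ∀ {H} → Principal K H → F ∩ G ⊆ H → H ≡ F ⊎ H ≡ G

lk-ridge : {K : Complex n} {v : Fin n} {F G : Subset n} → Ridge K F G → v ∈ F → v ∈ G → Ridge (lk v K) (F ∖ v) (G ∖ v)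
lk-ridge {K = K} {v} {F} {G} r v∈F v∈G = record
  { prF = lk-principal⁺ prF v∈F
  ; prG = lk-principal⁺ prG v∈G
  ; F≢G = λ e → F≢G (trans (sym (insert-∖ v∈F)) (trans (cong (⁅ v ⁆ ∪_) e) (insert-∖ v∈G)))
  ; only = λ {H} prH ⊆H → let (prvH , v∉H) = lk-principal⁻ prH in
      Sum.map (λ e → trans (sym (∖-insert v∉H)) (cong (_∖ v) e)) (λ e → trans (sym (∖-insert v∉H)) (cong (_∖ v) e))
        (only prvH (λ {y} y∈ → enlarge ⊆H y (y Fin.≟ v) (x∈p∩q⁻ F G y∈)))
  }
  where
  open Ridge r
  enlarge : ∀ {H} → (F ∖ v) ∩ (G ∖ v) ⊆ H → ∀ y → Dec (y ≡ v) → y ∈ F × y ∈ G → y ∈ ⁅ v ⁆ ∪ H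
  enlarge ⊆H y (yes refl) _ = x∈insert
  enlarge ⊆H y (no y≢v) (y∈F , y∈G) = ∈-insert⁺ (⊆H (x∈p∩q⁺ (∈-∖⁺ y∈F y≢v , ∈-∖⁺ y∈G y≢v)))

Thin-∖ : {v : Fin n} {F G : Subset n} → v ∈ G → Thin (F ∖ v) (G ∖ v) → Thin F G
Thin-∖ v∈G (x , only) = x , λ y∈F y∉G → only (∈-∖⁺ y∈F (λ { refl → y∉G v∈G })) (y∉G ∘ ∖-⊆)

Thin⊎ : Subset n → Subset n → Set
Thin⊎ F G = Thin F G ⊎ Thin G F

principal-≢⊥ : {K : Complex n} {F G : Subset n} → Principal K F → Principal K G → F ≢ G → ∃[ x ] x ∈ F
principal-≢⊥ {F = F} prF prG F≢G with nonempty? F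
... | yes w = w
... | no ¬w = contradiction (Principal.max prF (Principal.∈K prG) (λ x∈ → contradiction (_ , x∈) ¬w)) F≢G

-- Disjointness makes F and G the only facets. Both are nonempty, so {F, G} is a critical cover.
disjoint-¬collapsible : {K : Complex n} {F G : Subset n} → IsComplex K → Ridge K F G → (∀ x → x ∈ F → x ∉ G) → ¬ Collapsible K
disjoint-¬collapsible {K = K} {F} {G} complex r disj coll = collapsible⇒¬critical complex coll (F ∷ G ∷ [])
    (λ { (here refl) → Principal.∈K prF ; (there (here refl)) → Principal.∈K prG }) covered
    ((proj₁ g , ∈⊤ , λ { (here refl) → proj₂ g }) , (proj₁ f , x∈p∩q⁺ (∈⊤ , proj₂ f) , λ ()) ,
      λ x x∈ → let (x∈⊤F , x∈G) = x∈p∩q⁻ (⊤ ∩ F) G x∈ in disj x (proj₂ (x∈p∩q⁻ ⊤ F x∈⊤F)) x∈G)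
  where
  open Ridge r
  f = principal-≢⊥ prF prG F≢G
  g = principal-≢⊥ prG prF (F≢G ∘ sym)
  covered : ∀ {σ} → K σ ≡ true → ∃[ H ] (H ∈ˡ F ∷ G ∷ [] × σ ⊆ H)
  covered Kσ = let (H , σ⊆H , prH) = principal-above K Kσ in
    H , [ here , there ∘ here ]′ (only prH (λ x∈ → let (a , b) = x∈p∩q⁻ F G x∈ in contradiction b (disj _ a))) , σ⊆H

module _ {n : ℕ} where

  mutual
    -- Links are taken at vertices of F ∩ G, lowering the dimension, until F and G are disjoint and
    -- are the only facets. Such a complex of positive dimension is no ball, not being collapsible,
    -- and as a sphere it falls under `two-facets-thin`; in dimension 0 a facet has at most one
    -- vertex anyway.
    link-thin : ∀ d {K : Complex n} {F G} → LinkOK d K → Ridge K F G → Thin⊎ F G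
    link-thin d (inj₁ ball) r = ball-thin d ball r
    link-thin d (inj₂ (inj₁ sphere)) r = sphere-thin d sphere r
    link-thin d (inj₂ (inj₂ empty)) r = contradiction
      (trans (to⇔ (empty _) (Principal.∈K (Ridge.prF r))) (sym (to⇔ (empty _) (Principal.∈K (Ridge.prG r))))) (Ridge.F≢G r)

    ball-thin : ∀ d {K : Complex n} {F G} → BallUpTo d K → Ridge K F G → Thin⊎ F G
    ball-thin zero (_ , v , eq) r = inj₁ (v , λ y∈ _ → x∈⁅y⁆⇒x≡y v (to⇔ (eq _) (Principal.∈K (Ridge.prF r)) y∈))
    ball-thin (suc d) (inj₁ ball) r = ball-thin d ball r
    ball-thin (suc d) (inj₂ (mfd , coll)) r = manifold-thin d mfd r
      (λ disj → contradiction coll (disjoint-¬collapsible (manifold-complex (suc d) mfd) r disj))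

    sphere-thin : ∀ d {K : Complex n} {F G} → SphereUpTo d K → Ridge K F G → Thin⊎ F G
    sphere-thin zero (_ , _ , _ , u , v , _ , eq) r with to⇔ (eq _) (Principal.∈K (Ridge.prF r))
    ... | inj₁ F⊆u = inj₁ (u , λ y∈ _ → x∈⁅y⁆⇒x≡y u (F⊆u y∈))
    ... | inj₂ F⊆v = inj₁ (v , λ y∈ _ → x∈⁅y⁆⇒x≡y v (F⊆v y∈))
    sphere-thin (suc d) (inj₁ sphere) r = sphere-thin d sphere r
    sphere-thin (suc d) (inj₂ (k , sphere)) r = manifold-thin d (proj₁ sphere) r
      (λ disj → let (_ , _ , D , _) = sphere-decomposition sphere in
        Decomposition.two-facets-thin D (λ prH → Ridge.only r prH (λ x∈ → let (a , b) = x∈p∩q⁻ _ _ x∈ in contradiction b (disj _ a))))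

    manifold-thin : ∀ d {K : Complex n} {F G} → NHManifold (suc d) K → Ridge K F G → ((∀ x → x ∈ F → x ∉ G) → Thin⊎ F G) → Thin⊎ F G
    manifold-thin d {K} {F} {G} (complex , _ , links) r disjoint with nonempty? (F ∩ G)
    ... | no empty = disjoint (λ x a b → empty (x , x∈p∩q⁺ (a , b)))
    ... | yes (v , v∈) =
      let (v∈F , v∈G) = x∈p∩q⁻ F G v∈
          Kv = complex F ⁅ v ⁆ (Principal.∈K (Ridge.prF r)) (λ {y} y∈ → subst (_∈ F) (sym (x∈⁅y⁆⇒x≡y v y∈)) v∈F)
      in Sum.map (Thin-∖ v∈G) (Thin-∖ v∈F) (link-thin d (links v Kv) (lk-ridge r v∈F v∈G))

-- The facts from which a word can be built, uniform over all dimensions including {∅}. The vertex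
-- in `own` is the future marked letter of F; by `no-common` every element of V is omitted somewhere
-- and so becomes a letter.
record Nested {n} (V : Subset n) (S : Complex n) : Set where
  field
    complex   : IsComplex S
    nonvoid   : S ⊥ ≡ true
    vertex    : ∀ {v} → S ⁅ v ⁆ ≡ true → v ∈ V
    own       : ∀ {F} → Principal S F → ∃[ v ] (v ∈ V × v ∉ F × (∀ {G} → Principal S G → G ≢ F → v ∈ G))
    no-common : ∀ x → ∃[ F ] (Principal S F × x ∉ F)
    thin      : ∀ {F G} → Principal S F → Principal S G → F ≢ G → Thin⊎ F G

⁅⁆-⊆ : {v : Fin n} {F : Subset n} → v ∈ F → ⁅ v ⁆ ⊆ F
⁅⁆-⊆ {v = v} {F} v∈F y∈ = subst (_∈ F) (sym (x∈⁅y⁆⇒x≡y v y∈)) v∈F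

enumeration-complete : (P : Subset n → Bool) {xs : List (Subset n)} → Unique xs → (∀ {σ} → σ ∈ˡ xs → P σ ≡ true) →
                       countB P ≡ length xs → ∀ {σ} → P σ ≡ true → σ ∈ˡ xs
enumeration-complete P {xs} u sound count {σ} Pσ with Any.any? (σ ≟ₛ_) xs
... | yes σ∈ = σ∈
... | no σ∉  = contradiction (length-mono {xs = σ ∷ xs} (Allₚ.¬Any⇒All¬ xs σ∉ ∷ u) (λ { (here refl) → ∈-members⁺ P Pσ ; (there ρ∈) → ∈-members⁺ P (sound ρ∈) }))
  (ℕₚ.<⇒≱ (s≤s (ℕₚ.≤-reflexive (trans (sym (countB-members P)) count))))

-- The k + 2 facets of a minimal NH-sphere

module MinimalSphere {k} {S B L : Complex n} (S-complex : IsComplex S) (D : Decomposition k S B L) (coll : Collapsible B) (minimal : m S ≡ k + 2) where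
  open Decomposition D

  abstract
    μ : Subset n
    μ = proj₁ L-facet

    Lμ : L μ ≡ true
    Lμ = proj₁ (proj₂ L-facet)

    ∣μ∣ : ∣ μ ∣ ≡ suc k
    ∣μ∣ = proj₁ (proj₂ (proj₂ L-facet))

    pr-μ : Principal S μ
    pr-μ = proj₂ (proj₂ (proj₂ L-facet))

  choose : ∀ v → Dec (v ∈ μ) → Subset n
  choose v (yes v∈) = proj₁ (ridge Lμ ∣μ∣ v∈)
  choose v (no _)   = μ

  abstract
    opposite : Fin n → Subset n
    opposite v = choose v (v ∈? μ)

    opposite-spec : ∀ {v} → v ∈ μ → Principal S (opposite v) × μ ∖ v ⊆ opposite v × opposite v ≢ μ
    opposite-spec {v} v∈ = go (v ∈? μ)
      where
      go : (d : Dec (v ∈ μ)) → Principal S (choose v d) × μ ∖ v ⊆ choose v d × choose v d ≢ μ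
      go (yes v∈) = proj₂ (ridge Lμ ∣μ∣ v∈)
      go (no v∉)  = contradiction v∈ v∉

  opposite-principal : ∀ {v} → v ∈ μ → Principal S (opposite v)
  opposite-principal v∈ = proj₁ (opposite-spec v∈)

  opposite-∋ : ∀ {v w} → v ∈ μ → w ∈ μ → w ≢ v → w ∈ opposite v
  opposite-∋ v∈ w∈ w≢v = proj₁ (proj₂ (opposite-spec v∈)) (∈-∖⁺ w∈ w≢v)

  -- Otherwise the opposite facet would contain μ properly.
  opposite-∌ : ∀ {v} → v ∈ μ → v ∉ opposite v
  opposite-∌ {v} v∈ v∈F = proj₂ (proj₂ (opposite-spec v∈)) (sym (Principal.max pr-μ (Principal.∈K (opposite-principal v∈)) μ⊆))
    where
    μ⊆ : μ ⊆ opposite v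
    μ⊆ {w} w∈ with w Fin.≟ v
    ... | yes refl = v∈F
    ... | no w≢v   = opposite-∋ v∈ w∈ w≢v

  facets : List (Subset n)
  facets = μ ∷ map opposite (elements μ)

  facets-unique : Unique facets
  facets-unique = All.tabulate (λ F∈ → μ≢ (∈-map⁻ opposite F∈)) ∷ go (elements-unique μ) (∈-elements⁻ μ)
    where
    μ≢ : ∀ {F} → ∃[ v ] (v ∈ˡ elements μ × F ≡ opposite v) → μ ≢ F
    μ≢ (v , v∈ , refl) e = opposite-∌ (∈-elements⁻ μ v∈) (subst (v ∈_) e (∈-elements⁻ μ v∈))
    go : ∀ {vs} → Unique vs → (∀ {v} → v ∈ˡ vs → v ∈ μ) → Unique (map opposite vs)
    go [] _ = []
    go {v ∷ vs} (v∉ ∷ u) ∈μ = All.tabulate (λ F∈ → distinct (∈-map⁻ opposite F∈)) ∷ go u (∈μ ∘ there)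
      where
      distinct : ∀ {F} → ∃[ w ] (w ∈ˡ vs × F ≡ opposite w) → opposite v ≢ F
      distinct (w , w∈ , refl) e = opposite-∌ (∈μ (here refl)) (subst (v ∈_) (sym e) (opposite-∋ (∈μ (there w∈)) (∈μ (here refl)) (All.lookup v∉ w∈)))

  -- The place where minimality is used: μ and its k + 1 opposite facets are distinct, so they
  -- already exhaust the count.
  facet-cases : ∀ {G} → Principal S G → G ≡ μ ⊎ ∃[ v ] (v ∈ μ × G ≡ opposite v)
  facet-cases prG with enumeration-complete (principal S) facets-unique sound
      (trans minimal (trans (ℕₚ.+-comm k 2) (cong suc (sym (trans (Listₚ.length-map opposite (elements μ)) (trans (length-elements μ) ∣μ∣)))))) (principal⁺ prG)
    where
    sound : ∀ {G} → G ∈ˡ facets → principal S G ≡ true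
    sound (here refl) = principal⁺ pr-μ
    sound (there G∈) with ∈-map⁻ opposite G∈
    ... | v , v∈ , refl = principal⁺ (opposite-principal (∈-elements⁻ μ v∈))
  ... | here G≡μ = inj₁ G≡μ
  ... | there G∈ with ∈-map⁻ opposite G∈
  ... | v , v∈ , e = inj₂ (v , ∈-elements⁻ μ v∈ , e)

  missing⇒opposite : ∀ {G v} → Principal S G → v ∈ μ → v ∉ G → G ≡ opposite v
  missing⇒opposite {G} {v} prG v∈ v∉G with facet-cases prG
  ... | inj₁ refl = contradiction v∈ v∉G
  ... | inj₂ (w , w∈ , refl) with v Fin.≟ w
  ... | yes refl = refl
  ... | no v≢w   = contradiction (opposite-∋ w∈ v∈ v≢w) v∉G

  -- If L has a second facet μ − i + u, then its ridges show that u lies in every opposite facet.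
  common-from-L : ∀ {i} → i ∈ μ → L (opposite i) ≡ true → ∃[ u ] (∀ {v} → v ∈ μ → u ∈ opposite v)
  common-from-L {i} i∈ LF with ⊈-witness {p = opposite i} {μ ∖ i} (λ F⊆ →
        opposite-∌ i∈ (subst (i ∈_) (sym (Principal.max (opposite-principal i∈) (Principal.∈K pr-μ) (λ x∈ → ∖-⊆ (F⊆ x∈)))) i∈))
  ... | u , u∈F , u∉ = u , in-opposite
    where
    F = opposite i
    u∉μ : u ∉ μ
    u∉μ u∈μ = u∉ (∈-∖⁺ u∈μ (λ { refl → opposite-∌ i∈ u∈F }))
    size : ∣ F ∣ ≡ suc k
    -- F contains μ - i and u, and dimension invariance caps it at k + 1 vertices, so F = μ - i + u.
    size = ℕₚ.≤-antisym (combBall-size L-ball LF)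
      (subst (_≤ ∣ F ∣) (trans (∣insert∣ {p = μ ∖ i} {u} u∉) (cong suc (ℕₚ.suc-injective (trans (sym (∣∖∣ i∈)) ∣μ∣))))
        (p⊆q⇒∣p∣≤∣q∣ (insert-⊆ u∈F (proj₁ (proj₂ (opposite-spec i∈))))))
    in-opposite : ∀ {v} → v ∈ μ → u ∈ opposite v
    in-opposite {v} v∈ with v Fin.≟ i
    ... | yes refl = u∈F
    ... | no v≢i = go (ridge LF size v∈F)
      where
      v∈F : v ∈ F
      v∈F = opposite-∋ i∈ v∈ v≢i
      go : ∃[ G ] (Principal S G × F ∖ v ⊆ G × G ≢ F) → u ∈ opposite v
      -- The facet G across F - v omits v, as it would contain F otherwise; so it is `opposite v`,
      -- and it contains u because u ≠ v.
      go (G , prG , ⊆G , G≢F) = subst (u ∈_) (missing⇒opposite prG v∈ v∉G) (⊆G (∈-∖⁺ u∈F (λ { refl → u∉μ v∈ })))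
        where
        F⊆G : v ∈ G → F ⊆ G
        F⊆G v∈G {w} w∈ with w Fin.≟ v
        ... | yes refl = v∈G
        ... | no w≢v   = ⊆G (∈-∖⁺ w∈ w≢v)
        v∉G : v ∉ G
        v∉G v∈G = G≢F (sym (Principal.max (opposite-principal i∈) (Principal.∈K prG) (F⊆G v∈G)))

  -- Each v in μ lies in all opposite facets except its own, which witnesses that dropping
  -- `opposite v` leaves a nonempty intersection.
  critical : ∀ G vs → Unique vs → (∀ {v} → v ∈ˡ vs → v ∈ μ × v ∈ G) → (∀ {u} → u ∈ G → ¬ (∀ {v} → v ∈ˡ vs → u ∈ opposite v)) → Critical G (map opposite vs)
  critical G [] _ _ none = λ x x∈ → none x∈ λ ()
  critical G (v ∷ vs) (v∉ ∷ u) ∈μG none =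
      (v , proj₂ (∈μG (here refl)) , λ F∈ → contains (∈-map⁻ opposite F∈))
    , critical (G ∩ opposite v) vs u
        (λ w∈ → let (w∈μ , w∈G) = ∈μG (there w∈) in w∈μ , x∈p∩q⁺ (w∈G , opposite-∋ (proj₁ (∈μG (here refl))) w∈μ (All.lookup v∉ w∈ ∘ sym)))
        (λ u∈ all → let (u∈G , u∈F) = x∈p∩q⁻ G (opposite v) u∈ in none u∈G (λ { (here refl) → u∈F ; (there w∈) → all w∈ }))
    where
    contains : ∀ {F} → ∃[ w ] (w ∈ˡ vs × F ≡ opposite w) → v ∈ F
    contains (w , w∈ , refl) = opposite-∋ (proj₁ (∈μG (there w∈))) (proj₁ (∈μG (here refl))) (All.lookup v∉ w∈)

  -- Otherwise B is the union of the opposite facets.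
  common-from-B : (∀ {i} → i ∈ μ → L (opposite i) ≢ true) → ∃[ u ] (∀ {v} → v ∈ μ → u ∈ opposite v)
  common-from-B ¬L with Finₚ.any? (λ u → Finₚ.all? λ v → (v ∈? μ) →-dec (u ∈? opposite v))
  ... | yes (u , all) = u , λ {v} → all v
  ... | no none = contradiction
    (critical ⊤ (elements μ) (elements-unique μ) (λ v∈ → ∈-elements⁻ μ v∈ , ∈⊤) (λ {u} _ all → none (u , λ v v∈ → all (∈-elements⁺ v∈))))
    (collapsible⇒¬critical B-complex coll (map opposite (elements μ)) (λ F∈ → in-B (∈-map⁻ opposite F∈)) covered)
    where
    in-B : ∀ {F} → ∃[ v ] (v ∈ˡ elements μ × F ≡ opposite v) → B F ≡ true
    in-B (v , v∈ , refl) with S⊆B⊎L (Principal.∈K (opposite-principal (∈-elements⁻ μ v∈)))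
    ... | inj₁ BF = BF
    ... | inj₂ LF = contradiction LF (¬L (∈-elements⁻ μ v∈))
    covered : ∀ {σ} → B σ ≡ true → ∃[ F ] (F ∈ˡ map opposite (elements μ) × σ ⊆ F)
    covered Bσ = go (B-facet-above Bσ)
      where
      go : ∀ {σ} → ∃[ G ] (σ ⊆ G × Principal S G × B G ≡ true) → ∃[ F ] (F ∈ˡ map opposite (elements μ) × σ ⊆ F)
      go (G , σ⊆G , prG , BG) with facet-cases prG
      ... | inj₁ refl = contradiction BG (L-cell∉B Lμ ∣μ∣)
      ... | inj₂ (v , v∈ , refl) = opposite v , ∈-map⁺ opposite (∈-elements⁺ v∈) , σ⊆G

  common : ∃[ u ] (∀ {v} → v ∈ μ → u ∈ opposite v)
  common with Finₚ.any? (λ i → (i ∈? μ) ×-dec (L (opposite i) Boolₚ.≟ true))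
  ... | yes (i , i∈ , LF) = common-from-L i∈ LF
  ... | no none = common-from-B (λ i∈ LF → none (_ , i∈ , LF))

  -- For `opposite v` the vertex is v. For μ it is the common vertex u of the opposite facets, which
  -- is not in μ since `opposite u` would omit it.
  own-vertex : ∀ {F} → Principal S F → ∃[ v ] (S ⁅ v ⁆ ≡ true × v ∉ F × (∀ {G} → Principal S G → G ≢ F → v ∈ G))
  own-vertex prF with facet-cases prF
  ... | inj₂ (v , v∈ , refl) = v , S-complex μ ⁅ v ⁆ (Principal.∈K pr-μ) (⁅⁆-⊆ v∈) , opposite-∌ v∈ ,
    λ {G} prG G≢F → decidable-stable (v ∈? G) (λ v∉G → G≢F (missing⇒opposite prG v∈ v∉G))
  ... | inj₁ refl with common | ∣p∣>0⇒nonempty (subst (1 ≤_) (sym ∣μ∣) (s≤s z≤n))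
  ... | u , u∈ | v , v∈ = u , S-complex (opposite v) ⁅ u ⁆ (Principal.∈K (opposite-principal v∈)) (⁅⁆-⊆ (u∈ v∈)) ,
    (λ u∈μ → opposite-∌ u∈μ (u∈ u∈μ)) , elsewhere
    where
    elsewhere : ∀ {G} → Principal S G → G ≢ μ → u ∈ G
    elsewhere prG G≢μ with facet-cases prG
    ... | inj₁ G≡μ = contradiction G≡μ G≢μ
    ... | inj₂ (w , w∈ , refl) = u∈ w∈

  no-common-vertex : ∀ x → ∃[ F ] (Principal S F × x ∉ F)
  no-common-vertex x with x ∈? μ
  ... | yes x∈ = opposite x , opposite-principal x∈ , opposite-∌ x∈
  ... | no x∉  = μ , pr-μ , x∉

minimal⇒nested : {V : Subset n} {S : Complex n} → (∀ {v} → S ⁅ v ⁆ ≡ true → v ∈ V) → ∃[ x ] x ∈ V → IsMinimalNHSphere S → Nested V S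
minimal⇒nested {V = V} {S} vertex (x , x∈V) (inj₁ empty) = record
  { complex   = λ σ τ Sσ τ⊆σ → from⇔ (empty τ) (Empty-unique λ (y , y∈) → ∉⊥ (subst (y ∈_) (to⇔ (empty σ) Sσ) (τ⊆σ y∈)))
  ; nonvoid   = from⇔ (empty ⊥) refl
  ; vertex    = vertex
  -- The only facet of {∅} is empty and omits everything, so any element of the nonempty V serves.
  ; own       = λ prF → x , x∈V , (λ x∈ → ∉⊥ (subst (x ∈_) (is⊥ prF) x∈)) , λ prG G≢F → contradiction (trans (is⊥ prG) (sym (is⊥ prF))) G≢F
  ; no-common = λ y → ⊥ , mkPrincipal (from⇔ (empty ⊥) refl) (λ Sτ _ → sym (to⇔ (empty _) Sτ)) , ∉⊥
  ; thin      = λ prF prG F≢G → contradiction (trans (is⊥ prF) (sym (is⊥ prG))) F≢G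
  }
  where
  is⊥ : ∀ {F} → Principal S F → F ≡ ⊥
  is⊥ prF = to⇔ (empty _) (Principal.∈K prF)
minimal⇒nested {V = V} {S} vertex _ (inj₂ (zero , _ , (_ , complex , u , v , u≢v , eq) , _)) = record
  { complex   = complex
  ; nonvoid   = from⇔ (eq ⊥) (inj₁ ⊥⊆)
  ; vertex    = vertex
  ; own       = own
  ; no-common = no-common
  ; thin      = thin
  }
  where
  Su : S ⁅ u ⁆ ≡ true
  Su = from⇔ (eq _) (inj₁ (λ x → x))
  Sv : S ⁅ v ⁆ ≡ true
  Sv = from⇔ (eq _) (inj₂ (λ x → x))
  v∉u : v ∉ ⁅ u ⁆
  v∉u v∈ = u≢v (sym (x∈⁅y⁆⇒x≡y u v∈))
  u∉v : u ∉ ⁅ v ⁆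
  u∉v u∈ = u≢v (x∈⁅y⁆⇒x≡y v u∈)
  cases : ∀ {F} → Principal S F → F ≡ ⁅ u ⁆ ⊎ F ≡ ⁅ v ⁆
  cases (mkPrincipal SF max) = Sum.map (max Su) (max Sv) (to⇔ (eq _) SF)
  pr-u : Principal S ⁅ u ⁆
  pr-u = mkPrincipal Su λ {τ} Sτ u⊆τ → ⊆-antisym u⊆τ
    ([ (λ τ⊆u → τ⊆u) , (λ τ⊆v → contradiction (τ⊆v (u⊆τ (x∈⁅x⁆ u))) u∉v) ]′ (to⇔ (eq τ) Sτ))
  pr-v : Principal S ⁅ v ⁆
  pr-v = mkPrincipal Sv λ {τ} Sτ v⊆τ → ⊆-antisym v⊆τ
    ([ (λ τ⊆u → contradiction (τ⊆u (v⊆τ (x∈⁅x⁆ v))) v∉u) , (λ τ⊆v → τ⊆v) ]′ (to⇔ (eq τ) Sτ))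
  own : ∀ {F} → Principal S F → ∃[ w ] (w ∈ V × w ∉ F × (∀ {G} → Principal S G → G ≢ F → w ∈ G))
  own prF with cases prF
  ... | inj₁ refl = v , vertex Sv , v∉u , λ prG G≢ → [ (λ e → contradiction e G≢) , (λ { refl → x∈⁅x⁆ v }) ]′ (cases prG)
  ... | inj₂ refl = u , vertex Su , u∉v , λ prG G≢ → [ (λ { refl → x∈⁅x⁆ u }) , (λ e → contradiction e G≢) ]′ (cases prG)
  no-common : ∀ x → ∃[ F ] (Principal S F × x ∉ F)
  no-common x with x ∈? ⁅ u ⁆
  ... | no x∉ = ⁅ u ⁆ , pr-u , x∉
  ... | yes x∈ = ⁅ v ⁆ , pr-v , λ x∈v → u≢v (trans (sym (x∈⁅y⁆⇒x≡y u x∈)) (x∈⁅y⁆⇒x≡y v x∈v))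
  thin : ∀ {F G} → Principal S F → Principal S G → F ≢ G → Thin⊎ F G
  thin prF _ _ with cases prF
  ... | inj₁ refl = inj₁ (u , λ y∈ _ → x∈⁅y⁆⇒x≡y u y∈)
  ... | inj₂ refl = inj₁ (v , λ y∈ _ → x∈⁅y⁆⇒x≡y v y∈)
minimal⇒nested {V = V} {S} vertex _ (inj₂ (suc d , k , sphere , minimal)) = go (sphere-decomposition sphere)
  where
  complex : IsComplex S
  complex = manifold-complex (suc d) (proj₁ sphere)
  go : ∃[ B ] ∃[ L ] (Decomposition k S B L × Collapsible B) → Nested V S
  go (B , L , D , coll) = record
    { complex   = complex
    ; nonvoid   = Decomposition.B⊆S D (Decomposition.B-⊥ D)
    ; vertex    = vertex
    ; own       = λ prF → let (v , Sv , rest) = own-vertex prF in v , vertex Sv , rest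
    ; no-common = no-common-vertex
    ; thin      = λ prF prG F≢G → link-thin (suc d) (inj₂ (inj₁ (inj₂ (k , sphere)))) (record { prF = prF ; prG = prG ; F≢G = F≢G ; only = only prF prG })
    }
    where
    open MinimalSphere complex D coll minimal
    -- The vertex that only a third facet H omits lies in F ∩ G, so H cannot contain F ∩ G.
    only : ∀ {F G} → Principal S F → Principal S G → ∀ {H} → Principal S H → F ∩ G ⊆ H → H ≡ F ⊎ H ≡ G
    only {F} {G} prF prG {H} prH ⊆H with H ≟ₛ F | H ≟ₛ G
    ... | yes e | _     = inj₁ e
    ... | no _  | yes e = inj₂ e
    ... | no H≢F | no H≢G = let (v , _ , v∉H , v∈) = own-vertex prH in
      contradiction (⊆H (x∈p∩q⁺ (v∈ prF (H≢F ∘ sym) , v∈ prG (H≢G ∘ sym)))) v∉H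

-- Words

-- A word is a linear order on the vertices with a label on each; the facets of the complex
-- it encodes are indexed by the letters x labelled `true`: the facet of x omits exactly x
-- and the letters labelled `false` that precede x.
Word : ℕ → Set
Word n = List (Bool × Fin n)

-- Containment in some facet, decided letter by letter: at a marked letter one may stop by omitting
-- it or go on, while unmarked letters passed on the way must be omitted. That σ uses letters only
-- is left to `Encodes`.
Face : Word n → Subset n → Set
Face []                σ = Void
Face ((true , x) ∷ w)  σ = x ∉ σ ⊎ Face w σ
Face ((false , x) ∷ w) σ = x ∉ σ × Face w σ

letters : Word n → Subset n
letters []            = ⊥
letters ((_ , x) ∷ w) = ⁅ x ⁆ ∪ letters w

Distinct : Word n → Set
Distinct []            = Unit
Distinct ((_ , x) ∷ w) = x ∉ letters w × Distinct w

Encodes : Word n → Complex n → Set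
Encodes w K = ∀ σ → K σ ≡ true ⇔ (σ ⊆ letters w × Face w σ)

deleted : List (Fin n) → Word n
deleted = map (false ,_)

Face-deleted⁺ : (ys : List (Fin n)) {w : Word n} {σ : Subset n} → (∀ {y} → y ∈ˡ ys → y ∉ σ) → Face w σ → Face (deleted ys ++ w) σ
Face-deleted⁺ []       _   f = f
Face-deleted⁺ (y ∷ ys) out f = out (here refl) , Face-deleted⁺ ys (out ∘ there) f

Face-deleted⁻ : (ys : List (Fin n)) {w : Word n} {σ : Subset n} → Face (deleted ys ++ w) σ → (∀ {y} → y ∈ˡ ys → y ∉ σ) × Face w σ
Face-deleted⁻ []       f = (λ ()) , f
Face-deleted⁻ (y ∷ ys) (y∉ , f) = let (out , g) = Face-deleted⁻ ys f in (λ { (here refl) → y∉ ; (there y∈) → out y∈ }) , g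

letters-deleted⁻ : (ys : List (Fin n)) {w : Word n} {x : Fin n} → x ∈ letters (deleted ys ++ w) → x ∈ˡ ys ⊎ x ∈ letters w
letters-deleted⁻ []       x∈ = inj₂ x∈
letters-deleted⁻ (y ∷ ys) x∈ with ∈-insert⁻ x∈
... | inj₁ x≡y = inj₁ (here x≡y)
... | inj₂ x∈′ = Sum.map₁ there (letters-deleted⁻ ys x∈′)

letters-deleted⁺ˡ : (ys : List (Fin n)) {w : Word n} {x : Fin n} → x ∈ˡ ys → x ∈ letters (deleted ys ++ w)
letters-deleted⁺ˡ (y ∷ ys) (here refl) = x∈insert
letters-deleted⁺ˡ (y ∷ ys) (there x∈)  = ∈-insert⁺ (letters-deleted⁺ˡ ys x∈)

letters-deleted⁺ʳ : (ys : List (Fin n)) {w : Word n} {x : Fin n} → x ∈ letters w → x ∈ letters (deleted ys ++ w)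
letters-deleted⁺ʳ []       x∈ = x∈
letters-deleted⁺ʳ (y ∷ ys) x∈ = ∈-insert⁺ (letters-deleted⁺ʳ ys x∈)

Distinct-deleted : {ys : List (Fin n)} {w : Word n} → Unique ys → (∀ {y} → y ∈ˡ ys → y ∉ letters w) → Distinct w → Distinct (deleted ys ++ w)
Distinct-deleted [] _ d = d
Distinct-deleted {ys = y ∷ ys} (y∉ ∷ u) out d =
  (λ y∈ → [ (λ y∈ys → All.lookup y∉ y∈ys refl) , out (here refl) ]′ (letters-deleted⁻ ys y∈)) , Distinct-deleted u (out ∘ there) d

module NestedWord {V : Subset n} {S : Complex n} (nested : Nested V S) where
  open Nested nested

  pick : ∀ F → Dec (principal S F ≡ true) → Fin n
  pick F (yes pr) = proj₁ (own (principal⁻ pr))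
  pick F (no _)   = proj₁ (own (proj₂ (proj₂ (principal-above S nonvoid))))

  abstract
    ownv : Subset n → Fin n
    ownv F = pick F (principal S F Boolₚ.≟ true)

    ownv-spec : ∀ {F} → Principal S F → ownv F ∈ V × ownv F ∉ F × (∀ {G} → Principal S G → G ≢ F → ownv F ∈ G)
    ownv-spec {F} prF = go (principal S F Boolₚ.≟ true)
      where
      go : (d : Dec (principal S F ≡ true)) → pick F d ∈ V × pick F d ∉ F × (∀ {G} → Principal S G → G ≢ F → pick F d ∈ G)
      go (yes pr) = proj₂ (own (principal⁻ pr))
      go (no ¬pr) = contradiction (principal⁺ prF) ¬pr

  -- In the word these become the unmarked letters preceding `ownv F`.
  rest : Subset n → Subset n
  rest F = (V ∩ ∁ F) ∖ ownv F

  rest⁺ : ∀ {F y} → y ∈ V → y ∉ F → y ≢ ownv F → y ∈ rest F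
  rest⁺ y∈V y∉F y≢ = ∈-∖⁺ (x∈p∩q⁺ (y∈V , x∉p⇒x∈∁p y∉F)) y≢

  rest⁻ : ∀ {F y} → y ∈ rest F → y ∈ V × y ∉ F × y ≢ ownv F
  rest⁻ {F} y∈ = let (y∈′ , y≢) = ∈-∖⁻ {p = V ∩ ∁ F} y∈ ; (y∈V , y∈∁F) = x∈p∩q⁻ V (∁ F) y∈′ in y∈V , x∈∁p⇒x∉p y∈∁F , y≢

  -- `ownv G` lies in F but not in G, so it is the single element of F - G. Every other letter that
  -- G omits is then omitted by F, and it is not `ownv F`, which G contains.
  thin⇒rest : ∀ {F G} → Principal S F → Principal S G → F ≢ G → Thin F G → rest G ⊆ rest F
  thin⇒rest {F} {G} prF prG F≢G (x , only) {y} y∈ =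
    let (y∈V , y∉G , y≢) = rest⁻ y∈
        (_ , v∉G , v∈) = ownv-spec prG
        (_ , _ , u∈) = ownv-spec prF
    in rest⁺ y∈V (λ y∈F → y≢ (trans (only y∈F y∉G) (sym (only (v∈ prF F≢G) v∉G)))) (λ { refl → y∉G (u∈ prG (F≢G ∘ sym)) })

  rest-total : ∀ {F G} → Principal S F → Principal S G → rest F ⊆ rest G ⊎ rest G ⊆ rest F
  rest-total {F} {G} prF prG with F ≟ₛ G
  ... | yes refl = inj₁ (λ x → x)
  ... | no F≢G with thin prF prG F≢G
  ... | inj₁ t = inj₂ (thin⇒rest prF prG F≢G t)
  ... | inj₂ t = inj₁ (thin⇒rest prG prF (F≢G ∘ sym) t)

  _≼_ : Subset n → Subset n → Set
  F ≼ G = rest F ⊆ rest G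

  record Sorted (Fs : List (Subset n)) : Set where
    field
      ordered  : AllPairs _≼_ Fs
      unique   : Unique Fs
      allprinc : All (Principal S) Fs

  below : ∀ {F G H Fs} → G ≼ F → All (G ≼_) Fs → H ≡ F ⊎ H ∈ˡ Fs → G ≼ H
  below G≼F o (inj₁ refl) x∈ = G≼F x∈
  below G≼F o (inj₂ H∈)   x∈ = All.lookup o H∈ x∈

  insertF : ∀ {F Fs} → Principal S F → (∀ {G} → G ∈ˡ Fs → G ≢ F) → Sorted Fs → ∃[ Gs ] (Sorted Gs × (∀ {G} → G ∈ˡ Gs → G ≡ F ⊎ G ∈ˡ Fs) × F ∈ˡ Gs × (∀ {G} → G ∈ˡ Fs → G ∈ˡ Gs))
  insertF {F} {[]} prF _ _ = F ∷ [] , record { ordered = [] ∷ [] ; unique = [] ∷ [] ; allprinc = prF ∷ [] } , (λ { (here e) → inj₁ e }) , here refl , λ ()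
  insertF {F} {G ∷ Fs} prF new record { ordered = o ∷ os ; unique = u ∷ us ; allprinc = prG ∷ prs } with rest-total prF prG
  ... | inj₁ F≼G = F ∷ G ∷ Fs , record
      { ordered = ((λ {x} → F≼G {x}) ∷ All.map (λ G≼H {x} x∈ → G≼H {x} (F≼G x∈)) o) ∷ o ∷ os
      ; unique = All.tabulate (λ G∈ e → new G∈ (sym e)) ∷ u ∷ us ; allprinc = prF ∷ prG ∷ prs } ,
      (λ { (here e) → inj₁ e ; (there G∈) → inj₂ G∈ }) , here refl , there
  ... | inj₂ G≼F with insertF {F} {Fs} prF (new ∘ there) record { ordered = os ; unique = us ; allprinc = prs }
  ... | Gs , record { ordered = os′ ; unique = us′ ; allprinc = prs′ } , back , F∈ , sub = G ∷ Gs , record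
      { ordered = All.tabulate (λ H∈ {x} → below G≼F o (back H∈) {x}) ∷ os′
      ; unique = All.tabulate (λ H∈ → [ (λ { refl → new (here refl) }) , All.lookup u ]′ (back H∈)) ∷ us′
      ; allprinc = prG ∷ prs′ } ,
      (λ { (here e) → inj₂ (here e) ; (there H∈) → Sum.map₂ there (back H∈) }) , there F∈ , λ { (here e) → here e ; (there H∈) → there (sub H∈) }

  sortF : ∀ Fs → Unique Fs → All (Principal S) Fs → ∃[ Gs ] (Sorted Gs × (∀ {G} → G ∈ˡ Fs → G ∈ˡ Gs) × (∀ {G} → G ∈ˡ Gs → G ∈ˡ Fs))
  sortF [] _ _ = [] , record { ordered = [] ; unique = [] ; allprinc = [] } , (λ ()) , (λ ())
  sortF (F ∷ Fs) (F∉ ∷ u) (prF ∷ prs) with sortF Fs u prs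
  ... | Gs , s , sub , back with insertF prF (λ G∈ e → All.lookup F∉ (back G∈) (sym e)) s
  ... | Hs , s′ , back′ , F∈ , sub′ = Hs , s′ , (λ { (here refl) → F∈ ; (there G∈) → sub′ (sub G∈) }) ,
    λ H∈ → [ (λ e → here e) , there ∘ back ]′ (back′ H∈)

  new : Subset n → Subset n → List (Fin n)
  new R F = elements (rest F ∩ ∁ R)

  new⁻ : ∀ {R F y} → y ∈ˡ new R F → y ∈ rest F × y ∉ R
  new⁻ {R} {F} y∈ = let (a , b) = x∈p∩q⁻ (rest F) (∁ R) (∈-elements⁻ (rest F ∩ ∁ R) y∈) in a , x∈∁p⇒x∉p b

  new⁺ : ∀ {R F y} → y ∈ rest F → y ∉ R → y ∈ˡ new R F
  new⁺ y∈ y∉ = ∈-elements⁺ (x∈p∩q⁺ (y∈ , x∉p⇒x∈∁p y∉))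

  -- `R` holds the unmarked letters already written. Along the chain of rests each facet has to add
  -- only its new ones before its marked letter.
  word : Subset n → List (Subset n) → Word n
  word R []       = []
  word R (F ∷ Fs) = deleted (new R F) ++ (true , ownv F) ∷ word (rest F) Fs

  -- σ may meet `R` here, since those letters are tested by the part of the word already passed; for
  -- `R` = ⊥ the condition is σ ⊆ F, for σ inside V.
  Avoids : Subset n → Subset n → Subset n → Set
  Avoids R σ F = (∀ {y} → y ∈ σ → y ∈ rest F → y ∈ R) × ownv F ∉ σ

  word-face⁺ : ∀ {R Fs σ} → AllPairs _≼_ Fs → All (λ F → R ⊆ rest F) Fs → ∃[ F ] (F ∈ˡ Fs × Avoids R σ F) → Face (word R Fs) σ
  word-face⁺ {R} {F ∷ Fs} (o ∷ os) (R⊆ ∷ _) (_ , here refl , av , v∉) =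
    Face-deleted⁺ (new R F) (λ y∈ y∈σ → let (y∈r , y∉R) = new⁻ {R} {F} y∈ in y∉R (av y∈σ y∈r)) (inj₁ v∉)
  word-face⁺ {R} {F ∷ Fs} (o ∷ os) (R⊆ ∷ _) (G , there G∈ , av , v∉) =
    Face-deleted⁺ (new R F) (λ y∈ y∈σ → let (y∈r , y∉R) = new⁻ {R} {F} y∈ in y∉R (av y∈σ (All.lookup o G∈ y∈r)))
      (inj₂ (word-face⁺ os o (G , G∈ , (λ y∈ y∈r → R⊆ (av y∈ y∈r)) , v∉)))

  word-face⁻ : ∀ {R Fs σ} → AllPairs _≼_ Fs → All (λ F → R ⊆ rest F) Fs → Face (word R Fs) σ → ∃[ F ] (F ∈ˡ Fs × Avoids R σ F)
  word-face⁻ {R} {F ∷ Fs} {σ} (o ∷ os) (R⊆ ∷ _) f with Face-deleted⁻ (new R F) f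
  ... | out , inj₁ v∉ = F , here refl , stay , v∉
    where
    stay : ∀ {y} → y ∈ σ → y ∈ rest F → y ∈ R
    stay {y} y∈ y∈r = decidable-stable (y ∈? R) (λ y∉R → out (new⁺ {R} {F} y∈r y∉R) y∈)
  ... | out , inj₂ g with word-face⁻ os o g
  ... | G , G∈ , av , v∉ = G , there G∈ , (λ {y} y∈ y∈r → decidable-stable (y ∈? R) (λ y∉R → out (new⁺ {R} {F} (av y∈ y∈r) y∉R) y∈)) , v∉

  word-letters⁻ : ∀ {R Fs x} → AllPairs _≼_ Fs → All (λ F → R ⊆ rest F) Fs → x ∈ letters (word R Fs) → ∃[ F ] (F ∈ˡ Fs × (x ≡ ownv F ⊎ (x ∈ rest F × x ∉ R)))
  word-letters⁻ {R} {[]} _ _ x∈ = contradiction x∈ ∉⊥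
  word-letters⁻ {R} {F ∷ Fs} (o ∷ os) (R⊆ ∷ _) x∈ with letters-deleted⁻ (new R F) x∈
  ... | inj₁ x∈new = F , here refl , inj₂ (new⁻ {R} {F} x∈new)
  ... | inj₂ x∈′ with ∈-insert⁻ x∈′
  ... | inj₁ e = F , here refl , inj₁ e
  ... | inj₂ x∈″ with word-letters⁻ os o x∈″
  ... | G , G∈ , inj₁ e = G , there G∈ , inj₁ e
  ... | G , G∈ , inj₂ (x∈r , x∉) = G , there G∈ , inj₂ (x∈r , x∉ ∘ R⊆)

  word-letters⁺ : ∀ {R Fs x} → ∃[ F ] (F ∈ˡ Fs × (x ≡ ownv F ⊎ (x ∈ rest F × x ∉ R))) → x ∈ letters (word R Fs)
  word-letters⁺ {R} {F ∷ Fs} (_ , here refl , inj₁ refl) = letters-deleted⁺ʳ (new R F) x∈insert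
  word-letters⁺ {R} {F ∷ Fs} (_ , here refl , inj₂ (x∈r , x∉R)) = letters-deleted⁺ˡ (new R F) (new⁺ {R} {F} x∈r x∉R)
  word-letters⁺ {R} {F ∷ Fs} (G , there G∈ , inj₁ refl) = letters-deleted⁺ʳ (new R F) (∈-insert⁺ (word-letters⁺ {rest F} {Fs} (G , G∈ , inj₁ refl)))
  word-letters⁺ {R} {F ∷ Fs} {x} (G , there G∈ , inj₂ (x∈r , x∉R)) with x ∈? rest F
  ... | yes x∈F = letters-deleted⁺ˡ (new R F) (new⁺ {R} {F} x∈F x∉R)
  ... | no x∉F  = letters-deleted⁺ʳ (new R F) (∈-insert⁺ (word-letters⁺ {rest F} {Fs} (G , G∈ , inj₂ (x∈r , x∉F))))

  ownv∉rest : ∀ {F G} → Principal S F → Principal S G → ownv F ∉ rest G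
  ownv∉rest {F} {G} prF prG v∈ with F ≟ₛ G
  ... | yes refl = proj₂ (proj₂ (rest⁻ v∈)) refl
  ... | no F≢G   = proj₁ (proj₂ (rest⁻ v∈)) (proj₂ (proj₂ (ownv-spec prF)) prG (F≢G ∘ sym))

  ownv-injective : ∀ {F G} → Principal S F → Principal S G → ownv F ≡ ownv G → F ≡ G
  ownv-injective {F} {G} prF prG e = decidable-stable (F ≟ₛ G) (λ F≢G →
    proj₁ (proj₂ (ownv-spec prG)) (subst (_∈ G) e (proj₂ (proj₂ (ownv-spec prF)) prG (F≢G ∘ sym))))

  word-distinct : ∀ {R Fs} → AllPairs _≼_ Fs → Unique Fs → All (Principal S) Fs → Distinct (word R Fs)
  word-distinct {R} {[]} _ _ _ = tt
  word-distinct {R} {F ∷ Fs} (o ∷ os) (u ∷ us) (prF ∷ prs) =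
    Distinct-deleted (elements-unique (rest F ∩ ∁ R)) old (ownv∉ , word-distinct os us prs)
    where
    ownv∉ : ownv F ∉ letters (word (rest F) Fs)
    ownv∉ x∈ with word-letters⁻ os o x∈
    ... | G , G∈ , inj₁ e = All.lookup u G∈ (ownv-injective prF (All.lookup prs G∈) e)
    ... | G , G∈ , inj₂ (x∈r , _) = ownv∉rest prF (All.lookup prs G∈) x∈r
    old : ∀ {y} → y ∈ˡ new R F → y ∉ letters ((true , ownv F) ∷ word (rest F) Fs)
    old y∈ y∈′ with new⁻ {R} {F} y∈ | ∈-insert⁻ y∈′
    ... | y∈r , _ | inj₁ refl = ownv∉rest prF prF y∈r
    ... | y∈r , _ | inj₂ y∈w with word-letters⁻ os o y∈w
    ... | G , G∈ , inj₁ refl = ownv∉rest (All.lookup prs G∈) prF y∈r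
    ... | G , G∈ , inj₂ (_ , y∉) = y∉ y∈r

  word-last : ∀ R F Fs → ∃[ u ] ∃[ z ] (word R (F ∷ Fs) ≡ u ∷ʳ (true , z))
  word-last R F [] = deleted (new R F) , ownv F , refl
  word-last R F (G ∷ Fs) with word-last (rest F) G Fs
  ... | u , z , e = deleted (new R F) ++ (true , ownv F) ∷ u , z ,
    trans (cong (λ w → deleted (new R F) ++ (true , ownv F) ∷ w) e) (sym (Listₚ.++-assoc (deleted (new R F)) ((true , ownv F) ∷ u) ((true , z) ∷ [])))

  abstract
    sorted : ∃[ Gs ] (Sorted Gs × (∀ {G} → G ∈ˡ members (principal S) → G ∈ˡ Gs) × (∀ {G} → G ∈ˡ Gs → G ∈ˡ members (principal S)))
    sorted = sortF (members (principal S)) (members-unique (principal S)) (All.tabulate (principal⁻ ∘ ∈-members⁻ (principal S)))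

  nested-word : ∃[ u ] ∃[ z ] (Encodes (u ∷ʳ (true , z)) S × Distinct (u ∷ʳ (true , z)) × (∀ x → x ∈ letters (u ∷ʳ (true , z)) ⇔ x ∈ V))
  nested-word with sorted
  ... | Gs , record { ordered = os ; unique = us ; allprinc = prs } , complete , _ = finish Gs refl
    where
    w = word ⊥ Gs
    ⊥⊆s : All (λ F → ⊥ ⊆ rest F) Gs
    ⊥⊆s = All.tabulate (λ _ {x} x∈ → contradiction x∈ (∉⊥ {x = x}))
    in-Gs : ∀ {F} → Principal S F → F ∈ˡ Gs
    in-Gs prF = complete (∈-members⁺ (principal S) (principal⁺ prF))
    letters-V : ∀ x → x ∈ letters w ⇔ x ∈ V
    letters-V x = mk⇔ to from
      where
      to : x ∈ letters w → x ∈ V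
      to x∈ with word-letters⁻ os ⊥⊆s x∈
      ... | F , F∈ , inj₁ refl = proj₁ (ownv-spec (All.lookup prs F∈))
      ... | F , F∈ , inj₂ (x∈r , _) = proj₁ (rest⁻ x∈r)
      from : x ∈ V → x ∈ letters w
      from x∈V with no-common x
      ... | F , prF , x∉F with x Fin.≟ ownv F
      ... | yes e = word-letters⁺ {⊥} {Gs} (F , in-Gs prF , inj₁ e)
      ... | no x≢ = word-letters⁺ {⊥} {Gs} (F , in-Gs prF , inj₂ (rest⁺ x∈V x∉F x≢ , ∉⊥))
    encodes : Encodes w S
    encodes σ = mk⇔ to from
      where
      in-V : S σ ≡ true → ∀ {y} → y ∈ σ → y ∈ V
      in-V Sσ {y} y∈ = vertex (complex σ ⁅ y ⁆ Sσ (⁅⁆-⊆ y∈))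
      to : S σ ≡ true → σ ⊆ letters w × Face w σ
      to Sσ = let (F , σ⊆F , prF) = principal-above S Sσ in
        (λ {y} y∈ → from⇔ (letters-V y) (in-V Sσ y∈)) ,
        word-face⁺ os ⊥⊆s (F , in-Gs prF , (λ y∈ y∈r → contradiction (σ⊆F y∈) (proj₁ (proj₂ (rest⁻ y∈r)))) , λ v∈ → proj₁ (proj₂ (ownv-spec prF)) (σ⊆F v∈))
      from : σ ⊆ letters w × Face w σ → S σ ≡ true
      from (σ⊆ , f) with word-face⁻ os ⊥⊆s f
      ... | F , F∈ , av , v∉ = complex F σ (Principal.∈K (All.lookup prs F∈)) (λ {y} y∈ → decidable-stable (y ∈? F) (λ y∉F →
        ∉⊥ (av y∈ (rest⁺ (to⇔ (letters-V y) (σ⊆ y∈)) y∉F (λ { refl → v∉ y∈ })))))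
    finish : ∀ Gs′ → Gs′ ≡ Gs → ∃[ u ] ∃[ z ] (Encodes (u ∷ʳ (true , z)) S × Distinct (u ∷ʳ (true , z)) × (∀ x → x ∈ letters (u ∷ʳ (true , z)) ⇔ x ∈ V))
    finish [] refl = contradiction (in-Gs (proj₂ (proj₂ (principal-above S nonvoid)))) λ ()
    finish (F ∷ Fs) refl with word-last ⊥ F Fs
    ... | u , z , e = u , z , subst (λ w → Encodes w S) e encodes , subst Distinct e (word-distinct {⊥} os us prs) ,
      subst (λ w → ∀ x → x ∈ letters w ⇔ x ∈ V) e letters-V

-- Alexander duality of words

flipped : Word n → Word n
flipped = map (λ (b , x) → not b , x)

letters-flipped : (u : Word n) (z : Fin n) → letters (flipped u ∷ʳ (true , z)) ≡ letters (u ∷ʳ (true , z))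
letters-flipped []            z = refl
letters-flipped ((_ , x) ∷ u) z = cong (⁅ x ⁆ ∪_) (letters-flipped u z)

Distinct-flipped : (u : Word n) (z : Fin n) → Distinct (u ∷ʳ (true , z)) → Distinct (flipped u ∷ʳ (true , z))
Distinct-flipped []            z d = d
Distinct-flipped ((_ , x) ∷ u) z (x∉ , d) = (λ x∈ → x∉ (subst (x ∈_) (letters-flipped u z) x∈)) , Distinct-flipped u z d

-- Alexander duality flips all labels but the last: complementing σ negates each condition
-- x ∉ σ, which exchanges the two clauses of `Face`.
module _ {σ σ′ : Subset n} where

  Face-dual⁺ : (u : Word n) (z : Fin n) → (∀ {x} → x ∈ letters (u ∷ʳ (true , z)) → x ∈ σ′ → x ∉ σ) →
               ¬ Face (u ∷ʳ (true , z)) σ′ → Face (flipped u ∷ʳ (true , z)) σ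
  -- A marked last letter is self-dual: the failure of z ∉ σ′ is z ∉ σ, and the empty tail offers no
  -- alternative on either side.
  Face-dual⁺ [] z compl ¬f = inj₁ (compl x∈insert (decidable-stable (z ∈? σ′) (¬f ∘ inj₁)))
  Face-dual⁺ ((true , x) ∷ u) z compl ¬f = compl x∈insert (decidable-stable (x ∈? σ′) (¬f ∘ inj₁)) , Face-dual⁺ u z (compl ∘ ∈-insert⁺) (¬f ∘ inj₂)
  Face-dual⁺ ((false , x) ∷ u) z compl ¬f with x ∈? σ′
  ... | yes x∈ = inj₁ (compl x∈insert x∈)
  ... | no x∉  = inj₂ (Face-dual⁺ u z (compl ∘ ∈-insert⁺) (λ f → ¬f (x∉ , f)))

  Face-dual⁻ : (u : Word n) (z : Fin n) → (∀ {x} → x ∈ letters (u ∷ʳ (true , z)) → x ∉ σ → x ∈ σ′) →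
               Face (flipped u ∷ʳ (true , z)) σ → ¬ Face (u ∷ʳ (true , z)) σ′
  Face-dual⁻ [] z compl (inj₁ z∉) (inj₁ z∉′) = z∉′ (compl x∈insert z∉)
  Face-dual⁻ ((true , x) ∷ u) z compl (x∉ , _) (inj₁ x∉′) = x∉′ (compl x∈insert x∉)
  Face-dual⁻ ((true , x) ∷ u) z compl (_ , f) (inj₂ g) = Face-dual⁻ u z (compl ∘ ∈-insert⁺) f g
  Face-dual⁻ ((false , x) ∷ u) z compl (inj₁ x∉) (x∉′ , _) = x∉′ (compl x∈insert x∉)
  Face-dual⁻ ((false , x) ∷ u) z compl (inj₂ f) (_ , g) = Face-dual⁻ u z (compl ∘ ∈-insert⁺) f g

encodes-dual : {K : Complex n} {V : Subset n} (u : Word n) (z : Fin n) → (∀ x → x ∈ letters (u ∷ʳ (true , z)) ⇔ x ∈ V) →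
               Encodes (u ∷ʳ (true , z)) K → Encodes (flipped u ∷ʳ (true , z)) (dualW K V)
encodes-dual {K = K} {V} u z letters-V enc σ = mk⇔ to from
  where
  w = u ∷ʳ (true , z)
  σ′ = V ∩ ∁ σ
  to : dualW K V σ ≡ true → σ ⊆ letters (flipped u ∷ʳ (true , z)) × Face (flipped u ∷ʳ (true , z)) σ
  to e = let (σ⊆V , ¬K) = ∧⁻ {σ ⊆ᵇ V} e in
    (λ {x} x∈ → subst (x ∈_) (sym (letters-flipped u z)) (from⇔ (letters-V x) (⊆ᵇ⁻ σ⊆V x∈))) ,
    Face-dual⁺ u z (λ _ x∈ → x∈∁p⇒x∉p (proj₂ (x∈p∩q⁻ V (∁ σ) x∈)))
      (λ f → not⁻ ¬K (from⇔ (enc σ′) ((λ {x} x∈ → from⇔ (letters-V x) (proj₁ (x∈p∩q⁻ V (∁ σ) x∈))) , f)))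
  from : σ ⊆ letters (flipped u ∷ʳ (true , z)) × Face (flipped u ∷ʳ (true , z)) σ → dualW K V σ ≡ true
  from (σ⊆ , f) = ∧⁺ (⊆ᵇ⁺ (λ {x} x∈ → to⇔ (letters-V x) (subst (x ∈_) (letters-flipped u z) (σ⊆ x∈))))
    (not⁺ (λ Kσ′ → Face-dual⁻ u z (λ {x} x∈ x∉ → x∈p∩q⁺ (to⇔ (letters-V x) x∈ , x∉p⇒x∈∁p x∉)) f (proj₂ (to⇔ (enc σ′) Kσ′))))

-- From words to NH-balls and NH-spheres

-- With vertices at distinct unit vectors, barycentric coordinates can be read off a point, which
-- settles independence and intersections. This yields both the trivial subdivision of a complex and
-- the comparison of Δ F with a standard simplex.
relabelling-subdivision : {J : Complex n} {K : Complex n′} (e : Fin n → Fin n′) → (∀ {u v} → e u ≡ e v → u ≡ v) → IsComplex J →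
  (∀ σ → J σ ≡ true → ∃[ ρ ] (K ρ ≡ true × (∀ v → v ∈ σ → e v ∈ ρ))) →
  (∀ ρ → K ρ ≡ true → ∃[ σ ] (J σ ≡ true × (∀ {i} → i ∈ ρ → ∃[ v ] (v ∈ σ × e v ≡ i)))) →
  IsSubdivision J (λ v → δ (e v)) K
relabelling-subdivision {n} {n′} {J} {K} e inj complex forth back = complex , independent , carrier , meet , cover
  where
  coordinate : ∀ (μ : Fin n → ℚ) v → sumFin (λ u → μ u *ℚ δ (e u) (e v)) ≡ μ v
  coordinate μ v = trans (sumFin-single v (λ u → μ u *ℚ δ (e u) (e v)) (λ u u≢v → trans (cong (μ u *ℚ_) (δ-diff (u≢v ∘ inj))) (ℚₚ.*-zeroʳ (μ u))))
    (trans (cong (μ v *ℚ_) (δ-same (e v))) (ℚₚ.*-identityʳ (μ v)))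
  independent : ∀ σ → J σ ≡ true → AffinelyIndependent (λ v → δ (e v)) σ
  independent σ _ μ _ _ rel v = trans (sym (coordinate μ v)) (rel (e v))
  carrier : ∀ σ → J σ ≡ true → ∃[ ρ ] (K ρ ≡ true × (∀ v → v ∈ σ → InSimplex ρ (δ (e v))))
  carrier σ Jσ with forth σ Jσ
  ... | ρ , Kρ , into = ρ , Kρ , λ v v∈ → δ-nonneg (e v) , (λ i i∉ → δ-diff {i = e v} {i} (λ { refl → i∉ (into v v∈) })) , sumFin-δ (e v)
  meet : ∀ σ ρ p → J σ ≡ true → J ρ ≡ true → InHull (λ v → δ (e v)) σ p → InHull (λ v → δ (e v)) ρ p → InHull (λ v → δ (e v)) (σ ∩ ρ) p
  meet σ ρ p _ _ (μ , (μ≥0 , μ≡0 , Σμ) , eqμ) (ν , (_ , ν≡0 , _) , eqν) = μ , (μ≥0 , vanish , Σμ) , eqμ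
    where
    vanish : ∀ v → v ∉ σ ∩ ρ → μ v ≡ 0ℚ
    vanish v v∉ with v ∈? σ
    ... | no v∉σ  = μ≡0 v v∉σ
    ... | yes v∈σ = trans (sym (trans (eqμ (e v)) (coordinate μ v))) (trans (trans (eqν (e v)) (coordinate ν v)) (ν≡0 v (λ v∈ρ → v∉ (x∈p∩q⁺ (v∈σ , v∈ρ)))))
  cover : ∀ p → InRealization K p → ∃[ σ ] (J σ ≡ true × InHull (λ v → δ (e v)) σ p)
  cover p (ρ , Kρ , p≥0 , p≡0 , Σp) with back ρ Kρ
  ... | σ , Jσ , onto = σ , Jσ , p ∘ e , (p≥0 ∘ e , vanish , total≡1) , expand
    where
    vanish : ∀ v → v ∉ σ → p (e v) ≡ 0ℚ
    vanish v v∉ = p≡0 (e v) (λ ev∈ → let (u , u∈ , eu≡ev) = onto ev∈ in v∉ (subst (_∈ σ) (inj eu≡ev) u∈))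
    expand : ∀ i → p i ≡ sumFin (λ v → p (e v) *ℚ δ (e v) i)
    expand i with i ∈? ρ
    ... | yes i∈ with onto i∈
    ... | v , _ , refl = sym (coordinate (p ∘ e) v)
    expand i | no i∉ = trans (p≡0 i i∉) (sym (sumFin-0 term))
      where
      term : ∀ v → p (e v) *ℚ δ (e v) i ≡ 0ℚ
      term v with e v Fin.≟ i
      ... | yes refl = trans (ℚₚ.*-identityʳ (p (e v))) (p≡0 (e v) i∉)
      ... | no _     = ℚₚ.*-zeroʳ (p (e v))
    total≡1 : sumFin (p ∘ e) ≡ 1ℚ
    total≡1 = trans (sumFin-cong (λ v → sym (trans (sumFin-*ˡ (p (e v)) (δ (e v))) (trans (cong (p (e v) *ℚ_) (sumFin-δ (e v))) (ℚₚ.*-identityʳ (p (e v)))))))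
      (trans (sumFin-swap (λ v i → p (e v) *ℚ δ (e v) i)) (trans (sym (sumFin-cong expand)) Σp))

identity-subdivision : {K : Complex n} → IsComplex K → IsSubdivision K δ K
identity-subdivision complex = relabelling-subdivision (λ v → v) (λ e → e) complex
  (λ σ Kσ → σ , Kσ , λ v v∈ → v∈) (λ ρ Kρ → ρ , Kρ , λ {i} i∈ → i , i∈ , refl)

enumeration : (F : Subset n) {k : ℕ} → ∣ F ∣ ≡ k →
  Σ (Fin k → Fin n) λ e → (∀ {u v} → e u ≡ e v → u ≡ v) × (∀ v → e v ∈ F) × (∀ {i} → i ∈ F → ∃[ v ] e v ≡ i)
enumeration F refl = enum F , injective F , into F , onto F
  where
  enum : ∀ {n} (F : Subset n) → Fin ∣ F ∣ → Fin n
  enum (true ∷ F)  Fin.zero    = Fin.zero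
  enum (true ∷ F)  (Fin.suc i) = Fin.suc (enum F i)
  enum (false ∷ F) i           = Fin.suc (enum F i)
  injective : ∀ {n} (F : Subset n) {u v} → enum F u ≡ enum F v → u ≡ v
  injective (true ∷ F)  {Fin.zero}  {Fin.zero}  _ = refl
  injective (true ∷ F)  {Fin.suc u} {Fin.suc v} e = cong Fin.suc (injective F (Finₚ.suc-injective e))
  injective (false ∷ F) e = injective F (Finₚ.suc-injective e)
  into : ∀ {n} (F : Subset n) v → enum F v ∈ F
  into (true ∷ F)  Fin.zero    = Vec.here
  into (true ∷ F)  (Fin.suc v) = Vec.there (into F v)
  into (false ∷ F) v           = Vec.there (into F v)
  onto : ∀ {n} (F : Subset n) {i} → i ∈ F → ∃[ v ] enum F v ≡ i
  onto (true ∷ F) Vec.here = Fin.zero , refl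
  onto (true ∷ F) (Vec.there i∈) = let (v , e) = onto F i∈ in Fin.suc v , cong Fin.suc e
  onto (false ∷ F) (Vec.there i∈) = let (v , e) = onto F i∈ in v , cong Fin.suc e

Δ-complex : (F : Subset n) → IsComplex (Δ F)
Δ-complex F σ τ Δσ τ⊆σ = ⊆ᵇ⁺ (λ x∈ → ⊆ᵇ⁻ Δσ (τ⊆σ x∈))

simplex-combBall : ∀ {k} (F : Subset n) → ∣ F ∣ ≡ suc k → IsCombBall k (Δ F)
simplex-combBall {k = k} F size with enumeration F size
... | e , injective , into , onto = Δ-complex F , suc k , Simplex k , (λ v → δ (e v)) , δ ,
  relabelling-subdivision e injective (λ _ _ _ _ → refl)
    (λ σ _ → F , ⊆ᵇ⁺ {σ = F} (λ x → x) , λ v _ → into v)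
    (λ ρ Δρ → ⊤ , refl , λ i∈ → let (v , eq) = onto (⊆ᵇ⁻ Δρ i∈) in v , ∈⊤ , eq) ,
  identity-subdivision (λ _ _ _ _ → refl)

∂-simplex⁺ : ∀ {k} {F : Subset n} → ∣ F ∣ ≡ suc k → ∀ {σ x} → σ ⊆ F → x ∈ F → x ∉ σ → ∂ k (Δ F) σ ≡ true
∂-simplex⁺ {k = k} {F} size {σ} {x} σ⊆F x∈F x∉σ = ∂⁺ {k = k} {Δ F} (F ∖ x) (⊆-∖ σ⊆F x∉σ) (⊆ᵇ⁺ (∖-⊆ {p = F})) (ℕₚ.suc-injective (trans (sym (∣∖∣ x∈F)) size))
  (countB-enumerated (coface k (Δ F) (F ∖ x)) {F ∷ []} ([] ∷ []) (λ { (here refl) → coface⁺ {k = k} {Δ F} (⊆ᵇ⁺ {σ = F} (λ x → x)) size (∖-⊆ {p = F}) })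
    (λ c → let (Δρ , ∣ρ∣ , _) = coface⁻ {k = k} {Δ F} c in here (⊆∧∣≡∣⇒≡ (⊆ᵇ⁻ Δρ) (ℕₚ.≤-reflexive (trans size (sym ∣ρ∣))))))

∂-simplex⁻ : ∀ {k} {F : Subset n} → ∣ F ∣ ≡ suc k → ∀ {σ} → ∂ k (Δ F) σ ≡ true → σ ⊆ F × ∃[ x ] (x ∈ F × x ∉ σ)
∂-simplex⁻ {k = k} {F} size {σ} e =
  let (ρ , σ⊆ρ , Δρ , ∣ρ∣ , _) = ∂⁻ {k = k} {Δ F} {σ} e
      (x , x∈ , x∉) = ⊈-witness {p = F} {ρ} (λ F⊆ρ → ℕₚ.<⇒≱ (ℕₚ.n<1+n k) (subst (_≤ k) size (subst (∣ F ∣ ≤_) ∣ρ∣ (p⊆q⇒∣p∣≤∣q∣ F⊆ρ))))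
  in (λ y∈ → ⊆ᵇ⁻ Δρ (σ⊆ρ y∈)) , x , x∈ , λ x∈σ → x∉ (σ⊆ρ x∈σ)

-- The complex D + x * K, for K ⊆ D and D without the vertex x. With K void only D remains.
attach : Fin n → Complex n → Complex n → Complex n
attach x D K ρ = if ⌊ x ∈? ρ ⌋ then K (ρ ∖ x) else D ρ

module _ {x : Fin n} {D K : Complex n} {ρ : Subset n} where

  attach-∈ : x ∈ ρ → attach x D K ρ ≡ K (ρ ∖ x)
  attach-∈ x∈ with x ∈? ρ
  ... | yes _ = refl
  ... | no x∉ = contradiction x∈ x∉

  attach-∉ : x ∉ ρ → attach x D K ρ ≡ D ρ
  attach-∉ x∉ with x ∈? ρ
  ... | yes x∈ = contradiction x∈ x∉
  ... | no _   = refl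

Avoiding : Fin n → Complex n → Set
Avoiding x K = ∀ ρ → K ρ ≡ true → x ∉ ρ

collapse-⊆ : {K K′ : Complex n} → ElemCollapse K K′ → ∀ ρ → K′ ρ ≡ true → K ρ ≡ true
collapse-⊆ (σ , τ , _ , _ , _ , _ , eq) ρ K′ρ = proj₁ (∧⁻ (trans (sym (eq ρ)) K′ρ))

-- Everything above x + σ contains x and so lies in the cone; hence x + σ is free as soon as σ is
-- free in K, and D is untouched.
attach-collapse : {x : Fin n} {D K K′ : Complex n} → Avoiding x K → ElemCollapse K K′ → ElemCollapse (attach x D K) (attach x D K′)
attach-collapse {n} {x} {D} {K} {K′} avoid (σ , τ , Kσ , Kτ , σ⊂τ , free , eq) =
  ⁅ x ⁆ ∪ σ , ⁅ x ⁆ ∪ τ , lifted {K} x∉σ Kσ , lifted {K} x∉τ Kτ , ⊂ᵇ⁺ σ̂⊆τ̂ (λ e → σ≢τ (trans (sym (∖-insert x∉σ)) (trans (cong (_∖ x) e) (∖-insert x∉τ)))) , free′ , eq′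
  where
  x∉σ = avoid σ Kσ
  x∉τ = avoid τ Kτ
  σ⊆τ : σ ⊆ τ
  σ⊆τ = proj₁ (⊂ᵇ⁻ {σ = σ} {τ} σ⊂τ)
  σ≢τ : σ ≢ τ
  σ≢τ = proj₂ (⊂ᵇ⁻ {σ = σ} {τ} σ⊂τ)
  σ̂⊆τ̂ : ⁅ x ⁆ ∪ σ ⊆ ⁅ x ⁆ ∪ τ
  σ̂⊆τ̂ = insert-⊆ x∈insert (λ y∈ → ∈-insert⁺ (σ⊆τ y∈))
  lifted : ∀ {K : Complex n} {ρ} → x ∉ ρ → K ρ ≡ true → attach x D K (⁅ x ⁆ ∪ ρ) ≡ true
  lifted {K} {ρ} x∉ Kρ = trans (attach-∈ {D = D} {K} x∈insert) (trans (cong K (∖-insert x∉)) Kρ)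
  free′ : ∀ ρ → attach x D K ρ ≡ true → ⁅ x ⁆ ∪ σ ⊆ ρ → ρ ≡ ⁅ x ⁆ ∪ σ ⊎ ρ ≡ ⁅ x ⁆ ∪ τ
  free′ ρ Aρ σ̂⊆ρ = let x∈ρ = σ̂⊆ρ x∈insert in
    Sum.map (λ e → trans (sym (insert-∖ x∈ρ)) (cong (⁅ x ⁆ ∪_) e)) (λ e → trans (sym (insert-∖ x∈ρ)) (cong (⁅ x ⁆ ∪_) e))
      (free (ρ ∖ x) (trans (sym (attach-∈ {D = D} {K} x∈ρ)) Aρ) (⊆-∖ (λ y∈ → σ̂⊆ρ (∈-insert⁺ y∈)) x∉σ))
  same : ∀ {ρ π} → x ∈ ρ → x ∉ π → ((ρ ∖ x) ==ₛ π) ≡ (ρ ==ₛ (⁅ x ⁆ ∪ π))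
  same {ρ} {π} x∈ρ x∉π = ≡true-ext
    (λ e → ==ₛ⁺ (trans (sym (insert-∖ x∈ρ)) (cong (⁅ x ⁆ ∪_) (==ₛ⁻ {σ = ρ ∖ x} {π} e))))
    (λ e → ==ₛ⁺ (trans (cong (_∖ x) (==ₛ⁻ {σ = ρ} {⁅ x ⁆ ∪ π} e)) (∖-insert x∉π)))
  differ : ∀ {ρ π} → x ∉ ρ → (ρ ==ₛ (⁅ x ⁆ ∪ π)) ≡ false
  differ {ρ} {π} x∉ρ = Boolₚ.¬-not (λ e → x∉ρ (subst (x ∈_) (sym (==ₛ⁻ {σ = ρ} e)) x∈insert))
  eq′ : ∀ ρ → attach x D K′ ρ ≡ (attach x D K ρ ∧ not (ρ ==ₛ (⁅ x ⁆ ∪ σ)) ∧ not (ρ ==ₛ (⁅ x ⁆ ∪ τ)))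
  eq′ ρ = go (x ∈? ρ)
    where
    go : Dec (x ∈ ρ) → attach x D K′ ρ ≡ (attach x D K ρ ∧ not (ρ ==ₛ (⁅ x ⁆ ∪ σ)) ∧ not (ρ ==ₛ (⁅ x ⁆ ∪ τ)))
    go (yes x∈ρ) = trans (attach-∈ {D = D} {K′} x∈ρ) (trans (eq (ρ ∖ x))
      (cong₂ _∧_ (sym (attach-∈ {D = D} {K} x∈ρ)) (cong₂ (λ a b → not a ∧ not b) (same x∈ρ x∉σ) (same x∈ρ x∉τ))))
    go (no x∉ρ) = trans (attach-∉ {D = D} {K′} x∉ρ) (sym (trans
      (cong₂ _∧_ (attach-∉ {D = D} {K} x∉ρ) (cong₂ (λ a b → not a ∧ not b) (differ {ρ} {σ} x∉ρ) (differ {ρ} {τ} x∉ρ))) (∧-identityʳ (D ρ))))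

void : Complex n
void _ = false

-- Collapsing the last vertex onto the void complex becomes, after coning with x, the collapse
-- of the free edge from x to that vertex.
attach-collapses : {x : Fin n} {D K : Complex n} → Avoiding x K → CollapsesToVertex K → Star ElemCollapse (attach x D K) (attach x D void)
attach-collapses {x = x} {D} avoid (K′ , steps , z , eq) = go avoid steps
  where
  last : ElemCollapse K′ void
  last = ⊥ , ⁅ z ⁆ , from⇔ (eq ⊥) ⊥⊆ , from⇔ (eq ⁅ z ⁆) (λ y → y) , ⊂ᵇ⁺ ⊥⊆ (λ e → ∉⊥ (subst (z ∈_) (sym e) (x∈⁅x⁆ z))) , cases ,
    λ ρ → sym (Boolₚ.¬-not (λ e → let (Kρ , e′) = ∧⁻ {K′ ρ} e ; (a , b) = ∧⁻ {not (ρ ==ₛ ⊥)} e′ in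
      [ not⁻ a ∘ ==ₛ⁺ , not⁻ b ∘ ==ₛ⁺ ]′ (cases ρ Kρ ⊥⊆)))
    where
    cases : ∀ ρ → K′ ρ ≡ true → ⊥ ⊆ ρ → ρ ≡ ⊥ ⊎ ρ ≡ ⁅ z ⁆
    cases ρ Kρ _ with z ∈? ρ
    ... | yes z∈ = inj₂ (⊆-antisym (to⇔ (eq ρ) Kρ) (⁅⁆-⊆ z∈))
    ... | no z∉  = inj₁ (Empty-unique λ (y , y∈) → z∉ (subst (_∈ ρ) (x∈⁅y⁆⇒x≡y z (to⇔ (eq ρ) Kρ y∈)) y∈))
  go : ∀ {K} → Avoiding x K → Star ElemCollapse K K′ → Star ElemCollapse (attach x D K) (attach x D void)
  go av ε        = attach-collapse av last ◅ ε
  go av (c ◅ cs) = attach-collapse av c ◅ go (λ ρ K′ρ → av ρ (collapse-⊆ c ρ K′ρ)) cs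

collapses-resp : {K K′ : Complex n} → K ≈ₖ K′ → CollapsesToVertex K → CollapsesToVertex K′
collapses-resp {K = K} {K′} K≈K′ (_ , ε , z , eq) = K′ , ε , z , λ σ → mk⇔ (to σ) (from σ)
  where
  to : ∀ σ → K′ σ ≡ true → σ ⊆ ⁅ z ⁆
  to σ K′σ = to⇔ (eq σ) (trans (K≈K′ σ) K′σ)
  from : ∀ σ → σ ⊆ ⁅ z ⁆ → K′ σ ≡ true
  from σ σ⊆ = trans (sym (K≈K′ σ)) (from⇔ (eq σ) σ⊆)
collapses-resp {K = K} {K′} K≈K′ (P , (σ , τ , Kσ , Kτ , σ⊂τ , free , eq) ◅ cs , pt) = P ,
  (σ , τ , trans (sym (K≈K′ σ)) Kσ , trans (sym (K≈K′ τ)) Kτ , σ⊂τ , (λ ρ K′ρ → free ρ (trans (K≈K′ ρ) K′ρ)) ,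
    λ ρ → trans (eq ρ) (cong (_∧ _) (K≈K′ ρ))) ◅ cs , pt

collapses-trans : {K K′ : Complex n} → Star ElemCollapse K K′ → CollapsesToVertex K′ → CollapsesToVertex K
collapses-trans cs (P , ds , pt) = P , cs ◅◅ ds , pt

-- The simplex on x and W is `attach x (Δ W) (Δ W)`. As Δ W collapses by induction, the whole
-- collapses to Δ W and then to a vertex. The word serves as an enumeration of the vertices.
simplex-collapses : (b : Bool) (x : Fin n) (w : Word n) → Distinct ((b , x) ∷ w) → {K : Complex n} → (∀ σ → K σ ≡ true ⇔ σ ⊆ letters ((b , x) ∷ w)) → CollapsesToVertex K
simplex-collapses b x [] _ {K} eq = K , ε , x , λ σ → mk⇔ (to σ) (from σ)
  where
  to : ∀ σ → K σ ≡ true → σ ⊆ ⁅ x ⁆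
  to σ Kσ {y} y∈ = subst (y ∈_) (∪-identityʳ ⁅ x ⁆) (to⇔ (eq σ) Kσ y∈)
  from : ∀ σ → σ ⊆ ⁅ x ⁆ → K σ ≡ true
  from σ σ⊆ = from⇔ (eq σ) (λ {y} y∈ → subst (y ∈_) (sym (∪-identityʳ ⁅ x ⁆)) (σ⊆ y∈))
simplex-collapses b x w@((b′ , y) ∷ w′) (x∉ , d) {K} eq =
  collapses-resp pointwise (collapses-trans (attach-collapses avoid (simplex-collapses b′ y w′ d (λ σ → mk⇔ (⊆ᵇ⁻ {σ = σ}) ⊆ᵇ⁺)))
    (simplex-collapses b′ y w′ d bottom))
  where
  base : Complex _
  base = Δ (letters w)
  avoid : Avoiding x base
  avoid ρ Δρ x∈ = x∉ (⊆ᵇ⁻ {σ = ρ} Δρ x∈)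
  bottom : ∀ σ → attach x base void σ ≡ true ⇔ σ ⊆ letters w
  bottom σ with x ∈? σ
  ... | yes x∈ = mk⇔ (λ ()) (λ σ⊆ → contradiction (σ⊆ x∈) x∉)
  ... | no x∉σ = mk⇔ (⊆ᵇ⁻ {σ = σ}) ⊆ᵇ⁺
  pointwise : attach x base base ≈ₖ K
  pointwise σ with x ∈? σ
  ... | yes x∈ = ≡true-ext (λ Δσ → from⇔ (eq σ) (λ {y} y∈ → grow (⊆ᵇ⁻ {σ = σ ∖ x} Δσ) y y∈))
                           (λ Kσ → ⊆ᵇ⁺ (λ {y} y∈ → let (y∈σ , y≢x) = ∈-∖⁻ {p = σ} y∈ in [ (λ e → contradiction e y≢x) , (λ z → z) ]′ (∈-insert⁻ (to⇔ (eq σ) Kσ y∈σ))))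
    where
    grow : σ ∖ x ⊆ letters w → ∀ y → y ∈ σ → y ∈ ⁅ x ⁆ ∪ letters w
    grow ⊆w y y∈ with y Fin.≟ x
    ... | yes refl = x∈insert
    ... | no y≢x   = ∈-insert⁺ (⊆w (∈-∖⁺ y∈ y≢x))
  ... | no x∉σ = ≡true-ext (λ Δσ → from⇔ (eq σ) (λ y∈ → ∈-insert⁺ (⊆ᵇ⁻ {σ = σ} Δσ y∈)))
                           (λ Kσ → ⊆ᵇ⁺ (λ {y} y∈ → [ (λ { refl → contradiction y∈ x∉σ }) , (λ z → z) ]′ (∈-insert⁻ (to⇔ (eq σ) Kσ y∈))))

Face-mono : (w : Word n) {σ τ : Subset n} → (∀ {y} → y ∈ letters w → y ∈ σ → y ∈ τ) → Face w τ → Face w σ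
Face-mono ((true , x) ∷ w)  sub (inj₁ x∉)  = inj₁ (x∉ ∘ sub x∈insert)
Face-mono ((true , x) ∷ w)  sub (inj₂ f)   = inj₂ (Face-mono w (sub ∘ ∈-insert⁺) f)
Face-mono ((false , x) ∷ w) sub (x∉ , f)   = x∉ ∘ sub x∈insert , Face-mono w (sub ∘ ∈-insert⁺) f

face? : (w : Word n) (σ : Subset n) → Dec (Face w σ)
face? []                σ = no (λ ())
face? ((true , x) ∷ w)  σ = ¬? (x ∈? σ) ⊎-dec face? w σ
face? ((false , x) ∷ w) σ = ¬? (x ∈? σ) ×-dec face? w σ

⟦_⟧ : Word n → Complex n
⟦ w ⟧ σ = ⌊ (σ ⊆? letters w) ×-dec face? w σ ⌋

encodes-⟦⟧ : (w : Word n) → Encodes w ⟦ w ⟧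
encodes-⟦⟧ w σ = mk⇔ (⌊⌋⁻ ((σ ⊆? letters w) ×-dec face? w σ)) (⌊⌋⁺ ((σ ⊆? letters w) ×-dec face? w σ))

encodes-complex : (w : Word n) {K : Complex n} → Encodes w K → IsComplex K
encodes-complex w enc σ τ Kσ τ⊆σ = let (σ⊆ , f) = to⇔ (enc σ) Kσ in from⇔ (enc τ) ((λ y∈ → σ⊆ (τ⊆σ y∈)) , Face-mono w (λ _ → τ⊆σ) f)

⊆-letters-tail : {b : Bool} {x : Fin n} {w : Word n} {σ : Subset n} → σ ⊆ letters ((b , x) ∷ w) → x ∉ σ → σ ⊆ letters w
⊆-letters-tail σ⊆ x∉σ y∈ = [ (λ { refl → contradiction y∈ x∉σ }) , (λ y∈w → y∈w) ]′ (∈-insert⁻ (σ⊆ y∈))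

∖-letters-tail : {b : Bool} {x : Fin n} {w : Word n} {σ : Subset n} → σ ⊆ letters ((b , x) ∷ w) → σ ∖ x ⊆ letters w
∖-letters-tail {σ = σ} σ⊆ y∈ = let (y∈σ , y≢x) = ∈-∖⁻ {p = σ} y∈ in [ (λ e → contradiction e y≢x) , (λ y∈w → y∈w) ]′ (∈-insert⁻ (σ⊆ y∈σ))

-- A leading unmarked letter precedes every mark, so every facet omits it.
encodes-tail : {x : Fin n} {w : Word n} {K : Complex n} → Distinct ((false , x) ∷ w) → Encodes ((false , x) ∷ w) K → Encodes w K
encodes-tail {x = x} {w} {K} (x∉ , _) enc σ = mk⇔ to from
  where
  to : K σ ≡ true → σ ⊆ letters w × Face w σ
  to Kσ = let (σ⊆ , x∉σ , f) = to⇔ (enc σ) Kσ in ⊆-letters-tail {b = false} {x} {w} σ⊆ x∉σ , f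
  from : σ ⊆ letters w × Face w σ → K σ ≡ true
  from (σ⊆ , f) = from⇔ (enc σ) ((λ y∈ → ∈-insert⁺ (σ⊆ y∈)) , (λ x∈ → x∉ (σ⊆ x∈)) , f)

data Unmarked {n} : Word n → Set where
  []  : Unmarked []
  _∷_ : ∀ x {w} → Unmarked w → Unmarked ((false , x) ∷ w)

-- There is a marked letter, but the last letter is unmarked; `base` starts at the last mark.
data Ball {n} : Word n → Set where
  base : ∀ x y {w} → Unmarked w → Ball ((true , x) ∷ (false , y) ∷ w)
  cons : ∀ b x {w} → Ball w → Ball ((b , x) ∷ w)

-- The last letter is marked. The index counts the other marks and exceeds the homotopy dimension by
-- 1, so that {∅} has index 0.
data Sphere {n} : ℕ → Word n → Set where
  base  : ∀ x → Sphere zero ((true , x) ∷ [])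
  mark  : ∀ x {j w} → Sphere j w → Sphere (suc j) ((true , x) ∷ w)
  skip  : ∀ x {j w} → Sphere j w → Sphere j ((false , x) ∷ w)

classify : (w : Word n) → Unmarked w ⊎ Ball w ⊎ ∃[ j ] Sphere j w
classify [] = inj₁ []
classify ((b , x) ∷ w) with b | classify w
... | true  | inj₁ []       = inj₂ (inj₂ (zero , base x))
... | true  | inj₁ (y ∷ u)  = inj₂ (inj₁ (base x y u))
... | false | inj₁ u        = inj₁ (x ∷ u)
... | b     | inj₂ (inj₁ s) = inj₂ (inj₁ (cons b x s))
... | true  | inj₂ (inj₂ (j , s)) = inj₂ (inj₂ (suc j , mark x s))
... | false | inj₂ (inj₂ (j , s)) = inj₂ (inj₂ (j , skip x s))

unmarked-face : {w : Word n} {σ : Subset n} → Unmarked w → ¬ Face w σ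
unmarked-face (x ∷ u) (_ , f) = unmarked-face u f

-- A leading marked x makes the complex `attach x D ⟦ w ⟧` with D the full simplex on the later
-- letters, so a collapse of the tail leaves D. At the last mark the complex is itself the simplex
-- on the letters that follow.
ball-collapses : {w : Word n} → Ball w → Distinct w → {K : Complex n} → Encodes w K → CollapsesToVertex K
ball-collapses (base x y {w} u) (x∉ , d) {K} enc = simplex-collapses false y w d λ σ → mk⇔ (to σ) (from σ)
  where
  to : ∀ σ → K σ ≡ true → σ ⊆ letters ((false , y) ∷ w)
  to σ Kσ with to⇔ (enc σ) Kσ
  ... | σ⊆ , inj₁ x∉σ = ⊆-letters-tail {b = true} {x} {(false , y) ∷ w} σ⊆ x∉σ
  ... | σ⊆ , inj₂ (_ , f) = contradiction f (unmarked-face u)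
  from : ∀ σ → σ ⊆ letters ((false , y) ∷ w) → K σ ≡ true
  from σ σ⊆ = from⇔ (enc σ) ((λ z∈ → ∈-insert⁺ (σ⊆ z∈)) , inj₁ (λ x∈ → x∉ (σ⊆ x∈)))
ball-collapses (cons false x s) d@(_ , d′) enc = ball-collapses s d′ (encodes-tail d enc)
ball-collapses (cons true x {w} s) (x∉ , d) {K} enc = collapses-resp pointwise (collapses-trans
    (attach-collapses {D = D} avoid (ball-collapses s d (encodes-⟦⟧ w))) (bottom w refl s))
  where
  D : Complex _
  D = Δ (letters w)
  avoid : Avoiding x ⟦ w ⟧
  avoid ρ Kρ x∈ = x∉ (proj₁ (to⇔ (encodes-⟦⟧ w ρ) Kρ) x∈)
  below : ∀ σ → attach x D void σ ≡ true ⇔ σ ⊆ letters w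
  below σ with x ∈? σ
  ... | yes x∈ = mk⇔ (λ ()) (λ σ⊆ → contradiction (σ⊆ x∈) x∉)
  ... | no x∉σ = mk⇔ (⊆ᵇ⁻ {σ = σ}) ⊆ᵇ⁺
  bottom : ∀ w′ → w′ ≡ w → Ball w′ → CollapsesToVertex (attach x D void)
  bottom ((b , y) ∷ w′) refl _ = simplex-collapses b y w′ d below
  pointwise : attach x D ⟦ w ⟧ ≈ₖ K
  pointwise σ = go (x ∈? σ)
    where
    grow : σ ∖ x ⊆ letters w → σ ⊆ ⁅ x ⁆ ∪ letters w
    grow ⊆w {y} y∈ with y Fin.≟ x
    ... | yes refl = x∈insert
    ... | no y≢x   = ∈-insert⁺ (⊆w (∈-∖⁺ y∈ y≢x))
    go : Dec (x ∈ σ) → attach x D ⟦ w ⟧ σ ≡ K σ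
    go (yes x∈) = trans (attach-∈ {D = D} {⟦ w ⟧} x∈) (≡true-ext
      (λ e → let (σ⊆ , f) = to⇔ (encodes-⟦⟧ w (σ ∖ x)) e in from⇔ (enc σ) (grow σ⊆ , inj₂ (Face-mono w (λ y∈w y∈σ → ∈-∖⁺ y∈σ (λ { refl → x∉ y∈w })) f)))
      (λ Kσ → let (σ⊆ , f) = to⇔ (enc σ) Kσ in from⇔ (encodes-⟦⟧ w (σ ∖ x)) (∖-letters-tail {b = true} {x} {w} σ⊆ , [ (λ x∉σ → contradiction x∈ x∉σ) , Face-mono w (λ _ → ∖-⊆ {p = σ}) ]′ f)))
    go (no x∉σ) = trans (attach-∉ {D = D} {⟦ w ⟧} x∉σ) (≡true-ext
      (λ e → from⇔ (enc σ) ((λ y∈ → ∈-insert⁺ (⊆ᵇ⁻ {σ = σ} e y∈)) , inj₁ x∉σ))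
      (λ Kσ → ⊆ᵇ⁺ (⊆-letters-tail {b = true} {x} {w} (proj₁ (to⇔ (enc σ) Kσ)) x∉σ)))

-- The facet of the first marked letter omits fewest letters and keeps all that follow, so for a
-- word with a mark this is the dimension plus 1.
top : Word n → ℕ
top []                = 0
top ((true , _) ∷ w)  = length w
top ((false , _) ∷ w) = top w

∣letters∣ : (w : Word n) → Distinct w → ∣ letters w ∣ ≡ length w
∣letters∣ {n} [] _ = ∣⊥∣≡0 n
∣letters∣ ((b , x) ∷ w) (x∉ , d) = trans (∣insert∣ x∉) (cong suc (∣letters∣ w d))

top<length : (w : Word n) {σ : Subset n} → Face w σ → top w < length w
top<length ((true , _) ∷ w)  _       = ℕₚ.n<1+n (length w)
top<length ((false , _) ∷ w) (_ , f) = ℕₚ.m<n⇒m<1+n (top<length w f)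

face-size : (w : Word n) → Distinct w → ∀ {σ} → σ ⊆ letters w → Face w σ → ∣ σ ∣ ≤ top w
face-size ((false , x) ∷ w) (_ , d) σ⊆ (x∉σ , f) = face-size w d (⊆-letters-tail {b = false} {x} {w} σ⊆ x∉σ) f
face-size ((true , x) ∷ w) (_ , d) {σ} σ⊆ f with x ∈? σ
... | no x∉σ = subst (∣ σ ∣ ≤_) (∣letters∣ w d) (p⊆q⇒∣p∣≤∣q∣ (⊆-letters-tail {b = true} {x} {w} σ⊆ x∉σ))
face-size ((true , x) ∷ w) (_ , d) {σ} σ⊆ (inj₁ x∉σ) | yes x∈σ = contradiction x∈σ x∉σ
face-size ((true , x) ∷ w) (_ , d) {σ} σ⊆ (inj₂ f) | yes x∈σ = subst (_≤ length w) (sym (∣∖∣ x∈σ))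
  (ℕₚ.≤-trans (s≤s (face-size w d (∖-letters-tail {b = true} {x} {w} σ⊆) (Face-mono w (λ _ → ∖-⊆ {p = σ}) f))) (top<length w f))

top-face : (w : Word n) → Distinct w → ¬ Unmarked w → ∃[ σ ] (σ ⊆ letters w × Face w σ × ∣ σ ∣ ≡ top w)
top-face [] _ m = contradiction [] m
top-face ((true , x) ∷ w) (x∉ , d) _ = letters w , ∈-insert⁺ , inj₁ x∉ , ∣letters∣ w d
top-face ((false , x) ∷ w) (x∉ , d) m = let (σ , σ⊆ , f , size) = top-face w d (m ∘ (x ∷_)) in
  σ , (λ y∈ → ∈-insert⁺ (σ⊆ y∈)) , ((λ x∈ → x∉ (σ⊆ x∈)) , f) , size

encodes-dim : (w : Word n) {K : Complex n} → Distinct w → Encodes w K → ¬ Unmarked w → ∀ {d} → top w ≡ suc d → HasDim K d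
encodes-dim w {K} dist enc m t =
  (let (σ , σ⊆ , f , size) = top-face w dist m in σ , from⇔ (enc σ) ((λ y∈ → σ⊆ y∈) , f) , trans size t) ,
  λ σ Kσ → let (σ⊆ , f) = to⇔ (enc σ) Kσ in subst (∣ σ ∣ ≤_) t (face-size w dist σ⊆ f)

-- Links of word complexes

demoted : Word n → Word n
demoted = map (λ (_ , x) → false , x)

-- A marked v is omitted by its own facet alone, so only that facet is lost. An unmarked v is
-- omitted by the facets of all later marks, so these disappear while their letters stay as vertices
-- of the earlier facets.
linkWord : Fin n → Word n → Word n
linkWord v [] = []
linkWord v ((b , x) ∷ w) with x Fin.≟ v | b
... | yes _ | true  = w
... | yes _ | false = demoted w
... | no _  | b     = (b , x) ∷ linkWord v w

letters-demoted : (w : Word n) → letters (demoted w) ≡ letters w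
letters-demoted []            = refl
letters-demoted ((_ , x) ∷ w) = cong (⁅ x ⁆ ∪_) (letters-demoted w)

demoted-unmarked : (w : Word n) → Unmarked (demoted w)
demoted-unmarked []            = []
demoted-unmarked ((_ , x) ∷ w) = x ∷ demoted-unmarked w

Distinct-demoted : (w : Word n) → Distinct w → Distinct (demoted w)
Distinct-demoted []            _        = tt
Distinct-demoted ((_ , x) ∷ w) (x∉ , d) = (λ x∈ → x∉ (subst (x ∈_) (letters-demoted w) x∈)) , Distinct-demoted w d

letters-link : (v : Fin n) (w : Word n) → Distinct w → v ∈ letters w → letters (linkWord v w) ≡ letters w ∖ v
letters-link v [] _ v∈ = contradiction v∈ ∉⊥
letters-link v ((b , x) ∷ w) (x∉ , d) v∈ with x Fin.≟ v | b
... | yes refl | true  = sym (∖-insert x∉)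
... | yes refl | false = trans (letters-demoted w) (sym (∖-insert x∉))
... | no x≢v | b = trans (cong (⁅ x ⁆ ∪_) (letters-link v w d v∈w)) (⊆-antisym to from)
  where
  v∈w : v ∈ letters w
  v∈w = ∈-insert-≢ x≢v v∈
  to : ⁅ x ⁆ ∪ (letters w ∖ v) ⊆ (⁅ x ⁆ ∪ letters w) ∖ v
  to y∈ = [ (λ { refl → ∈-∖⁺ x∈insert x≢v }) , (λ y∈′ → let (y∈w , y≢v) = ∈-∖⁻ {p = letters w} y∈′ in ∈-∖⁺ (∈-insert⁺ y∈w) y≢v) ]′ (∈-insert⁻ y∈)
  from : (⁅ x ⁆ ∪ letters w) ∖ v ⊆ ⁅ x ⁆ ∪ (letters w ∖ v)
  from y∈ = let (y∈′ , y≢v) = ∈-∖⁻ {p = ⁅ x ⁆ ∪ letters w} y∈ in [ (λ { refl → x∈insert }) , (λ y∈w → ∈-insert⁺ (∈-∖⁺ y∈w y≢v)) ]′ (∈-insert⁻ y∈′)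

Distinct-link : (v : Fin n) (w : Word n) → Distinct w → v ∈ letters w → Distinct (linkWord v w)
Distinct-link v [] _ _ = tt
Distinct-link v ((b , x) ∷ w) (x∉ , d) v∈ with x Fin.≟ v | b
... | yes refl | true  = d
... | yes refl | false = Distinct-demoted w d
... | no x≢v | b = (λ x∈ → x∉ (∖-⊆ {p = letters w} (subst (x ∈_) (letters-link v w d v∈w) x∈))) , Distinct-link v w d v∈w
  where
  v∈w : v ∈ letters w
  v∈w = ∈-insert-≢ x≢v v∈

length-link : (v : Fin n) (w : Word n) → v ∈ letters w → suc (length (linkWord v w)) ≡ length w
length-link v [] v∈ = contradiction v∈ ∉⊥
length-link v ((b , x) ∷ w) v∈ with x Fin.≟ v | b
... | yes refl | true  = refl
... | yes refl | false = cong suc (Listₚ.length-map _ w)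
... | no x≢v | b = cong suc (length-link v w (∈-insert-≢ x≢v v∈))

face-link⁺ : (v : Fin n) (w : Word n) → Distinct w → v ∈ letters w → ∀ {ρ} → v ∉ ρ → Face w (⁅ v ⁆ ∪ ρ) → Face (linkWord v w) ρ
face-link⁺ v [] _ v∈ _ f = f
face-link⁺ v ((b , x) ∷ w) (x∉ , d) v∈ v∉ f with x Fin.≟ v | b | f
... | yes refl | true  | inj₁ v∉′ = contradiction x∈insert v∉′
... | yes refl | true  | inj₂ g = Face-mono w (λ _ → ∈-insert⁺) g
... | yes refl | false | (v∉′ , _) = contradiction x∈insert v∉′
... | no x≢v | true | inj₁ x∉′ = inj₁ (x∉′ ∘ ∈-insert⁺)
... | no x≢v | true | inj₂ g = inj₂ (face-link⁺ v w d (∈-insert-≢ x≢v v∈) v∉ g)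
... | no x≢v | false | (x∉′ , g) = x∉′ ∘ ∈-insert⁺ , face-link⁺ v w d (∈-insert-≢ x≢v v∈) v∉ g

face-link⁻ : (v : Fin n) (w : Word n) → Distinct w → v ∈ letters w → ∀ {ρ} → v ∉ ρ → Face (linkWord v w) ρ → Face w (⁅ v ⁆ ∪ ρ)
face-link⁻ v [] _ v∈ _ f = f
face-link⁻ v ((b , x) ∷ w) (x∉ , d) v∈ v∉ f with x Fin.≟ v | b | f
... | yes refl | true  | g = inj₂ (Face-mono w (λ y∈w y∈ → [ (λ { refl → contradiction y∈w x∉ }) , (λ y → y) ]′ (∈-insert⁻ y∈)) g)
... | yes refl | false | g = contradiction g (unmarked-face (demoted-unmarked w))
... | no x≢v | true | inj₁ x∉′ = inj₁ (λ x∈ → [ x≢v , x∉′ ]′ (∈-insert⁻ x∈))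
... | no x≢v | true | inj₂ g = inj₂ (face-link⁻ v w d (∈-insert-≢ x≢v v∈) v∉ g)
... | no x≢v | false | (x∉′ , g) = (λ x∈ → [ x≢v , x∉′ ]′ (∈-insert⁻ x∈)) , face-link⁻ v w d (∈-insert-≢ x≢v v∈) v∉ g

encodes-link : (v : Fin n) (w : Word n) {K : Complex n} → Distinct w → v ∈ letters w → Encodes w K → Encodes (linkWord v w) (lk v K)
encodes-link v w {K} d v∈ enc ρ = mk⇔ to from
  where
  eq = letters-link v w d v∈
  to : lk v K ρ ≡ true → ρ ⊆ letters (linkWord v w) × Face (linkWord v w) ρ
  to e = let (Kρ , v∉) = lk⁻ {K = K} {v} {ρ} e ; (⊆w , f) = to⇔ (enc (⁅ v ⁆ ∪ ρ)) Kρ in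
    (λ {y} y∈ → subst (y ∈_) (sym eq) (∈-∖⁺ (⊆w (∈-insert⁺ y∈)) (λ { refl → v∉ y∈ }))) , face-link⁺ v w d v∈ v∉ f
  from : ρ ⊆ letters (linkWord v w) × Face (linkWord v w) ρ → lk v K ρ ≡ true
  from (⊆w , f) = lk⁺ {K = K} {v} {ρ} (from⇔ (enc (⁅ v ⁆ ∪ ρ)) (insert-⊆ v∈ (λ {y} y∈ → ∖-⊆ {p = letters w} (subst (y ∈_) eq (⊆w y∈))) , face-link⁻ v w d v∈ v∉ f)) v∉
    where
    v∉ : v ∉ ρ
    v∉ v∈ρ = x∉p∖x {p = letters w} (subst (v ∈_) eq (⊆w v∈ρ))

-- Facets of word complexes

facets : Word n → List (Subset n)
facets []                = []
facets ((true , x) ∷ w)  = letters w ∷ map (⁅ x ⁆ ∪_) (facets w)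
facets ((false , _) ∷ w) = facets w

facets-⊆ : (w : Word n) → ∀ {F} → F ∈ˡ facets w → F ⊆ letters w
facets-⊆ ((true , x) ∷ w) (here refl) y∈ = ∈-insert⁺ y∈
facets-⊆ ((true , x) ∷ w) (there F∈) {y} y∈ with ∈-map⁻ (⁅ x ⁆ ∪_) F∈
... | F , F∈w , refl = insert-⊆ x∈insert (λ z∈ → ∈-insert⁺ (facets-⊆ w F∈w z∈)) y∈
facets-⊆ ((false , x) ∷ w) F∈ y∈ = ∈-insert⁺ (facets-⊆ w F∈ y∈)

face⇒facet : (w : Word n) → ∀ {σ} → σ ⊆ letters w → Face w σ → ∃[ F ] (F ∈ˡ facets w × σ ⊆ F)
face⇒facet ((false , x) ∷ w) σ⊆ (x∉σ , f) = face⇒facet w (⊆-letters-tail {b = false} {x} {w} σ⊆ x∉σ) f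
face⇒facet ((true , x) ∷ w) σ⊆ (inj₁ x∉σ) = letters w , here refl , ⊆-letters-tail {b = true} {x} {w} σ⊆ x∉σ
face⇒facet ((true , x) ∷ w) {σ} σ⊆ (inj₂ f) with face⇒facet w (∖-letters-tail {b = true} {x} {w} σ⊆) (Face-mono w (λ _ → ∖-⊆ {p = σ}) f)
... | F , F∈ , ⊆F = ⁅ x ⁆ ∪ F , there (∈-map⁺ (⁅ x ⁆ ∪_) F∈) , grow
  where
  grow : σ ⊆ ⁅ x ⁆ ∪ F
  grow {y} y∈ with y Fin.≟ x
  ... | yes refl = x∈insert
  ... | no y≢x   = ∈-insert⁺ (⊆F (∈-∖⁺ y∈ y≢x))

facet-face : (w : Word n) → Distinct w → ∀ {F} → F ∈ˡ facets w → Face w F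
facet-face ((true , x) ∷ w) (x∉ , d) (here refl) = inj₁ x∉
facet-face ((true , x) ∷ w) (x∉ , d) (there F∈) with ∈-map⁻ (⁅ x ⁆ ∪_) F∈
... | F , F∈w , refl = inj₂ (Face-mono w (λ y∈w y∈ → [ (λ { refl → contradiction y∈w x∉ }) , (λ y → y) ]′ (∈-insert⁻ y∈)) (facet-face w d F∈w))
facet-face ((false , x) ∷ w) (x∉ , d) F∈ = (λ x∈ → x∉ (facets-⊆ w F∈ x∈)) , facet-face w d F∈

face-misses : (w : Word n) {σ : Subset n} → Face w σ → ∃[ y ] (y ∈ letters w × y ∉ σ)
face-misses ((true , x) ∷ w)  (inj₁ x∉) = x , x∈insert , x∉
face-misses ((true , x) ∷ w)  (inj₂ f)  = let (y , y∈ , y∉) = face-misses w f in y , ∈-insert⁺ y∈ , y∉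
face-misses ((false , x) ∷ w) (x∉ , _)  = x , x∈insert , x∉

insert-⊆⁻ : {x : Fin n} {F G : Subset n} → x ∉ F → F ⊆ ⁅ x ⁆ ∪ G → F ⊆ G
insert-⊆⁻ x∉ F⊆ y∈ = [ (λ { refl → contradiction y∈ x∉ }) , (λ z → z) ]′ (∈-insert⁻ (F⊆ y∈))

facets-antichain : (w : Word n) → Distinct w → ∀ {F G} → F ∈ˡ facets w → G ∈ˡ facets w → F ⊆ G → F ≡ G
facets-antichain ((false , x) ∷ w) (_ , d) F∈ G∈ F⊆G = facets-antichain w d F∈ G∈ F⊆G
facets-antichain ((true , x) ∷ w) (x∉ , d) (here refl) (here refl) _ = refl
facets-antichain ((true , x) ∷ w) (x∉ , d) (here refl) (there G∈) F⊆G with ∈-map⁻ (⁅ x ⁆ ∪_) G∈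
... | G , G∈w , refl = let (y , y∈ , y∉) = face-misses w (facet-face w d G∈w) in contradiction (insert-⊆⁻ x∉ F⊆G y∈) y∉
facets-antichain ((true , x) ∷ w) (x∉ , d) (there F∈) (here refl) F⊆G with ∈-map⁻ (⁅ x ⁆ ∪_) F∈
... | F , F∈w , refl = contradiction (F⊆G x∈insert) x∉
facets-antichain ((true , x) ∷ w) (x∉ , d) (there F∈) (there G∈) F⊆G with ∈-map⁻ (⁅ x ⁆ ∪_) F∈ | ∈-map⁻ (⁅ x ⁆ ∪_) G∈
... | F , F∈w , refl | G , G∈w , refl = cong (⁅ x ⁆ ∪_) (facets-antichain w d F∈w G∈w (insert-⊆⁻ (λ x∈ → x∉ (facets-⊆ w F∈w x∈)) (λ y∈ → F⊆G (∈-insert⁺ y∈))))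

facets-unique : (w : Word n) → Distinct w → Unique (facets w)
facets-unique [] _ = []
facets-unique ((false , x) ∷ w) (_ , d) = facets-unique w d
facets-unique ((true , x) ∷ w) (x∉ , d) = All.tabulate (λ F∈ → head (∈-map⁻ (⁅ x ⁆ ∪_) F∈)) ∷ inserted (facets-unique w d) (λ F∈ x∈ → x∉ (facets-⊆ w F∈ x∈))
  where
  head : ∀ {G} → ∃[ F ] (F ∈ˡ facets w × G ≡ ⁅ x ⁆ ∪ F) → letters w ≢ G
  head (F , _ , refl) e = x∉ (subst (x ∈_) (sym e) x∈insert)
  inserted : ∀ {Fs} → Unique Fs → (∀ {F} → F ∈ˡ Fs → x ∉ F) → Unique (map (⁅ x ⁆ ∪_) Fs)
  inserted [] _ = []
  inserted {F ∷ Fs} (F∉ ∷ u) out = All.tabulate (λ G∈ → distinct (∈-map⁻ (⁅ x ⁆ ∪_) G∈)) ∷ inserted u (out ∘ there)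
    where
    distinct : ∀ {H} → ∃[ G ] (G ∈ˡ Fs × H ≡ ⁅ x ⁆ ∪ G) → ⁅ x ⁆ ∪ F ≢ H
    distinct (G , G∈ , refl) e = All.lookup F∉ G∈ (trans (sym (∖-insert (out (here refl)))) (trans (cong (_∖ x) e) (∖-insert (out (there G∈)))))

module _ (w : Word n) (d : Distinct w) {K : Complex n} (enc : Encodes w K) where

  facet-in : ∀ {F} → F ∈ˡ facets w → K F ≡ true
  facet-in {F} F∈ = from⇔ (enc F) (facets-⊆ w F∈ , facet-face w d F∈)

  facet-above : ∀ {σ} → K σ ≡ true → ∃[ F ] (F ∈ˡ facets w × σ ⊆ F)
  facet-above {σ} Kσ = let (σ⊆ , f) = to⇔ (enc σ) Kσ in face⇒facet w σ⊆ f

  facet-principal : ∀ {F} → F ∈ˡ facets w → principal K F ≡ true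
  facet-principal {F} F∈ = principal⁺ (mkPrincipal (facet-in F∈) λ {τ} Kτ F⊆τ →
    let (G , G∈ , τ⊆G) = facet-above Kτ
        F≡G = facets-antichain w d F∈ G∈ (λ y∈ → τ⊆G (F⊆τ y∈))
    in ⊆-antisym F⊆τ (λ {y} y∈ → subst (y ∈_) (sym F≡G) (τ⊆G y∈)))

  principal-facet : ∀ {F} → principal K F ≡ true → F ∈ˡ facets w
  principal-facet {F} pr = let (mkPrincipal KF max) = principal⁻ {K = K} pr ; (G , G∈ , F⊆G) = facet-above KF in
    subst (_∈ˡ facets w) (sym (max (facet-in G∈) F⊆G)) G∈

  m-facets : m K ≡ length (facets w)
  m-facets = countB-enumerated (principal K) (facets-unique w d) facet-principal principal-facet

sphere-facets : ∀ {j} {w : Word n} → Sphere j w → length (facets w) ≡ suc j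
sphere-facets (base x)   = refl
sphere-facets (mark x {w = w} s) = cong suc (trans (Listₚ.length-map (⁅ x ⁆ ∪_) (facets w)) (sphere-facets s))
sphere-facets (skip x s) = sphere-facets s

-- For a sphere word without its last letter this is the facet of that letter, and the simplex L of
-- the decomposition.
marked : Word n → Subset n
marked []                = ⊥
marked ((true , x) ∷ u)  = ⁅ x ⁆ ∪ marked u
marked ((false , _) ∷ u) = marked u

marked-⊆ : (u : Word n) → marked u ⊆ letters u
marked-⊆ ((true , x) ∷ u)  y∈ = insert-⊆ x∈insert (λ z∈ → ∈-insert⁺ (marked-⊆ u z∈)) y∈
marked-⊆ ((false , x) ∷ u) y∈ = ∈-insert⁺ (marked-⊆ u y∈)
marked-⊆ []                y∈ = y∈

letters-∷ʳ : (u : Word n) {b b′ : Bool} {z : Fin n} → letters (u ∷ʳ (b , z)) ≡ letters (u ∷ʳ (b′ , z))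
letters-∷ʳ []            = refl
letters-∷ʳ ((_ , x) ∷ u) = cong (⁅ x ⁆ ∪_) (letters-∷ʳ u)

letters-init : (u : Word n) {b : Bool} {z : Fin n} → letters u ⊆ letters (u ∷ʳ (b , z))
letters-init []            y∈ = contradiction y∈ ∉⊥
letters-init ((_ , x) ∷ u) y∈ = insert-⊆ x∈insert (λ z∈ → ∈-insert⁺ (letters-init u z∈)) y∈

Distinct-∷ʳ : (u : Word n) {b b′ : Bool} {z : Fin n} → Distinct (u ∷ʳ (b , z)) → Distinct (u ∷ʳ (b′ , z))
Distinct-∷ʳ []            d = d
Distinct-∷ʳ ((_ , x) ∷ u) {b} {b′} (x∉ , d) = (λ x∈ → x∉ (subst (x ∈_) (letters-∷ʳ u {b′} {b}) x∈)) , Distinct-∷ʳ u d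

Distinct-init : (u : Word n) {b : Bool} {z : Fin n} → Distinct (u ∷ʳ (b , z)) → Distinct u
Distinct-init []            _        = tt
Distinct-init ((_ , x) ∷ u) (x∉ , d) = (λ x∈ → x∉ (letters-init u x∈)) , Distinct-init u d

-- Unmarking the last letter costs only its own facet: no other facet depends on that label.
facets-∷ʳ⁺ : (u : Word n) {z : Fin n} {F : Subset n} → F ∈ˡ facets (u ∷ʳ (false , z)) ⊎ F ≡ marked u → F ∈ˡ facets (u ∷ʳ (true , z))
facets-∷ʳ⁺ [] (inj₂ refl) = here refl
facets-∷ʳ⁺ ((false , x) ∷ u) F∈ = facets-∷ʳ⁺ u F∈
facets-∷ʳ⁺ ((true , x) ∷ u) (inj₁ (here refl)) = here (letters-∷ʳ u)
facets-∷ʳ⁺ ((true , x) ∷ u) (inj₁ (there F∈)) with ∈-map⁻ (⁅ x ⁆ ∪_) F∈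
... | F , F∈u , refl = there (∈-map⁺ (⁅ x ⁆ ∪_) (facets-∷ʳ⁺ u (inj₁ F∈u)))
facets-∷ʳ⁺ ((true , x) ∷ u) (inj₂ refl) = there (∈-map⁺ (⁅ x ⁆ ∪_) (facets-∷ʳ⁺ u (inj₂ refl)))

facets-∷ʳ⁻ : (u : Word n) {z : Fin n} {F : Subset n} → F ∈ˡ facets (u ∷ʳ (true , z)) → F ∈ˡ facets (u ∷ʳ (false , z)) ⊎ F ≡ marked u
facets-∷ʳ⁻ [] (here e) = inj₂ e
facets-∷ʳ⁻ ((false , x) ∷ u) F∈ = facets-∷ʳ⁻ u F∈
facets-∷ʳ⁻ ((true , x) ∷ u) (here refl) = inj₁ (here (letters-∷ʳ u))
facets-∷ʳ⁻ ((true , x) ∷ u) (there F∈) with ∈-map⁻ (⁅ x ⁆ ∪_) F∈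
... | F , F∈u , refl = Sum.map (there ∘ ∈-map⁺ (⁅ x ⁆ ∪_)) (cong (⁅ x ⁆ ∪_)) (facets-∷ʳ⁻ u F∈u)

-- With its converse this says that the faces of L lying in B are the proper ones, which is B ∩ L =
-- ∂L.
face-∷ʳ-false⁻ : (u : Word n) {z : Fin n} {σ : Subset n} → Face (u ∷ʳ (false , z)) σ → ∃[ x ] (x ∈ marked u × x ∉ σ)
face-∷ʳ-false⁻ [] (_ , ())
face-∷ʳ-false⁻ ((true , x) ∷ u) (inj₁ x∉) = x , x∈insert , x∉
face-∷ʳ-false⁻ ((true , x) ∷ u) (inj₂ f) = let (y , y∈ , y∉) = face-∷ʳ-false⁻ u f in y , ∈-insert⁺ y∈ , y∉
face-∷ʳ-false⁻ ((false , x) ∷ u) (_ , f) = face-∷ʳ-false⁻ u f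

face-∷ʳ-false⁺ : (u : Word n) {z : Fin n} {σ : Subset n} → Distinct u → (∀ {y} → y ∈ σ → y ∈ letters u → y ∈ marked u) →
                 ∃[ x ] (x ∈ marked u × x ∉ σ) → Face (u ∷ʳ (false , z)) σ
face-∷ʳ-false⁺ [] _ _ (x , x∈ , _) = contradiction x∈ ∉⊥
face-∷ʳ-false⁺ ((true , x) ∷ u) (x∉u , d) H (y , y∈ , y∉) with ∈-insert⁻ y∈
... | inj₁ refl = inj₁ y∉
... | inj₂ y∈u  = inj₂ (face-∷ʳ-false⁺ u d (λ z∈ z∈u → [ (λ { refl → contradiction z∈u x∉u }) , (λ w → w) ]′ (∈-insert⁻ (H z∈ (∈-insert⁺ z∈u)))) (y , y∈u , y∉))
face-∷ʳ-false⁺ ((false , x) ∷ u) (x∉u , d) H m = (λ x∈ → x∉u (marked-⊆ u (H x∈ x∈insert))) , face-∷ʳ-false⁺ u d (λ z∈ z∈u → H z∈ (∈-insert⁺ z∈u)) m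

-- For j = 0 no mark remains once the last letter is unmarked. Otherwise the first mark survives; it
-- determines `top`, so the ball B has the dimension of the sphere.
record SphereWord {n} (j : ℕ) (w : Word n) : Set where
  field
    init   : Word n
    last   : Fin n
    split  : w ≡ init ∷ʳ (true , last)
    size   : Distinct init → ∣ marked init ∣ ≡ j
    kind   : (j ≡ 0 × Unmarked (init ∷ʳ (false , last))) ⊎ (Ball (init ∷ʳ (false , last)) × top (init ∷ʳ (true , last)) ≡ top (init ∷ʳ (false , last)))

sphere-word : ∀ {j} {w : Word n} → Sphere j w → SphereWord j w
sphere-word {n} (base x) = record { init = [] ; last = x ; split = refl ; size = λ _ → ∣⊥∣≡0 n ; kind = inj₁ (refl , x ∷ []) }
sphere-word (skip x s) = record
  { init = (false , x) ∷ init ; last = last ; split = cong ((false , x) ∷_) split ; size = λ (_ , d) → size d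
  ; kind = Sum.map (λ (e , u) → e , x ∷ u) (λ (b , t) → cons false x b , t) kind }
  where open SphereWord (sphere-word s)
sphere-word (mark x s) = record
  { init = (true , x) ∷ init ; last = last ; split = cong ((true , x) ∷_) split
  ; size = λ (x∉ , d) → trans (∣insert∣ (λ x∈ → x∉ (marked-⊆ init x∈))) (cong suc (size d))
  ; kind = inj₂ ([ (λ (_ , u) → unmarked-ball (init ∷ʳ (false , last)) u (∷ʳ≢[] init)) , cons true x ∘ proj₁ ]′ kind ,
                 trans (Listₚ.length-++ init) (sym (Listₚ.length-++ init))) }
  where
  open SphereWord (sphere-word s)
  ∷ʳ≢[] : ∀ {A : Set} (u : List A) {z} → u ∷ʳ z ≢ []
  ∷ʳ≢[] [] ()
  ∷ʳ≢[] (_ ∷ _) ()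
  unmarked-ball : ∀ w → Unmarked w → w ≢ [] → Ball ((true , x) ∷ w)
  unmarked-ball _ [] ne = contradiction refl ne
  unmarked-ball _ (y ∷ u) _ = base x y u

sphere-decomposes : ∀ {k} {u : Word n} {z : Fin n} {K : Complex n} → Distinct (u ∷ʳ (true , z)) → Encodes (u ∷ʳ (true , z)) K → ∣ marked u ∣ ≡ suc k →
  TopGenerated ⟦ u ∷ʳ (false , z) ⟧ K × IsCombBall k (Δ (marked u)) × TopGenerated (Δ (marked u)) K ×
  ((⟦ u ∷ʳ (false , z) ⟧ +ₖ Δ (marked u)) ≈ₖ K) × ((⟦ u ∷ʳ (false , z) ⟧ ∩ₖ Δ (marked u)) ≈ₖ ∂ k (Δ (marked u)))
sphere-decomposes {n} {k} {u} {z} {K} d enc size = B-top , simplex-combBall (marked u) size , L-top , union , boundary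
  where
  wT = u ∷ʳ (true , z)
  wF = u ∷ʳ (false , z)
  M = marked u
  dF : Distinct wF
  dF = Distinct-∷ʳ u d
  encF : Encodes wF ⟦ wF ⟧
  encF = encodes-⟦⟧ wF
  B-top : TopGenerated ⟦ wF ⟧ K
  B-top σ pr = facet-principal wT d enc (facets-∷ʳ⁺ u (inj₁ (principal-facet wF dF encF pr)))
  M-facet : M ∈ˡ facets wT
  M-facet = facets-∷ʳ⁺ u {z} (inj₂ refl)
  L-top : TopGenerated (Δ M) K
  L-top σ pr = let (mkPrincipal Δσ max) = principal⁻ {K = Δ M} pr in
    subst (λ σ → principal K σ ≡ true) (sym (max (⊆ᵇ⁺ {σ = M} (λ x → x)) (⊆ᵇ⁻ {σ = σ} Δσ))) (facet-principal wT d enc M-facet)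
  union : (⟦ wF ⟧ +ₖ Δ M) ≈ₖ K
  union σ = ≡true-ext to from
    where
    below : ∀ {F} → F ∈ˡ facets wT → σ ⊆ F → K σ ≡ true
    below {F} F∈ σ⊆ = encodes-complex wT enc F σ (facet-in wT d enc F∈) σ⊆
    to : (⟦ wF ⟧ +ₖ Δ M) σ ≡ true → K σ ≡ true
    to e with ∨⁻ {⟦ wF ⟧ σ} e
    ... | inj₁ Bσ = let (F , F∈ , σ⊆F) = facet-above wF dF encF Bσ in below (facets-∷ʳ⁺ u (inj₁ F∈)) σ⊆F
    ... | inj₂ Lσ = below M-facet (⊆ᵇ⁻ {σ = σ} Lσ)
    from : K σ ≡ true → (⟦ wF ⟧ +ₖ Δ M) σ ≡ true
    from Kσ with facet-above wT d enc Kσ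
    ... | F , F∈ , σ⊆F with facets-∷ʳ⁻ u F∈
    ... | inj₁ F∈F  = ∨⁺ˡ (encodes-complex wF encF F σ (facet-in wF dF encF F∈F) σ⊆F)
    ... | inj₂ refl = ∨⁺ʳ {⟦ wF ⟧ σ} (⊆ᵇ⁺ σ⊆F)
  boundary : (⟦ wF ⟧ ∩ₖ Δ M) ≈ₖ ∂ k (Δ M)
  boundary σ = ≡true-ext to from
    where
    to : (⟦ wF ⟧ ∩ₖ Δ M) σ ≡ true → ∂ k (Δ M) σ ≡ true
    to e = let (Bσ , Lσ) = ∧⁻ {⟦ wF ⟧ σ} e ; (x , x∈ , x∉) = face-∷ʳ-false⁻ u (proj₂ (to⇔ (encF σ) Bσ)) in
      ∂-simplex⁺ size (⊆ᵇ⁻ {σ = σ} Lσ) x∈ x∉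
    from : ∂ k (Δ M) σ ≡ true → (⟦ wF ⟧ ∩ₖ Δ M) σ ≡ true
    from e = let (σ⊆M , miss) = ∂-simplex⁻ size {σ} e in
      ∧⁺ (from⇔ (encF σ) ((λ y∈ → letters-init u (marked-⊆ u (σ⊆M y∈))) , face-∷ʳ-false⁺ u (Distinct-init u d) (λ y∈ _ → σ⊆M y∈) miss)) (⊆ᵇ⁺ σ⊆M)

ball-upTo : ∀ {d d′} {K : Complex n} → d′ ≤ d → NHBall d′ K → BallUpTo d K
ball-upTo {d = zero} z≤n b = b
ball-upTo {d = suc d} d′≤ b with ℕₚ.m≤n⇒m<n∨m≡n d′≤
... | inj₁ (s≤s d′≤d) = inj₁ (ball-upTo d′≤d b)
... | inj₂ refl       = inj₂ b

sphere-upTo : ∀ {d d′ k} {K : Complex n} → d′ ≤ d → NHSphere d′ k K → SphereUpTo d K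
sphere-upTo {d = zero} {k = k} z≤n s = k , s
sphere-upTo {d = suc d} {k = k} d′≤ s with ℕₚ.m≤n⇒m<n∨m≡n d′≤
... | inj₁ (s≤s d′≤d) = inj₁ (sphere-upTo d′≤d s)
... | inj₂ refl       = inj₂ (k , s)

ball-marked : {w : Word n} → Ball w → ¬ Unmarked w
ball-marked (cons false x b) (_ ∷ u) = ball-marked b u

sphere-marked : ∀ {j} {w : Word n} → Sphere j w → ¬ Unmarked w
sphere-marked (skip x s) (_ ∷ u) = sphere-marked s u

ball-length : {w : Word n} → Ball w → 2 ≤ length w
ball-length (base _ _ _) = s≤s (s≤s z≤n)
ball-length (cons _ _ b) = ℕₚ.m≤n⇒m≤1+n (ball-length b)

ball-top : {w : Word n} → Ball w → 1 ≤ top w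
ball-top (base _ _ _)     = s≤s z≤n
ball-top (cons true _ b)  = ℕₚ.≤-trans (s≤s z≤n) (ball-length b)
ball-top (cons false _ b) = ball-top b

sphere-nonempty : ∀ {j} {w : Word n} → Sphere j w → 1 ≤ length w
sphere-nonempty (base _)   = s≤s z≤n
sphere-nonempty (mark _ _) = s≤s z≤n
sphere-nonempty (skip _ _) = s≤s z≤n

sphere-top : ∀ {k} {w : Word n} → Sphere (suc k) w → 1 ≤ top w
sphere-top (mark _ s) = sphere-nonempty s
sphere-top (skip _ s) = sphere-top s

emptySphere : {w : Word n} {K : Complex n} → Sphere 0 w → Distinct w → Encodes w K → IsEmptySimplexOnly K
emptySphere (skip x s) d@(_ , d′) enc = emptySphere s d′ (encodes-tail d enc)
emptySphere {K = K} (base x) _ enc σ = mk⇔ to from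
  where
  to : K σ ≡ true → σ ≡ ⊥
  to Kσ with to⇔ (enc σ) Kσ
  ... | σ⊆ , inj₁ x∉ = Empty-unique λ (y , y∈) → ∉⊥ (⊆-letters-tail {b = true} {x} {[]} σ⊆ x∉ y∈)
  from : σ ≡ ⊥ → K σ ≡ true
  from refl = from⇔ (enc ⊥) (⊥⊆ , inj₁ ∉⊥)

pointBall : {w : Word n} {K : Complex n} → Ball w → Distinct w → Encodes w K → top w ≡ 1 → IsPoint K
pointBall (cons false x b) d@(_ , d′) enc t = pointBall b d′ (encodes-tail d enc) t
pointBall (cons true x b) _ _ t = contradiction (subst (2 ≤_) t (ball-length b)) (ℕₚ.<⇒≱ ℕₚ.≤-refl)
pointBall {K = K} (base x y []) (x∉ , _) enc _ = y , λ σ → mk⇔ (to σ) (from σ)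
  where
  to : ∀ σ → K σ ≡ true → σ ⊆ ⁅ y ⁆
  to σ Kσ {z} z∈ with to⇔ (enc σ) Kσ
  ... | σ⊆ , inj₁ x∉σ = subst (z ∈_) (∪-identityʳ ⁅ y ⁆) (⊆-letters-tail {b = true} {x} {(false , y) ∷ []} σ⊆ x∉σ z∈)
  from : ∀ σ → σ ⊆ ⁅ y ⁆ → K σ ≡ true
  from σ σ⊆ = from⇔ (enc σ) ((λ {z} z∈ → ∈-insert⁺ (inY z∈)) , inj₁ (λ x∈ → x∉ (inY x∈)))
    where
    inY : ∀ {z} → z ∈ σ → z ∈ ⁅ y ⁆ ∪ ⊥
    inY {z} z∈ = subst (z ∈_) (sym (∪-identityʳ ⁅ y ⁆)) (σ⊆ z∈)

twoPoints : ∀ {k} {w : Word n} {K : Complex n} → Sphere (suc k) w → Distinct w → Encodes w K → top w ≡ 1 → k ≡ 0 × IsTwoPoints K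
twoPoints (skip x s) d@(_ , d′) enc t = twoPoints s d′ (encodes-tail d enc) t
twoPoints (mark x (mark y s)) _ _ t = contradiction (sphere-nonempty s) (λ l → ℕₚ.<⇒≱ l (ℕₚ.≤-pred (ℕₚ.≤-reflexive t)))
twoPoints (mark x (skip y s)) _ _ t = contradiction (sphere-nonempty s) (λ l → ℕₚ.<⇒≱ l (ℕₚ.≤-pred (ℕₚ.≤-reflexive t)))
twoPoints {K = K} (mark x (base y)) (x∉ , _) enc _ = refl , x , y , (λ { refl → x∉ x∈insert }) , λ σ → mk⇔ (to σ) (from σ)
  where
  x≢y : x ≢ y
  x≢y refl = x∉ x∈insert
  cases : ∀ {σ z} → σ ⊆ ⁅ x ⁆ ∪ (⁅ y ⁆ ∪ ⊥) → z ∈ σ → z ≡ x ⊎ z ≡ y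
  cases σ⊆ z∈ = Sum.map₂ (λ z∈′ → [ (λ e → e) , (λ z∈⊥ → contradiction z∈⊥ ∉⊥) ]′ (∈-insert⁻ z∈′)) (∈-insert⁻ (σ⊆ z∈))
  to : ∀ σ → K σ ≡ true → σ ⊆ ⁅ x ⁆ ⊎ σ ⊆ ⁅ y ⁆
  to σ Kσ with to⇔ (enc σ) Kσ
  ... | σ⊆ , inj₁ x∉σ = inj₂ (λ {z} z∈ → [ (λ { refl → contradiction z∈ x∉σ }) , (λ { refl → x∈⁅x⁆ y }) ]′ (cases {σ} {z} σ⊆ z∈))
  ... | σ⊆ , inj₂ (inj₁ y∉σ) = inj₁ (λ {z} z∈ → [ (λ { refl → x∈⁅x⁆ x }) , (λ { refl → contradiction z∈ y∉σ }) ]′ (cases {σ} {z} σ⊆ z∈))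
  from : ∀ σ → σ ⊆ ⁅ x ⁆ ⊎ σ ⊆ ⁅ y ⁆ → K σ ≡ true
  from σ (inj₁ σ⊆) = from⇔ (enc σ) ((λ {z} z∈ → subst (_∈ ⁅ x ⁆ ∪ (⁅ y ⁆ ∪ ⊥)) (sym (x∈⁅y⁆⇒x≡y x (σ⊆ z∈))) x∈insert) , inj₂ (inj₁ (λ y∈ → x≢y (sym (x∈⁅y⁆⇒x≡y x (σ⊆ y∈))))))
  from σ (inj₂ σ⊆) = from⇔ (enc σ) ((λ {z} z∈ → subst (_∈ ⁅ x ⁆ ∪ (⁅ y ⁆ ∪ ⊥)) (sym (x∈⁅y⁆⇒x≡y y (σ⊆ z∈))) (∈-insert⁺ x∈insert)) , inj₁ (λ x∈ → x≢y (x∈⁅y⁆⇒x≡y y (σ⊆ x∈))))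

mutual
  -- `N` is the termination measure, a bound on the length less 1. A ball or sphere is shown to be a
  -- manifold for the same `N`, and the ball B of a sphere has a word of equal length; only the
  -- passage to a vertex link, whose word is one letter shorter, lowers `N`.
  word-ball : ∀ N (w : Word n) {K : Complex n} → length w ≤ suc N → Distinct w → Encodes w K → Ball w → ∀ {d} → top w ≡ suc d → NHBall d K
  word-ball N w _ dist enc b {zero} t = encodes-complex w enc , pointBall b dist enc t
  word-ball N w {K} l dist enc b {suc d} t = word-manifold N w l dist enc (ball-marked b) t ,
    _ , K , δ , identity-subdivision (encodes-complex w enc) , ball-collapses b dist enc

  word-sphere : ∀ N (w : Word n) {K : Complex n} → length w ≤ suc N → Distinct w → Encodes w K → ∀ {k} → Sphere (suc k) w → ∀ {d} → top w ≡ suc d → NHSphere d k K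
  word-sphere N w _ dist enc s {zero} t = let (k≡0 , two) = twoPoints s dist enc t in k≡0 , encodes-complex w enc , two
  word-sphere N w l dist enc {k} s {suc d} t with sphere-word s
  ... | record { init = u ; last = z ; split = refl ; size = size ; kind = inj₂ (b , tops) } =
    let (B-top , L-ball , L-top , union , boundary) = sphere-decomposes {u = u} {z} dist enc (size (Distinct-init u dist)) in
    word-manifold N w l dist enc (sphere-marked s) t ,
    ⟦ u ∷ʳ (false , z) ⟧ , Δ (marked u) ,
    word-ball N (u ∷ʳ (false , z)) (subst (_≤ suc N) (trans (Listₚ.length-++ u) (sym (Listₚ.length-++ u))) l) (Distinct-∷ʳ u dist) (encodes-⟦⟧ (u ∷ʳ (false , z))) b (trans (sym tops) t) ,
    B-top , L-ball , L-top , union , boundary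

  word-manifold : ∀ N (w : Word n) {K : Complex n} → length w ≤ suc N → Distinct w → Encodes w K → ¬ Unmarked w → ∀ {d} → top w ≡ suc (suc d) → NHManifold (suc d) K
  word-manifold zero w l dist _ mk t with top-face w dist mk
  -- A word of length at most 1 leaves no room for a face with two vertices.
  ... | _ , _ , f , _ = contradiction (ℕₚ.≤-trans (subst (_< length w) t (top<length w f)) l) (ℕₚ.<⇒≱ (s≤s (s≤s z≤n)))
  word-manifold (suc N) w {K} l dist enc mk {d} t = encodes-complex w enc , dim , λ v Kv → link v Kv (proj₁ (to⇔ (enc ⁅ v ⁆) Kv) (x∈⁅x⁆ v))
    where
    dim : HasDim K (suc d)
    dim = encodes-dim w dist enc mk t
    link : ∀ v → K ⁅ v ⁆ ≡ true → v ∈ letters w → LinkOK d (lk v K)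
    link v Kv v∈ = go (classify w′)
      where
      w′ = linkWord v w
      dist′ : Distinct w′
      dist′ = Distinct-link v w dist v∈
      enc′ : Encodes w′ (lk v K)
      enc′ = encodes-link v w dist v∈ enc
      l′ : length w′ ≤ suc N
      l′ = ℕₚ.≤-pred (subst (_≤ suc (suc N)) (sym (length-link v w v∈)) l)
      -- A largest face of the link together with v is a face of K, which bounds the dimension of
      -- the link by d.
      bound : ¬ Unmarked w′ → ∀ {d′} → top w′ ≡ suc d′ → d′ ≤ d
      bound mk′ t′ with top-face w′ dist′ mk′
      ... | σ , σ⊆ , f , size = let (Kvσ , v∉) = lk⁻ {K = K} {v} {σ} (from⇔ (enc′ σ) ((λ y∈ → σ⊆ y∈) , f)) in
        ℕₚ.≤-pred (ℕₚ.≤-pred (subst (_≤ suc (suc d)) (trans (∣insert∣ v∉) (cong suc (trans size t′))) (proj₂ dim (⁅ v ⁆ ∪ σ) Kvσ)))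
      pred : ∀ {a} → 1 ≤ a → ∃[ b ] a ≡ suc b
      pred (s≤s _) = _ , refl
      go : Unmarked w′ ⊎ Ball w′ ⊎ ∃[ j ] Sphere j w′ → LinkOK d (lk v K)
      -- The link contains the empty simplex because v is a vertex, whereas an unmarked word has no
      -- faces at all.
      go (inj₁ un) = contradiction (proj₂ (to⇔ (enc′ ⊥) (lk⁺ {K = K} {v} {⊥} (trans (cong K (∪-identityʳ ⁅ v ⁆)) Kv) ∉⊥))) (unmarked-face un)
      go (inj₂ (inj₁ b)) = let (d′ , t′) = pred (ball-top b) in
        inj₁ (ball-upTo (bound (ball-marked b) t′) (word-ball N w′ l′ dist′ enc′ b t′))
      go (inj₂ (inj₂ (zero , s))) = inj₂ (inj₂ (emptySphere s dist′ enc′))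
      go (inj₂ (inj₂ (suc k , s))) = let (d′ , t′) = pred (sphere-top s) in
        inj₂ (inj₁ (sphere-upTo (bound (sphere-marked s) t′) (word-sphere N w′ l′ dist′ enc′ s t′)))

-- Minimality of word complexes and the theorem

∷ʳ-sphere : (u : Word n) (z : Fin n) → ∃[ j ] Sphere j (u ∷ʳ (true , z))
∷ʳ-sphere []                z = zero , base z
∷ʳ-sphere ((true , x) ∷ u)  z = let (j , s) = ∷ʳ-sphere u z in suc j , mark x s
∷ʳ-sphere ((false , x) ∷ u) z = let (j , s) = ∷ʳ-sphere u z in j , skip x s

-- With k + 1 marks before the last there are k + 2 facets, one per mark, while L is spanned by
-- those k + 1 letters and has dimension k.
word-minimal : (u : Word n) (z : Fin n) {K : Complex n} → Distinct (u ∷ʳ (true , z)) → Encodes (u ∷ʳ (true , z)) K → IsMinimalNHSphere K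
word-minimal u z {K} dist enc = go (∷ʳ-sphere u z)
  where
  w = u ∷ʳ (true , z)
  go : ∃[ j ] Sphere j w → IsMinimalNHSphere K
  go (zero , s) = inj₁ (emptySphere s dist enc)
  go (suc k , s) with top w in t | sphere-top s
  ... | suc d | _ = inj₂ (d , k , word-sphere (length w) w (ℕₚ.n≤1+n (length w)) dist enc s t ,
    trans (m-facets w dist enc) (trans (sphere-facets s) (ℕₚ.+-comm 2 k)))

dual-minimal : {K : Complex n} {V : Subset n} → (∀ {v} → K ⁅ v ⁆ ≡ true → v ∈ V) → ∃[ x ] x ∈ V → IsMinimalNHSphere K → IsMinimalNHSphere (dualW K V)
dual-minimal {K = K} {V} inV nonempty minimal =
  let (u , z , enc , dist , letters-V) = NestedWord.nested-word (minimal⇒nested inV nonempty minimal)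
  in word-minimal (flipped u) z (Distinct-flipped u z dist) (encodes-dual u z letters-V enc)

-- Pointwise equal complexes are not equal without function extensionality. An encoding word depends
-- on the simplices only and gives minimality back for K′, so the inductive definition of NH-spheres
-- need not be transported.
minimal-resp : {K K′ : Complex n} → K ≈ₖ K′ → {V : Subset n} → (∀ {v} → K ⁅ v ⁆ ≡ true → v ∈ V) → ∃[ x ] x ∈ V → IsMinimalNHSphere K → IsMinimalNHSphere K′
minimal-resp K≈K′ inV nonempty minimal =
  let (u , z , enc , dist , _) = NestedWord.nested-word (minimal⇒nested inV nonempty minimal)
  in word-minimal u z dist (λ σ → mk⇔ (λ K′σ → to⇔ (enc σ) (trans (K≈K′ σ) K′σ)) (λ f → trans (sym (K≈K′ σ)) (from⇔ (enc σ) f)))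

dual-vertex : {K : Complex n} {V : Subset n} {v : Fin n} → dualW K V ⁅ v ⁆ ≡ true → v ∈ V
dual-vertex {V = V} {v} e = ⊆ᵇ⁻ {σ = ⁅ v ⁆} {V} (proj₁ (∧⁻ e)) (x∈⁅x⁆ v)

double-dual : {K : Complex n} {V : Subset n} → (∀ {σ} → K σ ≡ true → σ ⊆ V) → dualW (dualW K V) V ≈ₖ K
double-dual {K = K} {V} inV σ = ≡true-ext to from
  where
  complement : ∀ {σ} → σ ⊆ V → V ∩ ∁ (V ∩ ∁ σ) ≡ σ
  complement {σ} σ⊆V = ⊆-antisym
    (λ {y} y∈ → let (y∈V , y∈∁) = x∈p∩q⁻ V (∁ (V ∩ ∁ σ)) y∈ in
      decidable-stable (y ∈? σ) (λ y∉ → x∈∁p⇒x∉p y∈∁ (x∈p∩q⁺ (y∈V , x∉p⇒x∈∁p y∉))))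
    (λ {y} y∈ → x∈p∩q⁺ (σ⊆V y∈ , x∉p⇒x∈∁p (λ y∈′ → x∈∁p⇒x∉p (proj₂ (x∈p∩q⁻ V (∁ σ) y∈′)) y∈)))
  to : dualW (dualW K V) V σ ≡ true → K σ ≡ true
  to e = let (σ⊆ , ¬dual) = ∧⁻ {σ ⊆ᵇ V} e ; σ⊆V = ⊆ᵇ⁻ {σ = σ} {V} σ⊆ in
    decidable-stable (K σ Boolₚ.≟ true) (λ ¬K → not⁻ ¬dual (∧⁺ (⊆ᵇ⁺ (p∩q⊆p V (∁ σ))) (not⁺ (λ K∁ → ¬K (trans (cong K (sym (complement σ⊆V))) K∁)))))
  from : K σ ≡ true → dualW (dualW K V) V σ ≡ true
  from Kσ = ∧⁺ (⊆ᵇ⁺ (inV Kσ)) (not⁺ (λ dual → not⁻ (proj₂ (∧⁻ {(V ∩ ∁ σ) ⊆ᵇ V} dual)) (trans (cong K (complement (inV Kσ))) Kσ)))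

∈-vertices : {K : Complex n} {v : Fin n} → K ⁅ v ⁆ ≡ true → v ∈ vertices K
∈-vertices {v = v} Kv = Vecₚ.lookup⇒[]= v _ (trans (Vecₚ.lookup∘tabulate _ v) Kv)

theorem3p6 : ∀ {n} (K : Complex n) (τ : Subset n) → IsComplex K
    → (∀ v → v ∈ τ → v ∉ vertices K)
    → ∃[ v ] (v ∈ (vertices K ∪ τ))
    → (IsMinimalNHSphere K ⇔ IsMinimalNHSphere (dualτ K τ))
theorem3p6 K τ complex _ nonempty = mk⇔ (dual-minimal vertex∈ nonempty)
  -- The second dual is taken in the same V, even if the first one has fewer vertices, so that K
  -- returns.
  (λ minimal → minimal-resp (double-dual simplex⊆) (dual-vertex {K = dualW K V}) nonempty (dual-minimal (dual-vertex {K = K}) nonempty minimal))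
  where
  V = vertices K ∪ τ
  vertex∈ : ∀ {v} → K ⁅ v ⁆ ≡ true → v ∈ V
  vertex∈ Kv = p⊆p∪q τ (∈-vertices {K = K} Kv)
  simplex⊆ : ∀ {σ} → K σ ≡ true → σ ⊆ V
  simplex⊆ {σ} Kσ {v} v∈ = vertex∈ (complex σ ⁅ v ⁆ Kσ (⁅⁆-⊆ v∈))
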